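{- Fix integers $2\le r\le k$ with $r\ge 3$ or $k\ge 4$. There is a constant $c=c(k,r)>0$ such that every $k$-uniform hypergraph with $m$ edges has an $r$-cut with excess at least $c\,m^{5/9}$.
   Context: For $2\le r\le k$, an $r$-cut of a $k$-uniform hypergraph $H$ is a partition of $V(H)$ into $r$ labelled parts; its size is the number of edges that have a vertex in every part. The excess of an $r$-cut of an $m$-edge $k$-uniform hypergraph is its size minus $\frac{S(k,r)r!}{r^k}m$, where $S(k,r)$ is the Stirling number of the second kind (the number of partitions of $\{1,\dots,k\}$ into $r$ nonempty unlabelled sets); $\frac{S(k,r)r!}{r^k}m$ is the expected size of a uniformly random $r$-cut. -}

module Defs where

open import Data.Nat as ℕ using (ℕ; zero; suc; _+_; _^_; _!)
open import Data.Bool.ListAction using (all; any)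
open import Data.Bool using (Bool; true; false; _∧_; if_then_else_)
open import Data.Fin using (Fin; _≟_)
open import Data.Fin.Subset using (Subset; ∣_∣)
open import Data.Vec using (lookup)
open import Data.List using (List; length; filterᵇ; allFin)
open import Data.List.Relation.Unary.All using (All)
open import Data.List.Relation.Unary.Unique.Propositional using (Unique)
open import Data.Integer using (+_)
open import Data.Rational using (ℚ; 0ℚ; 1ℚ; _/_; _-_; _*_)
open import Relation.Nullary.Decidable using (⌊_⌋)
open import Relation.Binary.PropositionalEquality using (_≡_)

stirling2 : ℕ → ℕ → ℕ
stirling2 zero zero = 1
stirling2 zero (suc j) = 0
stirling2 (suc n) zero = 0
stirling2 (suc n) (suc j) = suc j ℕ.* stirling2 n (suc j) + stirling2 n j

record Hypergraph (k : ℕ) : Set where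
  field
    n       : ℕ
    edges   : List (Subset n)
    uniform : All (λ e → ∣ e ∣ ≡ k) edges
    simple  : Unique edges

open Hypergraph public

numEdges : ∀ {k} → Hypergraph k → ℕ
numEdges H = length (edges H)

-- an r-cut: a partition of V(H) into r labelled parts (parts may be empty)
Cut : ∀ {k} → Hypergraph k → ℕ → Set
Cut H r = Fin (n H) → Fin r

meets : ∀ {m r} → (Fin m → Fin r) → Subset m → Fin r → Bool
meets {m} f e i = any (λ v → lookup e v ∧ ⌊ f v ≟ i ⌋) (allFin m)

isCutEdge : ∀ {m r} → (Fin m → Fin r) → Subset m → Bool
isCutEdge {r = r} f e = all (meets f e) (allFin r)

cutSize : ∀ {k} (H : Hypergraph k) {r} → Cut H r → ℕ
cutSize H f = length (filterᵇ (isCutEdge f) (edges H))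

-- a / d as a rational, with the (unused) convention a / 0 = 0
_/ℕ_ : ℕ → ℕ → ℚ
a /ℕ zero = 0ℚ
a /ℕ suc d = (+ a) / suc d

excess : ∀ {k} (H : Hypergraph k) (r : ℕ) → Cut H r → ℚ
excess {k} H r f =
  (cutSize H f /ℕ 1) - ((stirling2 k r ℕ.* (r !) ℕ.* numEdges H) /ℕ (r ^ k))

_^ℚ_ : ℚ → ℕ → ℚ
q ^ℚ zero = 1ℚ
q ^ℚ suc j = q * (q ^ℚ j)

{-# OPTIONS --safe #-}
-- Give each vertex v the colour distribution 1/r + t_v w for a fixed direction w and weights |t_v| ≤ 1.  The expected
-- excess is a multi-affine form Σ_e Σ_{S ⊆ e} γ_|S| Π_{v ∈ S} t_v with γ_0 = γ_1 = 0, γ_2 < 0 and γ_{ℓ+1} ≠ 0 for some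
-- ℓ ≥ 2 (here r ≥ 3 or k ≥ 4 is used), so it suffices to find weights making this form at least c d⁵, where d ~ m^{1/9}.
-- If d⁴ disjoint pairs have codegree at least d, opposite random weights on each pair gain d⁵.  Otherwise O(d⁴)
-- vertices A meet all such pairs and all vertices of degree much larger than d⁵.  If A meets half of the edges, random
-- signs on A (or on part of it), and a small negative multiple of their mean on the other vertices, gain m / |A|.  If not,
-- split the vertices outside A at random into signed and free ones; each free vertex v takes its degree-ℓ linear
-- coefficient a_v, divided by K d⁴ and truncated to [-1, 1].  The first-order gain is of order Σ E a_v² / d⁴ ≥ c m / d⁴.
-- The quadratic loss is small because bounded codegrees make the a_v nearly uncorrelated, and the truncation error is
-- controlled by fourth moments (Bonami's lemma).
module Submission where

open import Defs
open import Data.Nat using (ℕ; _≤_)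
open import Data.Sum using (_⊎_)
open import Data.Product using (Σ; ∃-syntax; _×_)
open import Data.Rational using (ℚ; 0ℚ; _*_; _<_) renaming (_≤_ to _≤ℚ_)

open import Defs using () renaming (_^ℚ_ to infixr 8 _^_)
open import Data.Bool using (Bool; true; false; _∧_; _∨_; _xor_; not; if_then_else_)
import Data.Bool.Properties as Bool
open import Data.Bool.ListAction using (all; any)
open import Data.Empty using (⊥; ⊥-elim)
open import Data.Fin using (Fin; zero; suc)
import Data.Fin as Fin
import Data.Fin.Properties as Fin
import Data.Fin.Subset as Sub
import Data.Integer as ℤ
import Data.Integer.Properties as ℤ
open import Data.List as List using (List; []; _∷_; length; allFin; tabulate; _++_)
import Data.List.Properties as List
open import Data.List.Membership.Propositional using (_∈_)
open import Data.List.Membership.Propositional.Properties using (∈-++⁺ˡ; ∈-++⁺ʳ; ∈-++⁻; ∈-map⁺; ∈-map⁻; ∈-allFin)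
open import Data.List.Relation.Unary.All as All using (All)
open import Data.List.Relation.Unary.Any using (here; there)
open import Data.Nat as ℕ using (zero; suc; z≤n; s≤s; _!)
import Data.Nat.Properties as ℕ
open import Data.Nat.Tactic.RingSolver using () renaming (solve-∀ to solveℕ-∀)
open import Data.Product using (_,_; proj₁; proj₂)
open import Data.Rational using (1ℚ; ½; _+_; _-_; -_; ∣_∣)
import Data.Rational as ℚ
import Data.Rational.Properties as ℚ
import Data.Rational.Unnormalised as ℚᵘ
import Data.Rational.Unnormalised.Properties as ℚᵘ
open import Data.Sum using (inj₁; inj₂; [_,_]′)
open import Data.Unit using (⊤; tt)
open import Data.Vec as Vec using (Vec; []; _∷_; lookup)
import Data.Vec.Properties as Vec
open import Function using (_∘_; id)
open import Level using (0ℓ)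
open import Relation.Binary.PropositionalEquality using (_≡_; _≢_; refl; sym; trans; cong; cong₂; subst; subst₂)
open import Relation.Nullary using (¬_; Dec; yes; no)
open import Relation.Nullary.Decidable using (dec⇒maybe; ⌊_⌋; _×-dec_; ¬?)
open import Tactic.RingSolver using (solve-∀)
open import Tactic.RingSolver.Core.AlmostCommutativeRing using (AlmostCommutativeRing; fromCommutativeRing)

-- The exponent is where the losses still balance. In the last case codegrees are at most d and
-- degrees O(d⁵). Monomials at v with equal signed part lie in edges sharing v and another vertex,
-- so E a_v² = O(d · d⁵) and a_v has typical size d³. With weights a_v / (K d⁴) the truncation loss
-- at v is of order d⁵ · d⁻¹² · d³ · E a_v² = d⁻⁴ E a_v², the same order as the gain; a small
-- constant factor decides. The quadratic loss is of order d⁻⁸ · d² m and has d² to spare. The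
-- condition ℓ ≥ 2 is what lets codegrees control the quadratic loss: if monomials at two different
-- free vertices have the same signed part, their edges share two vertices. For ℓ = 1 they would
-- share only one, and degrees are too large. With two colours the odd levels vanish, so k ≤ 3 would
-- leave nothing beyond the quadratic level, as for cuts of graphs. No square or ninth roots are
-- taken: third moments are split between second and fourth moments at the scale d³, and d is an
-- integer with d⁹ ≤ m < (d + 1)⁹.

ℚ-ring : AlmostCommutativeRing 0ℓ 0ℓ
ℚ-ring = fromCommutativeRing ℚ.+-*-commutativeRing (λ x → dec⇒maybe (0ℚ ℚ.≟ x))

-- Rational arithmetic

2ℚ 3ℚ : ℚ
2ℚ = 1ℚ + 1ℚ
3ℚ = 2ℚ + 1ℚ

0≤1 : 0ℚ ≤ℚ 1ℚ
0≤1 = ℚ.nonNegative⁻¹ 1ℚ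

≤-diff : ∀ {x y} → 0ℚ ≤ℚ y - x → x ≤ℚ y
≤-diff {x} {y} p = subst₂ _≤ℚ_ (ℚ.+-identityˡ x) (eq y x) (ℚ.+-monoˡ-≤ x p)
  where
  eq : ∀ y x → (y - x) + x ≡ y
  eq = solve-∀ ℚ-ring

diff-≥0 : ∀ {x y} → x ≤ℚ y → 0ℚ ≤ℚ y - x
diff-≥0 {x} {y} p = subst (_≤ℚ y - x) (ℚ.+-inverseʳ x) (ℚ.+-monoˡ-≤ (- x) p)

≡⇒≤ : ∀ {x y} → x ≡ y → x ≤ℚ y
≡⇒≤ refl = ℚ.≤-refl

*≥0 : ∀ {x y} → 0ℚ ≤ℚ x → 0ℚ ≤ℚ y → 0ℚ ≤ℚ x * y
*≥0 {x} {y} p q = ℚ.nonNegative⁻¹ (x * y)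
  where instance
    i₁ = ℚ.nonNegative p
    i₂ = ℚ.nonNegative q
    i₃ = ℚ.nonNeg*nonNeg⇒nonNeg x y

*>0 : ∀ {x y} → 0ℚ < x → 0ℚ < y → 0ℚ < x * y
*>0 {x} {y} p q = ℚ.positive⁻¹ (x * y)
  where instance
    i₁ = ℚ.positive p
    i₂ = ℚ.positive q
    i₃ = ℚ.pos*pos⇒pos x y

+≥0 : ∀ {x y} → 0ℚ ≤ℚ x → 0ℚ ≤ℚ y → 0ℚ ≤ℚ x + y
+≥0 {x} {y} p q = subst (_≤ℚ x + y) (ℚ.+-identityˡ 0ℚ) (ℚ.+-mono-≤ p q)

+>0ˡ : ∀ {x y} → 0ℚ < x → 0ℚ ≤ℚ y → 0ℚ < x + y
+>0ˡ {x} {y} p q = subst (_< x + y) (ℚ.+-identityˡ 0ℚ) (ℚ.+-mono-<-≤ p q)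

*-monoˡ : ∀ {c x y} → 0ℚ ≤ℚ c → x ≤ℚ y → c * x ≤ℚ c * y
*-monoˡ {c} p q = ℚ.*-monoˡ-≤-nonNeg c {{ℚ.nonNegative p}} q

*-monoʳ : ∀ {c x y} → 0ℚ ≤ℚ c → x ≤ℚ y → x * c ≤ℚ y * c
*-monoʳ {c} p q = ℚ.*-monoʳ-≤-nonNeg c {{ℚ.nonNegative p}} q

*-mono : ∀ {x x′ y y′} → 0ℚ ≤ℚ y → 0ℚ ≤ℚ x′ → x ≤ℚ x′ → y ≤ℚ y′ → x * y ≤ℚ x′ * y′
*-mono p q r s = ℚ.≤-trans (*-monoʳ p r) (*-monoˡ q s)

neg-anti : ∀ {x y} → x ≤ℚ y → - y ≤ℚ - x
neg-anti = ℚ.neg-antimono-≤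

≤∣∣ : ∀ x → x ≤ℚ ∣ x ∣
≤∣∣ x with ℚ.≤-total 0ℚ x
... | inj₁ p = ≡⇒≤ (sym (ℚ.0≤p⇒∣p∣≡p p))
... | inj₂ p = ℚ.≤-trans p (ℚ.0≤∣p∣ x)

-∣∣≤ : ∀ x → - ∣ x ∣ ≤ℚ x
-∣∣≤ x = subst (- ∣ x ∣ ≤ℚ_) (neg² x) (neg-anti (subst (- x ≤ℚ_) (ℚ.∣-p∣≡∣p∣ x) (≤∣∣ (- x))))
  where
  neg² : ∀ x → - - x ≡ x
  neg² = solve-∀ ℚ-ring

∣∣≤ : ∀ {x y} → x ≤ℚ y → - x ≤ℚ y → ∣ x ∣ ≤ℚ y
∣∣≤ {x} p q with ℚ.∣p∣≡p∨∣p∣≡-p x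
... | inj₁ e = subst (_≤ℚ _) (sym e) p
... | inj₂ e = subst (_≤ℚ _) (sym e) q

∣∣*∣∣ : ∀ x → ∣ x ∣ * ∣ x ∣ ≡ x * x
∣∣*∣∣ x with ℚ.∣p∣≡p∨∣p∣≡-p x
... | inj₁ e = cong₂ _*_ e e
... | inj₂ e = trans (cong₂ _*_ e e) (eq x)
  where
  eq : ∀ x → (- x) * (- x) ≡ x * x
  eq = solve-∀ ℚ-ring

sq≥0 : ∀ x → 0ℚ ≤ℚ x * x
sq≥0 x = subst (0ℚ ≤ℚ_) (∣∣*∣∣ x) (*≥0 (ℚ.0≤∣p∣ x) (ℚ.0≤∣p∣ x))

opaque
  recip : ∀ {x} → 0ℚ < x → ∃[ y ] (0ℚ < y × x * y ≡ 1ℚ)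
  recip {x} p = ℚ.1/_ x {{x≢0}} , ℚ.positive⁻¹ (ℚ.1/_ x {{x≢0}}) {{ℚ.1/pos⇒pos x {{ℚ.positive p}}}} , ℚ.*-inverseʳ x {{x≢0}}
    where
    x≢0 : ℚ.NonZero x
    x≢0 = ℚ.pos⇒nonZero x {{ℚ.positive p}}

^≥0 : ∀ {x} → 0ℚ ≤ℚ x → ∀ n → 0ℚ ≤ℚ x ^ n
^≥0 p zero    = 0≤1
^≥0 p (suc n) = *≥0 p (^≥0 p n)

^>0 : ∀ {x} → 0ℚ < x → ∀ n → 0ℚ < x ^ n
^>0 p zero    = ℚ.positive⁻¹ 1ℚ
^>0 p (suc n) = *>0 p (^>0 p n)

^≤1 : ∀ {x} → 0ℚ ≤ℚ x → x ≤ℚ 1ℚ → ∀ n → x ^ n ≤ℚ 1ℚ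
^≤1 p q zero    = ℚ.≤-refl
^≤1 p q (suc n) = *-mono (^≥0 p n) 0≤1 q (^≤1 p q n)

^-mono : ∀ {x y} → 0ℚ ≤ℚ x → x ≤ℚ y → ∀ n → x ^ n ≤ℚ y ^ n
^-mono p q zero    = ℚ.≤-refl
^-mono p q (suc n) = *-mono (^≥0 p n) (ℚ.≤-trans p q) q (^-mono p q n)

1≤^ : ∀ {x} → 1ℚ ≤ℚ x → ∀ n → 1ℚ ≤ℚ x ^ n
1≤^ p zero    = ℚ.≤-refl
1≤^ p (suc n) = *-mono 0≤1 (ℚ.≤-trans 0≤1 p) p (1≤^ p n)

^-*-distrib : ∀ x y n → (x * y) ^ n ≡ x ^ n * y ^ n
^-*-distrib x y zero    = refl
^-*-distrib x y (suc n) = trans (cong ((x * y) *_) (^-*-distrib x y n)) (eq x y (x ^ n) (y ^ n))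
  where
  eq : ∀ a b c d → (a * b) * (c * d) ≡ (a * c) * (b * d)
  eq = solve-∀ ℚ-ring

1^ : ∀ n → 1ℚ ^ n ≡ 1ℚ
1^ zero    = refl
1^ (suc n) = trans (ℚ.*-identityˡ (1ℚ ^ n)) (1^ n)

-- The naturals in ℚ by recursion instead of through `_/_`, so that cardinalities and list lengths
-- can be treated by induction without normalising fractions; `/ℕ-*` links them to the fractions in
-- `excess`.
⟦_⟧ : ℕ → ℚ
⟦ zero ⟧  = 0ℚ
⟦ suc n ⟧ = 1ℚ + ⟦ n ⟧

⟦⟧≥0 : ∀ n → 0ℚ ≤ℚ ⟦ n ⟧
⟦⟧≥0 zero    = ℚ.≤-refl
⟦⟧≥0 (suc n) = +≥0 0≤1 (⟦⟧≥0 n)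

⟦⟧-mono : ∀ {m n} → m ≤ n → ⟦ m ⟧ ≤ℚ ⟦ n ⟧
⟦⟧-mono {n = n} z≤n = ⟦⟧≥0 n
⟦⟧-mono (s≤s p)     = ℚ.+-monoʳ-≤ 1ℚ (⟦⟧-mono p)

⟦⟧-+ : ∀ m n → ⟦ m ℕ.+ n ⟧ ≡ ⟦ m ⟧ + ⟦ n ⟧
⟦⟧-+ zero n    = sym (ℚ.+-identityˡ ⟦ n ⟧)
⟦⟧-+ (suc m) n = trans (cong (1ℚ +_) (⟦⟧-+ m n)) (sym (ℚ.+-assoc 1ℚ ⟦ m ⟧ ⟦ n ⟧))

⟦⟧-* : ∀ m n → ⟦ m ℕ.* n ⟧ ≡ ⟦ m ⟧ * ⟦ n ⟧
⟦⟧-* zero n    = sym (ℚ.*-zeroˡ ⟦ n ⟧)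
⟦⟧-* (suc m) n = trans (⟦⟧-+ n (m ℕ.* n)) (trans (cong (⟦ n ⟧ +_) (⟦⟧-* m n)) (eq ⟦ m ⟧ ⟦ n ⟧))
  where
  eq : ∀ a b → b + a * b ≡ (1ℚ + a) * b
  eq = solve-∀ ℚ-ring

⟦⟧-^ : ∀ m n → ⟦ m ℕ.^ n ⟧ ≡ ⟦ m ⟧ ^ n
⟦⟧-^ m zero    = ℚ.+-identityʳ 1ℚ
⟦⟧-^ m (suc n) = trans (⟦⟧-* m (m ℕ.^ n)) (cong (⟦ m ⟧ *_) (⟦⟧-^ m n))

ι : Bool → ℚ
ι true  = 1ℚ
ι false = 0ℚ

ι≥0 : ∀ b → 0ℚ ≤ℚ ι b
ι≥0 true  = 0≤1
ι≥0 false = ℚ.≤-refl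

ι≤1 : ∀ b → ι b ≤ℚ 1ℚ
ι≤1 true  = ℚ.≤-refl
ι≤1 false = 0≤1

-- Finite sums

opaque
  ∑ : ∀ {a} {A : Set a} → List A → (A → ℚ) → ℚ
  ∑ []       f = 0ℚ
  ∑ (x ∷ xs) f = f x + ∑ xs f

  ∑-[] : ∀ {a} {A : Set a} (f : A → ℚ) → ∑ [] f ≡ 0ℚ
  ∑-[] f = refl

  ∑-∷ : ∀ {a} {A : Set a} x xs (f : A → ℚ) → ∑ (x ∷ xs) f ≡ f x + ∑ xs f
  ∑-∷ x xs f = refl

  ∑-cong : ∀ {a} {A : Set a} (xs : List A) {f g : A → ℚ} → (∀ {x} → x ∈ xs → f x ≡ g x) → ∑ xs f ≡ ∑ xs g
  ∑-cong []       p = refl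
  ∑-cong (x ∷ xs) p = cong₂ _+_ (p (here refl)) (∑-cong xs (p ∘ there))

  ∑-mono : ∀ {a} {A : Set a} (xs : List A) {f g : A → ℚ} → (∀ {x} → x ∈ xs → f x ≤ℚ g x) → ∑ xs f ≤ℚ ∑ xs g
  ∑-mono []       p = ℚ.≤-refl
  ∑-mono (x ∷ xs) p = ℚ.+-mono-≤ (p (here refl)) (∑-mono xs (p ∘ there))

  ∑≥0 : ∀ {a} {A : Set a} (xs : List A) {f : A → ℚ} → (∀ x → 0ℚ ≤ℚ f x) → 0ℚ ≤ℚ ∑ xs f
  ∑≥0 []       p = ℚ.≤-refl
  ∑≥0 (x ∷ xs) p = +≥0 (p x) (∑≥0 xs p)

  ∑-zero : ∀ {a} {A : Set a} (xs : List A) {f : A → ℚ} → (∀ {x} → x ∈ xs → f x ≡ 0ℚ) → ∑ xs f ≡ 0ℚ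
  ∑-zero []       p = refl
  ∑-zero (x ∷ xs) p = trans (cong₂ _+_ (p (here refl)) (∑-zero xs (p ∘ there))) (ℚ.+-identityˡ 0ℚ)

  ∑-+ : ∀ {a} {A : Set a} (xs : List A) (f g : A → ℚ) → ∑ xs (λ x → f x + g x) ≡ ∑ xs f + ∑ xs g
  ∑-+ []       f g = refl
  ∑-+ (x ∷ xs) f g = trans (cong (f x + g x +_) (∑-+ xs f g)) (eq (f x) (g x) (∑ xs f) (∑ xs g))
    where
    eq : ∀ a b c d → (a + b) + (c + d) ≡ (a + c) + (b + d)
    eq = solve-∀ ℚ-ring

  ∑-*ˡ : ∀ {a} {A : Set a} c (xs : List A) (f : A → ℚ) → ∑ xs (λ x → c * f x) ≡ c * ∑ xs f
  ∑-*ˡ c []       f = sym (ℚ.*-zeroʳ c)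
  ∑-*ˡ c (x ∷ xs) f = trans (cong (c * f x +_) (∑-*ˡ c xs f)) (sym (ℚ.*-distribˡ-+ c (f x) (∑ xs f)))

  ∑-*ʳ : ∀ {a} {A : Set a} c (xs : List A) (f : A → ℚ) → ∑ xs (λ x → f x * c) ≡ ∑ xs f * c
  ∑-*ʳ c xs f = trans (∑-cong xs (λ {x} _ → ℚ.*-comm (f x) c)) (trans (∑-*ˡ c xs f) (ℚ.*-comm c (∑ xs f)))

  ∑-const : ∀ {a} {A : Set a} (xs : List A) c → ∑ xs (λ _ → c) ≡ ⟦ length xs ⟧ * c
  ∑-const []       c = sym (ℚ.*-zeroˡ c)
  ∑-const (x ∷ xs) c = trans (cong (c +_) (∑-const xs c)) (eq c ⟦ length xs ⟧)
    where
    eq : ∀ c l → c + l * c ≡ (1ℚ + l) * c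
    eq = solve-∀ ℚ-ring

  ∑-≤-const : ∀ {a} {A : Set a} (xs : List A) {f : A → ℚ} c → (∀ {x} → x ∈ xs → f x ≤ℚ c) → ∑ xs f ≤ℚ ⟦ length xs ⟧ * c
  ∑-≤-const xs c p = ℚ.≤-trans (∑-mono xs p) (≡⇒≤ (∑-const xs c))

  ∑-++ : ∀ {a} {A : Set a} (xs ys : List A) (f : A → ℚ) → ∑ (xs ++ ys) f ≡ ∑ xs f + ∑ ys f
  ∑-++ []       ys f = sym (ℚ.+-identityˡ _)
  ∑-++ (x ∷ xs) ys f = trans (cong (f x +_) (∑-++ xs ys f)) (sym (ℚ.+-assoc (f x) _ _))

  ∈⇒≤∑ : ∀ {a} {A : Set a} {xs x} (f : A → ℚ) → (∀ y → 0ℚ ≤ℚ f y) → x ∈ xs → f x ≤ℚ ∑ xs f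
  ∈⇒≤∑ {xs = x ∷ xs} f p (here refl) = subst (_≤ℚ f x + ∑ xs f) (ℚ.+-identityʳ (f x)) (ℚ.+-monoʳ-≤ (f x) (∑≥0 xs p))
  ∈⇒≤∑ {xs = x ∷ xs} f p (there i)   = ℚ.≤-trans (∈⇒≤∑ f p i)
    (subst (_≤ℚ f x + ∑ xs f) (ℚ.+-identityˡ _) (ℚ.+-monoˡ-≤ (∑ xs f) (p x)))

  ∣∑∣≤ : ∀ {a} {A : Set a} (xs : List A) (f : A → ℚ) → ∣ ∑ xs f ∣ ≤ℚ ∑ xs (λ x → ∣ f x ∣)
  ∣∑∣≤ []       f = ℚ.≤-refl
  ∣∑∣≤ (x ∷ xs) f = ℚ.≤-trans (ℚ.∣p+q∣≤∣p∣+∣q∣ (f x) (∑ xs f)) (ℚ.+-monoʳ-≤ ∣ f x ∣ (∣∑∣≤ xs f))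

opaque
  unfolding ∑

  ∑-map : ∀ {a b} {A : Set a} {B : Set b} (h : A → B) (xs : List A) (f : B → ℚ) → ∑ (List.map h xs) f ≡ ∑ xs (f ∘ h)
  ∑-map h []       f = refl
  ∑-map h (x ∷ xs) f = cong (f (h x) +_) (∑-map h xs f)

  ∑-swap : ∀ {a b} {A : Set a} {B : Set b} (xs : List A) (ys : List B) (f : A → B → ℚ) →
           ∑ xs (λ x → ∑ ys (f x)) ≡ ∑ ys (λ y → ∑ xs (λ x → f x y))
  ∑-swap []       ys f = sym (∑-zero ys (λ _ → refl))
  ∑-swap (x ∷ xs) ys f = trans (cong (∑ ys (f x) +_) (∑-swap xs ys f))
                               (sym (∑-+ ys (f x) (λ y → ∑ xs (λ x → f x y))))

  ∑-*-∑ : ∀ {a b} {A : Set a} {B : Set b} (xs : List A) (ys : List B) (f : A → ℚ) (g : B → ℚ) →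
          ∑ xs f * ∑ ys g ≡ ∑ xs (λ x → ∑ ys (λ y → f x * g y))
  ∑-*-∑ xs ys f g = trans (sym (∑-*ʳ (∑ ys g) xs f)) (∑-cong xs (λ {x} _ → sym (∑-*ˡ (f x) ys g)))

  ∑-tabulate : ∀ {a} {A : Set a} {n} (h : Fin n → A) (f : A → ℚ) → ∑ (tabulate h) f ≡ ∑ (allFin n) (f ∘ h)
  ∑-tabulate {n = zero}  h f = refl
  ∑-tabulate {n = suc n} h f = cong (f (h zero) +_)
    (trans (∑-tabulate (h ∘ suc) f) (sym (∑-tabulate suc (f ∘ h))))

  ∑-allFin-suc : ∀ n (f : Fin (suc n) → ℚ) → ∑ (allFin (suc n)) f ≡ f zero + ∑ (allFin n) (f ∘ suc)
  ∑-allFin-suc n f = cong (f zero +_) (∑-tabulate suc f)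

-- Averages over the cube

0≤½ : 0ℚ ≤ℚ ½
0≤½ = ℚ.nonNegative⁻¹ ½

½-double : ∀ c → ½ * (c + c) ≡ c
½-double = solve-∀ ℚ-ring

½-avg≤ : ∀ {a b c} → a ≤ℚ c → b ≤ℚ c → ½ * (a + b) ≤ℚ c
½-avg≤ {a} {b} {c} p q = ℚ.≤-trans (*-monoˡ 0≤½ (ℚ.+-mono-≤ p q)) (≡⇒≤ (½-double c))

opaque
  unfolding ∑

  𝔼 : ∀ {n} → (Vec Bool n → ℚ) → ℚ
  𝔼 {zero}  f = f []
  𝔼 {suc n} f = ½ * (𝔼 (λ x → f (true ∷ x)) + 𝔼 (λ x → f (false ∷ x)))

  𝔼-[] : ∀ (f : Vec Bool 0 → ℚ) → 𝔼 f ≡ f []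
  𝔼-[] f = refl

  𝔼-∷ : ∀ {n} (f : Vec Bool (suc n) → ℚ) → 𝔼 f ≡ ½ * (𝔼 (λ x → f (true ∷ x)) + 𝔼 (λ x → f (false ∷ x)))
  𝔼-∷ f = refl

  𝔼-cong : ∀ {n} {f g : Vec Bool n → ℚ} → (∀ x → f x ≡ g x) → 𝔼 f ≡ 𝔼 g
  𝔼-cong {zero}  p = p []
  𝔼-cong {suc n} p = cong (½ *_) (cong₂ _+_ (𝔼-cong (λ x → p (true ∷ x))) (𝔼-cong (λ x → p (false ∷ x))))

  𝔼-mono : ∀ {n} {f g : Vec Bool n → ℚ} → (∀ x → f x ≤ℚ g x) → 𝔼 f ≤ℚ 𝔼 g
  𝔼-mono {zero}  p = p []
  𝔼-mono {suc n} p = *-monoˡ 0≤½ (ℚ.+-mono-≤ (𝔼-mono (λ x → p (true ∷ x))) (𝔼-mono (λ x → p (false ∷ x))))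

  𝔼-const : ∀ {n} c → 𝔼 {n} (λ _ → c) ≡ c
  𝔼-const {zero}  c = refl
  𝔼-const {suc n} c = trans (cong (½ *_) (cong₂ _+_ (𝔼-const {n} c) (𝔼-const {n} c))) (½-double c)

  𝔼-+ : ∀ {n} (f g : Vec Bool n → ℚ) → 𝔼 (λ x → f x + g x) ≡ 𝔼 f + 𝔼 g
  𝔼-+ {zero}  f g = refl
  𝔼-+ {suc n} f g = trans (cong (½ *_) (cong₂ _+_ (𝔼-+ (λ x → f (true ∷ x)) (λ x → g (true ∷ x)))
                                                  (𝔼-+ (λ x → f (false ∷ x)) (λ x → g (false ∷ x)))))
                          (eq (𝔼 (λ x → f (true ∷ x))) (𝔼 (λ x → g (true ∷ x))) (𝔼 (λ x → f (false ∷ x))) (𝔼 (λ x → g (false ∷ x))))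
    where
    eq : ∀ a b c d → ½ * ((a + b) + (c + d)) ≡ ½ * (a + c) + ½ * (b + d)
    eq = solve-∀ ℚ-ring

  𝔼-*ˡ : ∀ {n} c (f : Vec Bool n → ℚ) → 𝔼 (λ x → c * f x) ≡ c * 𝔼 f
  𝔼-*ˡ {zero}  c f = refl
  𝔼-*ˡ {suc n} c f = trans (cong (½ *_) (cong₂ _+_ (𝔼-*ˡ c (λ x → f (true ∷ x))) (𝔼-*ˡ c (λ x → f (false ∷ x))))) (eq c (𝔼 (λ x → f (true ∷ x))) (𝔼 (λ x → f (false ∷ x))))
    where
    eq : ∀ c a b → ½ * (c * a + c * b) ≡ c * (½ * (a + b))
    eq = solve-∀ ℚ-ring

  𝔼-zero : ∀ {n} {f : Vec Bool n → ℚ} → (∀ x → f x ≡ 0ℚ) → 𝔼 f ≡ 0ℚ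
  𝔼-zero {n} p = trans (𝔼-cong p) (𝔼-const {n} 0ℚ)

  𝔼≥0 : ∀ {n} {f : Vec Bool n → ℚ} → (∀ x → 0ℚ ≤ℚ f x) → 0ℚ ≤ℚ 𝔼 f
  𝔼≥0 {n} {f} p = subst (_≤ℚ 𝔼 f) (𝔼-const {n} 0ℚ) (𝔼-mono p)

  𝔼-∑ : ∀ {a} {A : Set a} {n} (xs : List A) (f : A → Vec Bool n → ℚ) →
        𝔼 (λ x → ∑ xs (λ a → f a x)) ≡ ∑ xs (λ a → 𝔼 (f a))
  𝔼-∑ {n = n} []  f = 𝔼-const {n} 0ℚ
  𝔼-∑ (a ∷ xs) f = trans (𝔼-+ (f a) (λ x → ∑ xs (λ a → f a x))) (cong (𝔼 (f a) +_) (𝔼-∑ xs f))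

  -- The probabilistic method: fixing one coordinate at a time to its better value never falls below
  -- the mean.
  𝔼-max : ∀ {n} (f : Vec Bool n → ℚ) → ∃[ x ] 𝔼 f ≤ℚ f x
  𝔼-max {zero}  f = [] , ℚ.≤-refl
  𝔼-max {suc n} f with 𝔼-max (λ x → f (true ∷ x)) | 𝔼-max (λ x → f (false ∷ x))
  ... | x , p | y , q with ℚ.≤-total (f (true ∷ x)) (f (false ∷ y))
  ... | inj₁ r = false ∷ y , ½-avg≤ (ℚ.≤-trans p r) q
  ... | inj₂ r = true ∷ x , ½-avg≤ p (ℚ.≤-trans q r)

-- Signs, Walsh characters and their orthogonality

sgn : Bool → ℚ
sgn true  = 1ℚ
sgn false = - 1ℚ

sgn-not : ∀ b → sgn (not b) ≡ - sgn b
sgn-not true  = refl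
sgn-not false = refl

sgn² : ∀ b → sgn b * sgn b ≡ 1ℚ
sgn² true  = refl
sgn² false = refl

sgn≤1 : ∀ b → ∣ sgn b ∣ ≤ℚ 1ℚ
sgn≤1 true  = ℚ.≤-refl
sgn≤1 false = ℚ.≤-refl

-- Also applied to sets, where it removes a member or adds a nonmember.
flip : ∀ {n} → Fin n → Vec Bool n → Vec Bool n
flip zero    (b ∷ x) = not b ∷ x
flip (suc i) (b ∷ x) = b ∷ flip i x

lookup-flip-≡ : ∀ {n} i (x : Vec Bool n) → lookup (flip i x) i ≡ not (lookup x i)
lookup-flip-≡ zero    (b ∷ x) = refl
lookup-flip-≡ (suc i) (b ∷ x) = lookup-flip-≡ i x

lookup-flip-≢ : ∀ {n} i j (x : Vec Bool n) → i ≢ j → lookup (flip i x) j ≡ lookup x j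
lookup-flip-≢ zero    zero    x       ne = ⊥-elim (ne refl)
lookup-flip-≢ zero    (suc j) (b ∷ x) ne = refl
lookup-flip-≢ (suc i) zero    (b ∷ x) ne = refl
lookup-flip-≢ (suc i) (suc j) (b ∷ x) ne = lookup-flip-≢ i j x (ne ∘ cong suc)

𝔼-flip : ∀ {n} i (f : Vec Bool n → ℚ) → 𝔼 (λ x → f (flip i x)) ≡ 𝔼 f
𝔼-flip zero    f = trans (𝔼-∷ (λ x → f (flip zero x))) (trans
  (cong (½ *_) (ℚ.+-comm (𝔼 (λ x → f (false ∷ x))) (𝔼 (λ x → f (true ∷ x))))) (sym (𝔼-∷ f)))
𝔼-flip (suc i) f = trans (𝔼-∷ (λ x → f (flip (suc i) x))) (trans
  (cong (½ *_) (cong₂ _+_ (𝔼-flip i (λ x → f (true ∷ x))) (𝔼-flip i (λ x → f (false ∷ x))))) (sym (𝔼-∷ f)))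

-- Toggling a coordinate preserves the uniform measure, so the mean is its own negative.
𝔼-odd : ∀ {n} i (f : Vec Bool n → ℚ) → (∀ x → f (flip i x) ≡ - f x) → 𝔼 f ≡ 0ℚ
𝔼-odd {n} i f p = trans (sym (½-double (𝔼 f))) (cong (½ *_) (trans (cong (𝔼 f +_) e) (ℚ.+-inverseʳ (𝔼 f))))
  where
  -1* : ∀ c → - c ≡ (- 1ℚ) * c
  -1* = solve-∀ ℚ-ring
  e : 𝔼 f ≡ - 𝔼 f
  e = trans (sym (𝔼-flip i f)) (trans (𝔼-cong (λ x → trans (p x) (-1* (f x)))) (trans (𝔼-*ˡ (- 1ℚ) f) (sym (-1* (𝔼 f)))))

-- The Walsh character of S: the product of the signs of x over S.
χ : ∀ {n} → Vec Bool n → Vec Bool n → ℚ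
χ []          []      = 1ℚ
χ (true ∷ S)  (b ∷ x) = sgn b * χ S x
χ (false ∷ S) (b ∷ x) = χ S x

_⊕_ : ∀ {n} → Vec Bool n → Vec Bool n → Vec Bool n
_⊕_ = Vec.zipWith _xor_

χ-⊕ : ∀ {n} (S S′ x : Vec Bool n) → χ S x * χ S′ x ≡ χ (S ⊕ S′) x
χ-⊕ []          []           []      = refl
χ-⊕ (true ∷ S)  (true ∷ S′)  (b ∷ x) = trans (eq (sgn b) (χ S x) (χ S′ x)) (trans (cong₂ _*_ (sgn² b) (χ-⊕ S S′ x)) (ℚ.*-identityˡ _))
  where
  eq : ∀ a b c → (a * b) * (a * c) ≡ (a * a) * (b * c)
  eq = solve-∀ ℚ-ring
χ-⊕ (true ∷ S)  (false ∷ S′) (b ∷ x) = trans (ℚ.*-assoc (sgn b) (χ S x) (χ S′ x)) (cong (sgn b *_) (χ-⊕ S S′ x))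
χ-⊕ (false ∷ S) (true ∷ S′)  (b ∷ x) = trans (eq (sgn b) (χ S x) (χ S′ x)) (cong (sgn b *_) (χ-⊕ S S′ x))
  where
  eq : ∀ a b c → b * (a * c) ≡ a * (b * c)
  eq = solve-∀ ℚ-ring
χ-⊕ (false ∷ S) (false ∷ S′) (b ∷ x) = χ-⊕ S S′ x

-- Equality of sets as a rational, by the same recursion as `χ`, so that the orthogonality relation
-- `𝔼-χχ` follows coordinate by coordinate.
δ : ∀ {n} → Vec Bool n → Vec Bool n → ℚ
δ []          []           = 1ℚ
δ (true ∷ S)  (true ∷ S′)  = δ S S′
δ (true ∷ S)  (false ∷ S′) = 0ℚ
δ (false ∷ S) (true ∷ S′)  = 0ℚ
δ (false ∷ S) (false ∷ S′) = δ S S′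

δ-cases : ∀ {n} (S S′ : Vec Bool n) → (S ≡ S′ × δ S S′ ≡ 1ℚ) ⊎ (S ≢ S′ × δ S S′ ≡ 0ℚ)
δ-cases []          []           = inj₁ (refl , refl)
δ-cases (true ∷ S)  (false ∷ S′) = inj₂ ((λ ()) , refl)
δ-cases (false ∷ S) (true ∷ S′)  = inj₂ ((λ ()) , refl)
δ-cases (true ∷ S)  (true ∷ S′)  with δ-cases S S′
... | inj₁ (refl , e) = inj₁ (refl , e)
... | inj₂ (ne , e)   = inj₂ ((λ { refl → ne refl }) , e)
δ-cases (false ∷ S) (false ∷ S′) with δ-cases S S′
... | inj₁ (refl , e) = inj₁ (refl , e)
... | inj₂ (ne , e)   = inj₂ ((λ { refl → ne refl }) , e)

δ≥0 : ∀ {n} (S S′ : Vec Bool n) → 0ℚ ≤ℚ δ S S′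
δ≥0 S S′ with δ-cases S S′
... | inj₁ (_ , e) = subst (0ℚ ≤ℚ_) (sym e) 0≤1
... | inj₂ (_ , e) = ≡⇒≤ (sym e)

δ-refl : ∀ {n} (S : Vec Bool n) → δ S S ≡ 1ℚ
δ-refl S with δ-cases S S
... | inj₁ (_ , e)  = e
... | inj₂ (ne , _) = ⊥-elim (ne refl)

δ-≢ : ∀ {n} (S S′ : Vec Bool n) → S ≢ S′ → δ S S′ ≡ 0ℚ
δ-≢ S S′ ne with δ-cases S S′
... | inj₁ (e , _) = ⊥-elim (ne e)
... | inj₂ (_ , e) = e

𝔼-χχ : ∀ {n} (S S′ : Vec Bool n) → 𝔼 (λ x → χ S x * χ S′ x) ≡ δ S S′
𝔼-χχ []          []           = trans (𝔼-[] _) (ℚ.*-identityˡ 1ℚ)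
𝔼-χχ (true ∷ S)  (true ∷ S′)  = trans (𝔼-∷ (λ x → χ (true ∷ S) x * χ (true ∷ S′) x)) (trans (cong (½ *_) (cong₂ _+_ (𝔼-cong (λ x → eq₁ (χ S x) (χ S′ x))) (𝔼-cong (λ x → eq₂ (χ S x) (χ S′ x)))))
                                      (trans (½-double (𝔼 (λ x → χ S x * χ S′ x))) (𝔼-χχ S S′)))
  where
  eq₁ : ∀ a b → (1ℚ * a) * (1ℚ * b) ≡ a * b
  eq₁ = solve-∀ ℚ-ring
  eq₂ : ∀ a b → (- 1ℚ * a) * (- 1ℚ * b) ≡ a * b
  eq₂ = solve-∀ ℚ-ring
𝔼-χχ (true ∷ S)  (false ∷ S′) = 𝔼-odd zero (λ x → χ (true ∷ S) x * χ (false ∷ S′) x) odd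
  where
  eq : ∀ s a b → ((- s) * a) * b ≡ - ((s * a) * b)
  eq = solve-∀ ℚ-ring
  odd : ∀ x → χ (true ∷ S) (flip zero x) * χ (false ∷ S′) (flip zero x) ≡ - (χ (true ∷ S) x * χ (false ∷ S′) x)
  odd (b ∷ x) = trans (cong (λ s → (s * χ S x) * χ S′ x) (sgn-not b)) (eq (sgn b) (χ S x) (χ S′ x))
𝔼-χχ (false ∷ S) (true ∷ S′)  = 𝔼-odd zero (λ x → χ (false ∷ S) x * χ (true ∷ S′) x) odd
  where
  eq : ∀ s a b → a * ((- s) * b) ≡ - (a * (s * b))
  eq = solve-∀ ℚ-ring
  odd : ∀ x → χ (false ∷ S) (flip zero x) * χ (true ∷ S′) (flip zero x) ≡ - (χ (false ∷ S) x * χ (true ∷ S′) x)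
  odd (b ∷ x) = trans (cong (λ s → χ S x * (s * χ S′ x)) (sgn-not b)) (eq (sgn b) (χ S x) (χ S′ x))
𝔼-χχ (false ∷ S) (false ∷ S′) = trans (𝔼-∷ (λ x → χ (false ∷ S) x * χ (false ∷ S′) x))
  (trans (½-double (𝔼 (λ x → χ S x * χ S′ x))) (𝔼-χχ S S′))

-- Polynomials of bounded degree on the cube and Bonami's lemma

mutual
  -- Multilinear of degree at most ℓ in the signs. The splitting in the first coordinate, whose
  -- second part has smaller degree, is the data that the induction of `bonami` consumes; below
  -- degree 0 only the zero function is left.
  Deg : ∀ n → ℕ → (Vec Bool n → ℚ) → Set
  Deg zero    ℓ f = ⊤
  Deg (suc n) ℓ f = Σ (Vec Bool n → ℚ) λ g → Σ (Vec Bool n → ℚ) λ h →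
    Deg n ℓ g × Deg< n ℓ h × (∀ b x → f (b ∷ x) ≡ g x + sgn b * h x)

  Deg< : ∀ n → ℕ → (Vec Bool n → ℚ) → Set
  Deg< n zero    f = ∀ x → f x ≡ 0ℚ
  Deg< n (suc ℓ) f = Deg n ℓ f

mutual
  Deg-zero : ∀ n ℓ → Deg n ℓ (λ _ → 0ℚ)
  Deg-zero zero    ℓ = tt
  Deg-zero (suc n) ℓ = (λ _ → 0ℚ) , (λ _ → 0ℚ) , Deg-zero n ℓ , Deg<-zero n ℓ , λ b x → sym (eq (sgn b))
    where
    eq : ∀ s → 0ℚ + s * 0ℚ ≡ 0ℚ
    eq = solve-∀ ℚ-ring

  Deg<-zero : ∀ n ℓ → Deg< n ℓ (λ _ → 0ℚ)
  Deg<-zero n zero    = λ _ → refl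
  Deg<-zero n (suc ℓ) = Deg-zero n ℓ

mutual
  Deg-+ : ∀ n ℓ {f f′} → Deg n ℓ f → Deg n ℓ f′ → Deg n ℓ (λ x → f x + f′ x)
  Deg-+ zero    ℓ d d′ = tt
  Deg-+ (suc n) ℓ (g , h , dg , dh , e) (g′ , h′ , dg′ , dh′ , e′) =
    (λ x → g x + g′ x) , (λ x → h x + h′ x) , Deg-+ n ℓ dg dg′ , Deg<-+ n ℓ dh dh′ ,
    λ b x → trans (cong₂ _+_ (e b x) (e′ b x)) (eq (g x) (g′ x) (sgn b) (h x) (h′ x))
    where
    eq : ∀ g g′ s h h′ → (g + s * h) + (g′ + s * h′) ≡ (g + g′) + s * (h + h′)
    eq = solve-∀ ℚ-ring

  Deg<-+ : ∀ n ℓ {f f′} → Deg< n ℓ f → Deg< n ℓ f′ → Deg< n ℓ (λ x → f x + f′ x)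
  Deg<-+ n zero    d d′ = λ x → trans (cong₂ _+_ (d x) (d′ x)) (ℚ.+-identityˡ 0ℚ)
  Deg<-+ n (suc ℓ) d d′ = Deg-+ n ℓ d d′

mutual
  Deg-*ˡ : ∀ n ℓ c {f} → Deg n ℓ f → Deg n ℓ (λ x → c * f x)
  Deg-*ˡ zero    ℓ c d = tt
  Deg-*ˡ (suc n) ℓ c (g , h , dg , dh , e) =
    (λ x → c * g x) , (λ x → c * h x) , Deg-*ˡ n ℓ c dg , Deg<-*ˡ n ℓ c dh ,
    λ b x → trans (cong (c *_) (e b x)) (eq c (g x) (sgn b) (h x))
    where
    eq : ∀ c g s h → c * (g + s * h) ≡ c * g + s * (c * h)
    eq = solve-∀ ℚ-ring

  Deg<-*ˡ : ∀ n ℓ c {f} → Deg< n ℓ f → Deg< n ℓ (λ x → c * f x)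
  Deg<-*ˡ n zero    c d = λ x → trans (cong (c *_) (d x)) (ℚ.*-zeroʳ c)
  Deg<-*ˡ n (suc ℓ) c d = Deg-*ˡ n ℓ c d

Deg-cong : ∀ n ℓ {f g} → (∀ x → f x ≡ g x) → Deg n ℓ f → Deg n ℓ g
Deg-cong zero    ℓ p d = tt
Deg-cong (suc n) ℓ p (g , h , dg , dh , e) = g , h , dg , dh , λ b x → trans (sym (p (b ∷ x))) (e b x)

opaque
  unfolding ∑

  Deg-∑ : ∀ {a} {A : Set a} n ℓ (xs : List A) {f : A → Vec Bool n → ℚ} →
          (∀ a → Deg n ℓ (f a)) → Deg n ℓ (λ x → ∑ xs (λ a → f a x))
  Deg-∑ n ℓ []       d = Deg-zero n ℓ
  Deg-∑ n ℓ (a ∷ xs) d = Deg-+ n ℓ (d a) (Deg-∑ n ℓ xs d)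

Deg-χ : ∀ n ℓ (S : Vec Bool n) → Sub.∣ S ∣ ≤ ℓ → Deg n ℓ (χ S)
Deg-χ zero    ℓ       []          p       = tt
Deg-χ (suc n) (suc ℓ) (true ∷ S)  (s≤s p) = (λ _ → 0ℚ) , χ S , Deg-zero n (suc ℓ) , Deg-χ n ℓ S p ,
                                            λ b x → sym (ℚ.+-identityˡ _)
Deg-χ (suc n) ℓ       (false ∷ S) p       = χ S , (λ _ → 0ℚ) , Deg-χ n ℓ S p , Deg<-zero n ℓ ,
                                            λ b x → sym (eq (sgn b) (χ S x))
  where
  eq : ∀ s c → c + s * 0ℚ ≡ c
  eq = solve-∀ ℚ-ring

𝔼² : ∀ {n} → (Vec Bool n → ℚ) → ℚ
𝔼² f = 𝔼 (λ x → f x * f x)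

𝔼²² : ∀ {n} → (Vec Bool n → ℚ) → (Vec Bool n → ℚ) → ℚ
𝔼²² f g = 𝔼 (λ x → (f x * f x) * (g x * g x))

𝔼²≥0 : ∀ {n} (f : Vec Bool n → ℚ) → 0ℚ ≤ℚ 𝔼² f
𝔼²≥0 f = 𝔼≥0 (λ x → sq≥0 (f x))

𝔼²²-comm : ∀ {n} (f g : Vec Bool n → ℚ) → 𝔼²² f g ≡ 𝔼²² g f
𝔼²²-comm f g = 𝔼-cong (λ x → ℚ.*-comm (f x * f x) (g x * g x))

1≤3 : 1ℚ ≤ℚ 3ℚ
1≤3 = ≤-diff {1ℚ} {3ℚ} (ℚ.nonNegative⁻¹ 2ℚ)

3^≥0 : ∀ ℓ → 0ℚ ≤ℚ 3ℚ ^ ℓ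
3^≥0 = ^≥0 (ℚ.nonNegative⁻¹ 3ℚ)

1≤3^ : ∀ ℓ → 1ℚ ≤ℚ 3ℚ ^ ℓ
1≤3^ = 1≤^ 1≤3

-- Bonami's lemma, in a bilinear form that is stable under the induction on the dimension:
-- the cross term is absorbed by 4 g h g′ h′ ≤ 2 (g² h′² + h² g′²).
mutual
  bonami : ∀ n ℓ ℓ′ {f f′} → Deg n ℓ f → Deg n ℓ′ f′ →
           𝔼²² f f′ ≤ℚ (3ℚ ^ ℓ * 3ℚ ^ ℓ′) * (𝔼² f * 𝔼² f′)
  bonami zero ℓ ℓ′ {f} {f′} _ _ rewrite 𝔼-[] (λ x → f x * f x) | 𝔼-[] (λ x → f′ x * f′ x) | 𝔼-[] (λ x → (f x * f x) * (f′ x * f′ x)) =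
    subst (_≤ℚ (3ℚ ^ ℓ * 3ℚ ^ ℓ′) * ((f [] * f []) * (f′ [] * f′ []))) (ℚ.*-identityˡ ((f [] * f []) * (f′ [] * f′ [])))
    (*-monoʳ (*≥0 (sq≥0 (f [])) (sq≥0 (f′ []))) (*-mono 0≤1 (3^≥0 ℓ) (1≤3^ ℓ) (1≤3^ ℓ′)))
  bonami (suc n) ℓ ℓ′ {f} {f′} (g , h , dg , dh , e) (g′ , h′ , dg′ , dh′ , e′) = begin
    𝔼²² f f′
      ≡⟨ avg (λ x → (f x * f x) * (f′ x * f′ x)) ⟩
    𝔼 (λ x → ½ * ((f (true ∷ x) * f (true ∷ x)) * (f′ (true ∷ x) * f′ (true ∷ x))
                + (f (false ∷ x) * f (false ∷ x)) * (f′ (false ∷ x) * f′ (false ∷ x))))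
      ≤⟨ 𝔼-mono point ⟩
    𝔼 (λ x → ((g x * g x) * (g′ x * g′ x) + (h x * h x) * (h′ x * h′ x))
           + (3ℚ * ((g x * g x) * (h′ x * h′ x)) + 3ℚ * ((h x * h x) * (g′ x * g′ x))))
      ≡⟨ trans (𝔼-+ _ _) (cong₂ _+_ (𝔼-+ _ _) (trans (𝔼-+ _ _) (cong₂ _+_ (𝔼-*ˡ 3ℚ _) (𝔼-*ˡ 3ℚ _)))) ⟩
    (𝔼²² g g′ + 𝔼²² h h′) + (3ℚ * 𝔼²² g h′ + 3ℚ * 𝔼²² h g′)
      ≤⟨ ℚ.+-mono-≤ (ℚ.+-mono-≤ (bonami n ℓ ℓ′ dg dg′) (bonami<< n ℓ ℓ′ dh dh′))
                    (ℚ.+-mono-≤ (bonami> n ℓ ℓ′ dg dh′) (bonami< n ℓ ℓ′ dh dg′)) ⟩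
    (C * (𝔼² g * 𝔼² g′) + C * (𝔼² h * 𝔼² h′)) + (C * (𝔼² g * 𝔼² h′) + C * (𝔼² h * 𝔼² g′))
      ≡⟨ collect C (𝔼² g) (𝔼² g′) (𝔼² h) (𝔼² h′) ⟩
    C * ((𝔼² g + 𝔼² h) * (𝔼² g′ + 𝔼² h′))
      ≡⟨ sym (cong (C *_) (cong₂ _*_ (norm f g h e) (norm f′ g′ h′ e′))) ⟩
    C * (𝔼² f * 𝔼² f′) ∎
    where
    open ℚ.≤-Reasoning
    C = 3ℚ ^ ℓ * 3ℚ ^ ℓ′
    avg : ∀ {n} (F : Vec Bool (suc n) → ℚ) → 𝔼 F ≡ 𝔼 (λ x → ½ * (F (true ∷ x) + F (false ∷ x)))
    avg F = trans (𝔼-∷ F) (sym (trans (𝔼-*ˡ ½ (λ x → F (true ∷ x) + F (false ∷ x))) (cong (½ *_) (𝔼-+ (λ x → F (true ∷ x)) (λ x → F (false ∷ x))))))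
    collect : ∀ C a a′ b b′ → (C * (a * a′) + C * (b * b′)) + (C * (a * b′) + C * (b * a′)) ≡ C * ((a + b) * (a′ + b′))
    collect = solve-∀ ℚ-ring
    norm : ∀ {n} (f : Vec Bool (suc n) → ℚ) g h → (∀ b x → f (b ∷ x) ≡ g x + sgn b * h x) → 𝔼² f ≡ 𝔼² g + 𝔼² h
    norm f g h e = trans (avg (λ x → f x * f x)) (trans (𝔼-cong (λ x → trans
      (cong₂ (λ u v → ½ * (u * u + v * v)) (e true x) (e false x)) (eq (g x) (h x)))) (𝔼-+ _ _))
      where
      eq : ∀ g h → ½ * ((g + 1ℚ * h) * (g + 1ℚ * h) + (g + - 1ℚ * h) * (g + - 1ℚ * h)) ≡ g * g + h * h
      eq = solve-∀ ℚ-ring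
    point : ∀ x → ½ * ((f (true ∷ x) * f (true ∷ x)) * (f′ (true ∷ x) * f′ (true ∷ x))
                + (f (false ∷ x) * f (false ∷ x)) * (f′ (false ∷ x) * f′ (false ∷ x)))
                ≤ℚ ((g x * g x) * (g′ x * g′ x) + (h x * h x) * (h′ x * h′ x))
                 + (3ℚ * ((g x * g x) * (h′ x * h′ x)) + 3ℚ * ((h x * h x) * (g′ x * g′ x)))
    point x rewrite e true x | e false x | e′ true x | e′ false x = ≤-diff (subst (0ℚ ≤ℚ_)
      (sym (eq (g x) (h x) (g′ x) (h′ x))) (*≥0 {2ℚ} (ℚ.nonNegative⁻¹ 2ℚ) (sq≥0 (g x * h′ x - h x * g′ x))))
      where
      eq : ∀ g h g′ h′ → ((g * g) * (g′ * g′) + (h * h) * (h′ * h′))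
                 + (3ℚ * ((g * g) * (h′ * h′)) + 3ℚ * ((h * h) * (g′ * g′)))
           - ½ * (((g + 1ℚ * h) * (g + 1ℚ * h)) * ((g′ + 1ℚ * h′) * (g′ + 1ℚ * h′))
                + ((g + - 1ℚ * h) * (g + - 1ℚ * h)) * ((g′ + - 1ℚ * h′) * (g′ + - 1ℚ * h′)))
           ≡ 2ℚ * ((g * h′ - h * g′) * (g * h′ - h * g′))
      eq = solve-∀ ℚ-ring

  -- The drop in degree saves a factor 3, which pays for the coefficient 3 of the mixed terms. When
  -- ℓ is 0 the function h is zero.
  bonami< : ∀ n ℓ ℓ′ {h f} → Deg< n ℓ h → Deg n ℓ′ f →
            3ℚ * 𝔼²² h f ≤ℚ (3ℚ ^ ℓ * 3ℚ ^ ℓ′) * (𝔼² h * 𝔼² f)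
  bonami< n zero ℓ′ {h} {f} z d = ℚ.≤-trans
    (≡⇒≤ (trans (cong (3ℚ *_) (𝔼-zero (λ x → trans (cong (λ u → (u * u) * (f x * f x)) (z x)) (eq (f x * f x))))) (ℚ.*-zeroʳ 3ℚ)))
    (*≥0 (*≥0 0≤1 (3^≥0 ℓ′)) (*≥0 (𝔼²≥0 h) (𝔼²≥0 f)))
    where
    eq : ∀ a → (0ℚ * 0ℚ) * a ≡ 0ℚ
    eq = solve-∀ ℚ-ring
  bonami< n (suc ℓ) ℓ′ {h} {f} dh df = ℚ.≤-trans (*-monoˡ (ℚ.nonNegative⁻¹ 3ℚ) (bonami n ℓ ℓ′ dh df))
    (≡⇒≤ (eq (3ℚ ^ ℓ) (3ℚ ^ ℓ′) (𝔼² h * 𝔼² f)))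
    where
    eq : ∀ a b c → 3ℚ * ((a * b) * c) ≡ ((3ℚ * a) * b) * c
    eq = solve-∀ ℚ-ring

  bonami> : ∀ n ℓ ℓ′ {f h} → Deg n ℓ f → Deg< n ℓ′ h →
            3ℚ * 𝔼²² f h ≤ℚ (3ℚ ^ ℓ * 3ℚ ^ ℓ′) * (𝔼² f * 𝔼² h)
  bonami> n ℓ ℓ′ {f} {h} df dh = subst₂ _≤ℚ_ (cong (3ℚ *_) (𝔼²²-comm h f))
    (cong₂ _*_ (ℚ.*-comm (3ℚ ^ ℓ′) (3ℚ ^ ℓ)) (ℚ.*-comm (𝔼² h) (𝔼² f))) (bonami< n ℓ′ ℓ dh df)

  bonami<< : ∀ n ℓ ℓ′ {h h′} → Deg< n ℓ h → Deg< n ℓ′ h′ →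
             𝔼²² h h′ ≤ℚ (3ℚ ^ ℓ * 3ℚ ^ ℓ′) * (𝔼² h * 𝔼² h′)
  bonami<< n zero ℓ′ {h} {h′} z d = ℚ.≤-trans
    (≡⇒≤ (𝔼-zero (λ x → trans (cong (λ u → (u * u) * (h′ x * h′ x)) (z x)) (eq (h′ x * h′ x)))))
    (*≥0 (*≥0 0≤1 (3^≥0 ℓ′)) (*≥0 (𝔼²≥0 h) (𝔼²≥0 h′)))
    where
    eq : ∀ a → (0ℚ * 0ℚ) * a ≡ 0ℚ
    eq = solve-∀ ℚ-ring
  bonami<< n (suc ℓ) ℓ′ {h} {h′} dh dh′ = begin
    𝔼²² h h′                                             ≤⟨ triple (𝔼≥0 (λ x → *≥0 (sq≥0 (h x)) (sq≥0 (h′ x)))) ⟩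
    3ℚ * 𝔼²² h h′                                        ≤⟨ bonami> n ℓ ℓ′ dh dh′ ⟩
    (3ℚ ^ ℓ * 3ℚ ^ ℓ′) * (𝔼² h * 𝔼² h′)                  ≤⟨ triple (*≥0 (*≥0 (3^≥0 ℓ) (3^≥0 ℓ′)) (*≥0 (𝔼²≥0 h) (𝔼²≥0 h′))) ⟩
    3ℚ * ((3ℚ ^ ℓ * 3ℚ ^ ℓ′) * (𝔼² h * 𝔼² h′))           ≡⟨ eq (3ℚ ^ ℓ) (3ℚ ^ ℓ′) (𝔼² h * 𝔼² h′) ⟩
    ((3ℚ * 3ℚ ^ ℓ) * 3ℚ ^ ℓ′) * (𝔼² h * 𝔼² h′)           ∎
    where
    open ℚ.≤-Reasoning
    eq : ∀ a b c → 3ℚ * ((a * b) * c) ≡ ((3ℚ * a) * b) * c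
    eq = solve-∀ ℚ-ring
    triple : ∀ {x} → 0ℚ ≤ℚ x → x ≤ℚ 3ℚ * x
    triple {x} p = subst (_≤ℚ 3ℚ * x) (ℚ.*-identityˡ x) (*-monoʳ p 1≤3)

-- Multi-affine forms

card : ∀ {n} → Vec Bool n → ℕ
card = Sub.∣_∣

subs : ∀ {n} → Vec Bool n → List (Vec Bool n)
subs []          = [] ∷ []
subs (false ∷ e) = List.map (false ∷_) (subs e)
subs (true ∷ e)  = List.map (false ∷_) (subs e) ++ List.map (true ∷_) (subs e)

∈-subs⇒⊆ : ∀ {n} (e : Vec Bool n) {S} → S ∈ subs e → ∀ i → lookup S i ≡ true → lookup e i ≡ true
∈-subs⇒⊆ (false ∷ e) p i q with ∈-map⁻ (false ∷_) p
∈-subs⇒⊆ (false ∷ e) p (suc i) q | S , p′ , refl = ∈-subs⇒⊆ e p′ i q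
∈-subs⇒⊆ (true ∷ e) p zero    q = refl
∈-subs⇒⊆ (true ∷ e) p (suc i) q with ∈-++⁻ (List.map (false ∷_) (subs e)) p
... | inj₁ r with ∈-map⁻ (false ∷_) r
...   | S , p′ , refl = ∈-subs⇒⊆ e p′ i q
∈-subs⇒⊆ (true ∷ e) p (suc i) q | inj₂ r with ∈-map⁻ (true ∷_) r
...   | S , p′ , refl = ∈-subs⇒⊆ e p′ i q

false∷∈subs : ∀ {n} b (e : Vec Bool n) {S} → S ∈ subs e → (false ∷ S) ∈ subs (b ∷ e)
false∷∈subs false e p = ∈-map⁺ (false ∷_) p
false∷∈subs true  e p = ∈-++⁺ˡ (∈-map⁺ (false ∷_) p)

true∷∈subs : ∀ {n} (e : Vec Bool n) {S} → S ∈ subs e → (true ∷ S) ∈ subs (true ∷ e)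
true∷∈subs e p = ∈-++⁺ʳ (List.map (false ∷_) (subs e)) (∈-map⁺ (true ∷_) p)

∑-subs-const : ∀ {n} (e : Vec Bool n) c → ∑ (subs e) (λ _ → c) ≡ 2ℚ ^ card e * c
∑-subs-const []          c = trans (∑-const ([] ∷ []) c) (cong (_* c) (ℚ.+-identityʳ 1ℚ))
∑-subs-const (false ∷ e) c = trans (∑-map (false ∷_) (subs e) (λ _ → c)) (∑-subs-const e c)
∑-subs-const (true ∷ e)  c = trans (∑-++ (List.map (false ∷_) (subs e)) _ (λ _ → c)) (trans
  (cong₂ _+_ (trans (∑-map (false ∷_) (subs e) (λ _ → c)) (∑-subs-const e c))
             (trans (∑-map (true ∷_) (subs e) (λ _ → c)) (∑-subs-const e c))) (eq (2ℚ ^ card e) c))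
  where
  eq : ∀ a c → a * c + a * c ≡ (2ℚ * a) * c
  eq = solve-∀ ℚ-ring

mono : ∀ {n} → Vec Bool n → (Fin n → ℚ) → ℚ
mono []          t = 1ℚ
mono (true ∷ S)  t = t zero * mono S (t ∘ suc)
mono (false ∷ S) t = mono S (t ∘ suc)

∣*∣≤1 : ∀ {x y} → ∣ x ∣ ≤ℚ 1ℚ → ∣ y ∣ ≤ℚ 1ℚ → ∣ x * y ∣ ≤ℚ 1ℚ
∣*∣≤1 {x} {y} p q = subst (_≤ℚ 1ℚ) (sym (ℚ.∣p*q∣≡∣p∣*∣q∣ x y)) (*-mono (ℚ.0≤∣p∣ y) 0≤1 p q)

∣^∣≤1 : ∀ {x} → ∣ x ∣ ≤ℚ 1ℚ → ∀ j → ∣ x ^ j ∣ ≤ℚ 1ℚ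
∣^∣≤1 p zero    = ℚ.≤-refl
∣^∣≤1 p (suc j) = ∣*∣≤1 p (∣^∣≤1 p j)

∣mono∣≤1 : ∀ {n} (S : Vec Bool n) {t} → (∀ i → ∣ t i ∣ ≤ℚ 1ℚ) → ∣ mono S t ∣ ≤ℚ 1ℚ
∣mono∣≤1 []          p = ℚ.≤-refl
∣mono∣≤1 (true ∷ S)  p = ∣*∣≤1 (p zero) (∣mono∣≤1 S (p ∘ suc))
∣mono∣≤1 (false ∷ S) p = ∣mono∣≤1 S (p ∘ suc)

mono-const : ∀ {n} (S : Vec Bool n) c → mono S (λ _ → c) ≡ c ^ card S
mono-const []          c = refl
mono-const (true ∷ S)  c = cong (c *_) (mono-const S c)
mono-const (false ∷ S) c = mono-const S c

∣χ∣≤1 : ∀ {n} (S x : Vec Bool n) → ∣ χ S x ∣ ≤ℚ 1ℚ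
∣χ∣≤1 []          []      = ℚ.≤-refl
∣χ∣≤1 (true ∷ S)  (b ∷ x) = ∣*∣≤1 (sgn≤1 b) (∣χ∣≤1 S x)
∣χ∣≤1 (false ∷ S) (b ∷ x) = ∣χ∣≤1 S x

-- The multi-affine form of the excess: γ s is the weight of the level-s part.
excessForm : ∀ {n} → (ℕ → ℚ) → List (Vec Bool n) → (Fin n → ℚ) → ℚ
excessForm γ es t = ∑ es (λ e → ∑ (subs e) (λ S → γ (card S) * mono S t))

module _ {n : ℕ} (γ : ℕ → ℚ) (es : List (Vec Bool n)) where

  -- Linearity bounds the mean of the form subset by subset, and some outcome reaches the mean. All
  -- three constructions of weights end here.
  first-moment : ∀ {N} (t : Vec Bool N → Fin n → ℚ) (lo : Vec Bool n → Vec Bool n → ℚ) →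
    (∀ {e} → e ∈ es → ∀ {S} → S ∈ subs e → lo e S ≤ℚ γ (card S) * 𝔼 (λ x → mono S (t x))) →
    ∃[ x ] ∑ es (λ e → ∑ (subs e) (lo e)) ≤ℚ excessForm γ es (t x)
  first-moment t lo p with 𝔼-max (λ x → excessForm γ es (t x))
  ... | x , q = x , ℚ.≤-trans (ℚ.≤-trans (∑-mono es (λ {e} e∈ → ∑-mono (subs e) (p e∈))) (≡⇒≤ (sym eq))) q
    where
    eq : 𝔼 (λ x → excessForm γ es (t x)) ≡ ∑ es (λ e → ∑ (subs e) (λ S → γ (card S) * 𝔼 (λ x → mono S (t x))))
    eq = trans (𝔼-∑ es (λ e x → ∑ (subs e) (λ S → γ (card S) * mono S (t x))))
      (∑-cong es (λ {e} _ → trans (𝔼-∑ (subs e) (λ S x → γ (card S) * mono S (t x)))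
        (∑-cong (subs e) (λ {S} _ → 𝔼-*ˡ (γ (card S)) (λ x → mono S (t x))))))

∣𝔼∣≤ : ∀ {n} (f : Vec Bool n → ℚ) {h} → (∀ x → ∣ f x ∣ ≤ℚ h x) → ∣ 𝔼 f ∣ ≤ℚ 𝔼 h
∣𝔼∣≤ f {h} p = ∣∣≤ (𝔼-mono (λ x → ℚ.≤-trans (≤∣∣ (f x)) (p x)))
  (subst (_≤ℚ 𝔼 h) (trans (𝔼-*ˡ (- 1ℚ) f) (-1* (𝔼 f)))
    (𝔼-mono (λ x → ℚ.≤-trans (≡⇒≤ (-1* (f x))) (ℚ.≤-trans (subst (- f x ≤ℚ_) (ℚ.∣-p∣≡∣p∣ (f x)) (≤∣∣ (- f x))) (p x)))))
  where
  -1* : ∀ c → (- 1ℚ) * c ≡ - c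
  -1* = solve-∀ ℚ-ring

coeff-lower : ∀ {Γ c y h} → ∣ c ∣ ≤ℚ Γ → ∣ y ∣ ≤ℚ h → - (Γ * h) ≤ℚ c * y
coeff-lower {Γ} {c} {y} {h} p q = ℚ.≤-trans (neg-anti (subst (_≤ℚ Γ * h) (sym (ℚ.∣p*q∣≡∣p∣*∣q∣ c y))
  (*-mono (ℚ.0≤∣p∣ y) (ℚ.≤-trans (ℚ.0≤∣p∣ c) p) p q))) (-∣∣≤ (c * y))

-- Signed vertices carry independent random signs, free vertices a weight that may depend on these
-- signs, dead vertices the weight 0.
data Role : Set where
  signed free dead : Role

isSigned isFree isDead : Role → Bool
isSigned signed = true
isSigned _      = false
isFree free = true
isFree _    = false
isDead dead = true
isDead _    = false

signedPart freePart : ∀ {n} → Vec Role n → Vec Bool n → Vec Bool n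
signedPart []      []      = []
signedPart (r ∷ R) (s ∷ S) = (s ∧ isSigned r) ∷ signedPart R S
freePart []      []      = []
freePart (r ∷ R) (s ∷ S) = (s ∧ isFree r) ∷ freePart R S

alive : ∀ {n} → Vec Role n → Vec Bool n → Bool
alive []      []      = true
alive (r ∷ R) (s ∷ S) = not (s ∧ isDead r) ∧ alive R S

lookup-signedPart : ∀ {n} (R : Vec Role n) S i → lookup (signedPart R S) i ≡ lookup S i ∧ isSigned (lookup R i)
lookup-signedPart (r ∷ R) (s ∷ S) zero    = refl
lookup-signedPart (r ∷ R) (s ∷ S) (suc i) = lookup-signedPart R S i

lookup-freePart : ∀ {n} (R : Vec Role n) S i → lookup (freePart R S) i ≡ lookup S i ∧ isFree (lookup R i)
lookup-freePart (r ∷ R) (s ∷ S) zero    = refl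
lookup-freePart (r ∷ R) (s ∷ S) (suc i) = lookup-freePart R S i

byRole : Role → ℚ → ℚ → ℚ
byRole signed s g = s
byRole free   s g = g
byRole dead   s g = 0ℚ

roleWeights : ∀ {n} → Vec Role n → (Fin n → ℚ) → Vec Bool n → Fin n → ℚ
roleWeights R g x i = byRole (lookup R i) (sgn (lookup x i)) (g i)

∣roleWeights∣≤1 : ∀ {n} (R : Vec Role n) {g} x → (∀ i → ∣ g i ∣ ≤ℚ 1ℚ) → ∀ i → ∣ roleWeights R g x i ∣ ≤ℚ 1ℚ
∣roleWeights∣≤1 R x p i with lookup R i
... | signed = sgn≤1 (lookup x i)
... | free   = p i
... | dead   = 0≤1

-- The signed vertices contribute a character, so the mean of a monomial is a Fourier coefficient of
-- the product of its free weights.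
mono-roles : ∀ {n} (R : Vec Role n) g x S →
  mono S (roleWeights R g x) ≡ ι (alive R S) * (χ (signedPart R S) x * mono (freePart R S) g)
mono-roles []           g []      []          = refl
mono-roles (signed ∷ R) g (b ∷ x) (true ∷ S)  = trans (cong (sgn b *_) (mono-roles R (g ∘ suc) x S))
  (eq (sgn b) (ι (alive R S)) (χ (signedPart R S) x) (mono (freePart R S) (g ∘ suc)))
  where
  eq : ∀ s i c m → s * (i * (c * m)) ≡ i * ((s * c) * m)
  eq = solve-∀ ℚ-ring
mono-roles (free ∷ R)   g (b ∷ x) (true ∷ S)  = trans (cong (g zero *_) (mono-roles R (g ∘ suc) x S))
  (eq (g zero) (ι (alive R S)) (χ (signedPart R S) x) (mono (freePart R S) (g ∘ suc)))
  where
  eq : ∀ s i c m → s * (i * (c * m)) ≡ i * (c * (s * m))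
  eq = solve-∀ ℚ-ring
mono-roles (dead ∷ R)   g (b ∷ x) (true ∷ S)  = trans (ℚ.*-zeroˡ (mono S (roleWeights R (g ∘ suc) x)))
  (sym (ℚ.*-zeroˡ (χ (signedPart R S) x * mono (freePart R S) (g ∘ suc))))
mono-roles (signed ∷ R) g (b ∷ x) (false ∷ S) = mono-roles R (g ∘ suc) x S
mono-roles (free ∷ R)   g (b ∷ x) (false ∷ S) = mono-roles R (g ∘ suc) x S
mono-roles (dead ∷ R)   g (b ∷ x) (false ∷ S) = mono-roles R (g ∘ suc) x S

card-roles : ∀ {n} (R : Vec Role n) S → alive R S ≡ true → card S ≡ card (signedPart R S) ℕ.+ card (freePart R S)
card-roles []           []          p = refl
card-roles (signed ∷ R) (true ∷ S)  p = cong suc (card-roles R S p)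
card-roles (free ∷ R)   (true ∷ S)  p = trans (cong suc (card-roles R S p)) (sym (ℕ.+-suc _ _))
card-roles (signed ∷ R) (false ∷ S) p = card-roles R S p
card-roles (free ∷ R)   (false ∷ S) p = card-roles R S p
card-roles (dead ∷ R)   (false ∷ S) p = card-roles R S p

∃-subset : ∀ {n} (R : Vec Role n) e i j → i ≤ card (signedPart R e) → j ≤ card (freePart R e) →
  ∃[ S ] (S ∈ subs e × card (signedPart R S) ≡ i × card (freePart R S) ≡ j × alive R S ≡ true)
∃-subset []      []          zero zero p q = [] , here refl , refl , refl , refl
∃-subset (r ∷ R) (false ∷ e) i j p q with ∃-subset R e i j p q
... | S , a , b , c , d = false ∷ S , false∷∈subs false e a , b , c , d
∃-subset (dead ∷ R) (true ∷ e) i j p q with ∃-subset R e i j p q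
... | S , a , b , c , d = false ∷ S , false∷∈subs true e a , b , c , d
∃-subset (signed ∷ R) (true ∷ e) zero j p q with ∃-subset R e zero j z≤n q
... | S , a , b , c , d = false ∷ S , false∷∈subs true e a , b , c , d
∃-subset (signed ∷ R) (true ∷ e) (suc i) j (s≤s p) q with ∃-subset R e i j p q
... | S , a , b , c , d = true ∷ S , true∷∈subs e a , cong suc b , c , d
∃-subset (free ∷ R) (true ∷ e) i zero p q with ∃-subset R e i zero p z≤n
... | S , a , b , c , d = false ∷ S , false∷∈subs true e a , b , c , d
∃-subset (free ∷ R) (true ∷ e) i (suc j) p (s≤s q) with ∃-subset R e i j p q
... | S , a , b , c , d = true ∷ S , true∷∈subs e a , b , cong suc c , d

single : ∀ {n} → Fin n → Vec Bool n
single zero    = true ∷ Vec.replicate _ false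
single (suc i) = false ∷ single i

card-∅ : ∀ n → card (Vec.replicate n false) ≡ 0
card-∅ zero    = refl
card-∅ (suc n) = card-∅ n

lookup-∅ : ∀ {n} (i : Fin n) → lookup (Vec.replicate n false) i ≡ false
lookup-∅ zero    = refl
lookup-∅ (suc i) = lookup-∅ i

card-single : ∀ {n} (i : Fin n) → card (single i) ≡ 1
card-single {suc n} zero = cong suc (card-∅ n)
card-single (suc i) = card-single i

χ-∅ : ∀ {n} (x : Vec Bool n) → χ (Vec.replicate n false) x ≡ 1ℚ
χ-∅ []      = refl
χ-∅ (b ∷ x) = χ-∅ x

χ-single : ∀ {n} (i : Fin n) x → χ (single i) x ≡ sgn (lookup x i)
χ-single zero    (b ∷ x) = trans (cong (sgn b *_) (χ-∅ x)) (ℚ.*-identityʳ (sgn b))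
χ-single (suc i) (b ∷ x) = χ-single i x

card≡0 : ∀ {n} (S : Vec Bool n) → card S ≡ 0 → S ≡ Vec.replicate n false
card≡0 []          p = refl
card≡0 (false ∷ S) p = cong (false ∷_) (card≡0 S p)

card≡1 : ∀ {n} (S : Vec Bool n) → card S ≡ 1 → ∃[ i ] S ≡ single i
card≡1 (true ∷ S)  p = zero , cong (true ∷_) (card≡0 S (ℕ.suc-injective p))
card≡1 (false ∷ S) p with card≡1 S p
... | i , e = suc i , cong (false ∷_) e

mono-empty : ∀ {n} (S : Vec Bool n) t → card S ≡ 0 → mono S t ≡ 1ℚ
mono-empty []          t p = refl
mono-empty (false ∷ S) t p = mono-empty S (t ∘ suc) p

lookup-single : ∀ {n} (i : Fin n) → lookup (single i) i ≡ true
lookup-single zero    = refl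
lookup-single (suc i) = lookup-single i

card>0 : ∀ {n} (S : Vec Bool n) {m} → card S ≡ suc m → ∃[ i ] lookup S i ≡ true
card>0 (true ∷ S)  p = zero , refl
card>0 (false ∷ S) p with card>0 S p
... | i , e = suc i , e

∑-ι-lookup : ∀ {n} (S : Vec Bool n) → ∑ (allFin n) (λ i → ι (lookup S i)) ≡ ⟦ card S ⟧
∑-ι-lookup []          = ∑-[] _
∑-ι-lookup {suc n} (true ∷ S)  = trans (∑-allFin-suc n (λ i → ι (lookup (true ∷ S) i))) (cong (1ℚ +_) (∑-ι-lookup S))
∑-ι-lookup {suc n} (false ∷ S) = trans (∑-allFin-suc n (λ i → ι (lookup (false ∷ S) i)))
  (trans (ℚ.+-identityˡ _) (∑-ι-lookup S))

∑-δ-single : ∀ {n} (i : Fin n) (f : Fin n → ℚ) → ∑ (allFin n) (λ j → f j * δ (single i) (single j)) ≡ f i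
∑-δ-single {suc n} zero f = trans (∑-allFin-suc n (λ j → f j * δ (single zero) (single j))) (trans
  (cong₂ _+_ (trans (cong (f zero *_) (δ-refl (single {suc n} zero))) (ℚ.*-identityʳ (f zero)))
             (∑-zero (allFin n) (λ {j} _ → ℚ.*-zeroʳ (f (suc j))))) (ℚ.+-identityʳ (f zero)))
∑-δ-single {suc n} (suc i) f = trans (∑-allFin-suc n (λ j → f j * δ (single (suc i)) (single j))) (trans
  (cong₂ _+_ (ℚ.*-zeroʳ (f zero)) (∑-δ-single i (f ∘ suc))) (ℚ.+-identityˡ (f (suc i))))

-- What the analysis has to know of the cut problem. The sign of `γ 2` matters, because opposite
-- weights on a pair turn it into a gain; the sign of `γ (suc ℓ)` can be absorbed by the weights.
record Coefficients : Set where
  field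
    γ     : ℕ → ℚ
    Γ     : ℚ
    ℓ     : ℕ
    γ₀    : γ 0 ≡ 0ℚ
    γ₁    : γ 1 ≡ 0ℚ
    γ₂<0  : γ 2 < 0ℚ
    ∣γ∣≤Γ : ∀ s → ∣ γ s ∣ ≤ℚ Γ
    2≤ℓ   : 2 ≤ ℓ
    γtop≢0 : γ (suc ℓ) ≢ 0ℚ

  Γ≥0 : 0ℚ ≤ℚ Γ
  Γ≥0 = ℚ.≤-trans (ℚ.0≤∣p∣ (γ 0)) (∣γ∣≤Γ 0)

  -γ₂>0 : 0ℚ < - γ 2
  -γ₂>0 = ℚ.neg-antimono-< γ₂<0

-- Random signs on a set that meets many edges

coverRoles : ∀ {n} → Vec Bool n → Vec Role n
coverRoles = Vec.map (λ b → if b then signed else free)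

alive-cover : ∀ {n} (A S : Vec Bool n) → alive (coverRoles A) S ≡ true
alive-cover []          []          = refl
alive-cover (true ∷ A)  (true ∷ S)  = alive-cover A S
alive-cover (true ∷ A)  (false ∷ S) = alive-cover A S
alive-cover (false ∷ A) (true ∷ S)  = alive-cover A S
alive-cover (false ∷ A) (false ∷ S) = alive-cover A S

signed-cover : ∀ {n} (A S : Vec Bool n) i → lookup (signedPart (coverRoles A) S) i ≡ true → lookup A i ≡ true
signed-cover (true ∷ A)  (s ∷ S)     zero    p = refl
signed-cover (false ∷ A) (true ∷ S)  zero    ()
signed-cover (false ∷ A) (false ∷ S) zero    ()
signed-cover (a ∷ A)     (s ∷ S)     (suc i) p = signed-cover A S i p

-- Signs x on A; every vertex outside A takes - q times the average sign of A.
module Cover (C : Coefficients) {n} (A : Vec Bool n) {q a⁻¹ : ℚ}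
  (q≥0 : 0ℚ ≤ℚ q) (q≤1 : q ≤ℚ 1ℚ) (a⁻¹≥0 : 0ℚ ≤ℚ a⁻¹) (small : a⁻¹ * ⟦ card A ⟧ ≤ℚ 1ℚ) where

  open Coefficients C

  R : Vec Role n
  R = coverRoles A

  -- The factor `a⁻¹` only has to satisfy a⁻¹ |A| ≤ 1 and need not be 1 / |A|: an upper bound for
  -- |A| is enough, and an empty A is no special case.
  meanSign : Vec Bool n → ℚ
  meanSign x = a⁻¹ * ∑ (allFin n) (λ u → ι (lookup A u) * sgn (lookup x u))

  meanSign-χ : ∀ x → meanSign x ≡ a⁻¹ * ∑ (allFin n) (λ u → ι (lookup A u) * χ (single u) x)
  meanSign-χ x = cong (a⁻¹ *_) (∑-cong (allFin n) (λ {u} _ → cong (ι (lookup A u) *_) (sym (χ-single u x))))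

  ∣meanSign∣≤1 : ∀ x → ∣ meanSign x ∣ ≤ℚ 1ℚ
  ∣meanSign∣≤1 x = begin
    ∣ meanSign x ∣                                                            ≡⟨ ℚ.∣p*q∣≡∣p∣*∣q∣ a⁻¹ (∑ (allFin n) s) ⟩
    ∣ a⁻¹ ∣ * ∣ ∑ (allFin n) s ∣                                              ≡⟨ cong (_* ∣ ∑ (allFin n) s ∣) (ℚ.0≤p⇒∣p∣≡p a⁻¹≥0) ⟩
    a⁻¹ * ∣ ∑ (allFin n) s ∣                                                  ≤⟨ *-monoˡ a⁻¹≥0 (∣∑∣≤ (allFin n) s) ⟩
    a⁻¹ * ∑ (allFin n) (λ u → ∣ s u ∣)                                        ≤⟨ *-monoˡ a⁻¹≥0 (∑-mono (allFin n) (λ {u} _ → bound u)) ⟩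
    a⁻¹ * ∑ (allFin n) (λ u → ι (lookup A u))                                 ≡⟨ cong (a⁻¹ *_) (∑-ι-lookup A) ⟩
    a⁻¹ * ⟦ card A ⟧                                                          ≤⟨ small ⟩
    1ℚ                                                                        ∎
    where
    open ℚ.≤-Reasoning
    s : Fin n → ℚ
    s u = ι (lookup A u) * sgn (lookup x u)
    bound : ∀ u → ∣ s u ∣ ≤ℚ ι (lookup A u)
    bound u with lookup A u
    ... | true  = subst (λ z → ∣ z ∣ ≤ℚ 1ℚ) (sym (ℚ.*-identityˡ (sgn (lookup x u)))) (sgn≤1 (lookup x u))
    ... | false = ≡⇒≤ (cong ∣_∣ (ℚ.*-zeroˡ (sgn (lookup x u))))

  hits : Vec Bool n → ℚ
  hits S = ∑ (allFin n) (λ u → ι (lookup A u) * δ S (single u))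

  𝔼-χ-meanSign : ∀ S → 𝔼 (λ x → χ S x * meanSign x) ≡ a⁻¹ * hits S
  𝔼-χ-meanSign S = trans (𝔼-cong step) (trans (𝔼-*ˡ a⁻¹ (λ x → ∑ (allFin n) (λ u → ι (lookup A u) * (χ S x * χ (single u) x))))
    (cong (a⁻¹ *_) (trans (𝔼-∑ (allFin n) (λ u x → ι (lookup A u) * (χ S x * χ (single u) x)))
      (∑-cong (allFin n) (λ {u} _ → trans (𝔼-*ˡ (ι (lookup A u)) (λ x → χ S x * χ (single u) x))
        (cong (ι (lookup A u) *_) (𝔼-χχ S (single u))))))))
    where
    eq₁ : ∀ c a b → c * (a * b) ≡ a * (c * b)
    eq₁ = solve-∀ ℚ-ring
    step : ∀ x → χ S x * meanSign x ≡ a⁻¹ * ∑ (allFin n) (λ u → ι (lookup A u) * (χ S x * χ (single u) x))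
    step x = trans (cong (χ S x *_) (meanSign-χ x)) (trans (eq₁ (χ S x) a⁻¹ (∑ (allFin n) (λ u → ι (lookup A u) * χ (single u) x)))
      (cong (a⁻¹ *_) (trans (sym (∑-*ˡ (χ S x) (allFin n) (λ u → ι (lookup A u) * χ (single u) x)))
        (∑-cong (allFin n) (λ {u} _ → eq₁ (χ S x) (ι (lookup A u)) (χ (single u) x))))))

  hits-single : ∀ w → hits (single w) ≡ ι (lookup A w)
  hits-single w = ∑-δ-single w (λ u → ι (lookup A u))

  -- By orthonormality of the signs the second moment is a⁻² |A|, and a⁻¹ |A| is at most 1.
  𝔼-meanSign² : 𝔼 (λ x → meanSign x * meanSign x) ≤ℚ a⁻¹
  𝔼-meanSign² = begin
    𝔼 (λ x → meanSign x * meanSign x)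
      ≡⟨ 𝔼-cong (λ x → trans (cong (_* meanSign x) (meanSign-χ x)) (trans (ℚ.*-assoc a⁻¹ _ (meanSign x))
           (cong (a⁻¹ *_) (trans (sym (∑-*ʳ (meanSign x) (allFin n) (λ u → ι (lookup A u) * χ (single u) x)))
             (∑-cong (allFin n) (λ {u} _ → ℚ.*-assoc (ι (lookup A u)) (χ (single u) x) (meanSign x))))))) ⟩
    𝔼 (λ x → a⁻¹ * ∑ (allFin n) (λ u → ι (lookup A u) * (χ (single u) x * meanSign x)))
      ≡⟨ trans (𝔼-*ˡ a⁻¹ (λ x → ∑ (allFin n) (λ u → ι (lookup A u) * (χ (single u) x * meanSign x))))
           (cong (a⁻¹ *_) (trans (𝔼-∑ (allFin n) (λ u x → ι (lookup A u) * (χ (single u) x * meanSign x)))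
             (∑-cong (allFin n) (λ {u} _ → trans (𝔼-*ˡ (ι (lookup A u)) (λ x → χ (single u) x * meanSign x))
               (cong (ι (lookup A u) *_) (trans (𝔼-χ-meanSign (single u)) (cong (a⁻¹ *_) (hits-single u)))))))) ⟩
    a⁻¹ * ∑ (allFin n) (λ u → ι (lookup A u) * (a⁻¹ * ι (lookup A u)))
      ≡⟨ cong (a⁻¹ *_) (trans (∑-cong (allFin n) (λ {u} _ → idem u)) (∑-*ˡ a⁻¹ (allFin n) (λ u → ι (lookup A u)))) ⟩
    a⁻¹ * (a⁻¹ * ∑ (allFin n) (λ u → ι (lookup A u)))
      ≡⟨ cong (λ z → a⁻¹ * (a⁻¹ * z)) (∑-ι-lookup A) ⟩
    a⁻¹ * (a⁻¹ * ⟦ card A ⟧)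
      ≤⟨ *-monoˡ a⁻¹≥0 small ⟩
    a⁻¹ * 1ℚ
      ≡⟨ ℚ.*-identityʳ a⁻¹ ⟩
    a⁻¹ ∎
    where
    open ℚ.≤-Reasoning
    idem : ∀ u → ι (lookup A u) * (a⁻¹ * ι (lookup A u)) ≡ a⁻¹ * ι (lookup A u)
    idem u with lookup A u
    ... | true  = ℚ.*-identityˡ (a⁻¹ * 1ℚ)
    ... | false = trans (ℚ.*-zeroˡ (a⁻¹ * 0ℚ)) (sym (ℚ.*-zeroʳ a⁻¹))

  weights : Vec Bool n → Fin n → ℚ
  weights x = roleWeights R (λ _ → - (q * meanSign x)) x

  ∣q*meanSign∣≤1 : ∀ x → ∣ - (q * meanSign x) ∣ ≤ℚ 1ℚ
  ∣q*meanSign∣≤1 x = subst (_≤ℚ 1ℚ) (sym (ℚ.∣-p∣≡∣p∣ (q * meanSign x)))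
    (∣*∣≤1 (subst (_≤ℚ 1ℚ) (sym (ℚ.0≤p⇒∣p∣≡p q≥0)) q≤1) (∣meanSign∣≤1 x))

  ∣weights∣≤1 : ∀ x i → ∣ weights x i ∣ ≤ℚ 1ℚ
  ∣weights∣≤1 x = ∣roleWeights∣≤1 R x (λ _ → ∣q*meanSign∣≤1 x)

  mono-weights : ∀ S x → mono S (weights x) ≡ χ (signedPart R S) x * (- (q * meanSign x)) ^ card (freePart R S)
  mono-weights S x = trans (mono-roles R (λ _ → - (q * meanSign x)) x S)
    (trans (cong (λ b → ι b * (χ (signedPart R S) x * mono (freePart R S) (λ _ → - (q * meanSign x)))) (alive-cover A S))
    (trans (ℚ.*-identityˡ _) (cong (χ (signedPart R S) x *_) (mono-const (freePart R S) (- (q * meanSign x))))))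

  crossing : Vec Bool n → Bool
  crossing S = (card (signedPart R S) ℕ.≡ᵇ 1) ∧ (card (freePart R S) ℕ.≡ᵇ 1)

  -- A gain linear in q, on sets with exactly one vertex inside and one outside A, against a loss
  -- quadratic in q on every set.
  lower : Vec Bool n → ℚ
  lower S = a⁻¹ * ((- γ 2 * q) * ι (crossing S) - Γ * (q * q))

  -- By the numbers of signed and free vertices. Without free vertices the mean vanishes, or S is
  -- empty and `γ 0` does. A single free vertex pairs a character with the linear function
  -- `meanSign`: nonzero only for one signed vertex (the gain) or none (killed by `γ 1`, and by the
  -- mean). From two free vertices on, the factor q² `meanSign`² has mean at most q² a⁻¹.
  term≥lower : ∀ S → lower S ≤ℚ γ (card S) * 𝔼 (λ x → mono S (weights x))
  term≥lower S = subst (λ z → lower S ≤ℚ γ (card S) * z) (sym (𝔼-cong (mono-weights S)))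
    (go (card SA) (card SB) refl refl)
    where
    SA = signedPart R S
    SB = freePart R S
    y : Vec Bool n → ℚ
    y x = - (q * meanSign x)
    cards : card S ≡ card SA ℕ.+ card SB
    cards = card-roles R S (alive-cover A S)
    plain : crossing S ≡ false → lower S ≡ - (Γ * (a⁻¹ * (q * q)))
    plain p = trans (cong (λ b → a⁻¹ * ((- γ 2 * q) * ι b - Γ * (q * q))) p) (eq a⁻¹ (γ 2) q Γ)
      where
      eq : ∀ a g q G → a * ((- g * q) * 0ℚ - G * (q * q)) ≡ - (G * (a * (q * q)))
      eq = solve-∀ ℚ-ring
    plain≤0 : crossing S ≡ false → lower S ≤ℚ 0ℚ
    plain≤0 p = subst (_≤ℚ 0ℚ) (sym (plain p)) (neg-anti (*≥0 Γ≥0 (*≥0 a⁻¹≥0 (sq≥0 q))))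
    vanishes : ∀ z w → crossing S ≡ false → z ≡ 0ℚ ⊎ w ≡ 0ℚ → lower S ≤ℚ z * w
    vanishes z w p (inj₁ refl) = ℚ.≤-trans (plain≤0 p) (≡⇒≤ (sym (ℚ.*-zeroˡ w)))
    vanishes z w p (inj₂ refl) = ℚ.≤-trans (plain≤0 p) (≡⇒≤ (sym (ℚ.*-zeroʳ z)))
    notB : ∀ {j} → card SB ≡ j → (j ℕ.≡ᵇ 1) ≡ false → crossing S ≡ false
    notB {j} e p = trans (cong (λ z → (card SA ℕ.≡ᵇ 1) ∧ (z ℕ.≡ᵇ 1)) e) (trans (cong ((card SA ℕ.≡ᵇ 1) ∧_) p) (Bool.∧-zeroʳ (card SA ℕ.≡ᵇ 1)))
    notA : ∀ {i} → card SA ≡ i → (i ℕ.≡ᵇ 1) ≡ false → crossing S ≡ false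
    notA e p = trans (cong (λ z → (z ℕ.≡ᵇ 1) ∧ (card SB ℕ.≡ᵇ 1)) e) (cong (_∧ (card SB ℕ.≡ᵇ 1)) p)
    linear : card SB ≡ 1 → 𝔼 (λ x → χ SA x * y x ^ card SB) ≡ - (q * (a⁻¹ * hits SA))
    linear e = trans (𝔼-cong (λ x → trans (cong (λ j → χ SA x * y x ^ j) e) (eq (χ SA x) q (meanSign x))))
      (trans (𝔼-*ˡ (- q) (λ x → χ SA x * meanSign x)) (trans (cong (- q *_) (𝔼-χ-meanSign SA)) (eq′ q (a⁻¹ * hits SA))))
      where
      eq : ∀ c q m → c * (- (q * m) * 1ℚ) ≡ - q * (c * m)
      eq = solve-∀ ℚ-ring
      eq′ : ∀ q m → - q * m ≡ - (q * m)
      eq′ = solve-∀ ℚ-ring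
    go : ∀ i j → card SA ≡ i → card SB ≡ j → lower S ≤ℚ γ (card S) * 𝔼 (λ x → χ SA x * y x ^ card SB)
    go zero zero eA eB = vanishes (γ (card S)) (𝔼 (λ x → χ SA x * y x ^ card SB)) (notB eB refl) (inj₁ (trans (cong γ (trans cards (cong₂ ℕ._+_ eA eB))) γ₀))
    go (suc i) zero eA eB = vanishes (γ (card S)) (𝔼 (λ x → χ SA x * y x ^ card SB)) (notB eB refl) (inj₂ (trans
      (𝔼-cong (λ x → cong₂ _*_ (refl {x = χ SA x}) (trans (cong (y x ^_) eB) (sym (χ-∅ x)))))
      (trans (𝔼-χχ SA (Vec.replicate n false)) (δ-≢ SA (Vec.replicate n false) (λ p → ℕ.0≢1+n (trans (sym (card-∅ n)) (trans (cong card (sym p)) eA)))))))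
    go zero (suc zero) eA eB = vanishes (γ (card S)) (𝔼 (λ x → χ SA x * y x ^ card SB)) (notA eA refl) (inj₁ (trans (cong γ (trans cards (cong₂ ℕ._+_ eA eB))) γ₁))
    go (suc zero) (suc zero) eA eB = subst₂ _≤ℚ_
      (sym (cong (λ b → a⁻¹ * ((- γ 2 * q) * ι b - Γ * (q * q))) (cong₂ (λ i j → (i ℕ.≡ᵇ 1) ∧ (j ℕ.≡ᵇ 1)) eA eB)))
      (sym (cong₂ _*_ (cong γ (trans cards (cong₂ ℕ._+_ eA eB))) (trans (linear eB) (cong (λ z → - (q * (a⁻¹ * z))) one))))
      (≤-diff (subst (0ℚ ≤ℚ_) (sym (eq a⁻¹ (γ 2) q Γ)) (*≥0 a⁻¹≥0 (*≥0 Γ≥0 (sq≥0 q)))))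
      where
      eq : ∀ a g q G → g * - (q * (a * 1ℚ)) - a * ((- g * q) * 1ℚ - G * (q * q)) ≡ a * (G * (q * q))
      eq = solve-∀ ℚ-ring
      one : hits SA ≡ 1ℚ
      one with card≡1 SA eA
      ... | w , e = trans (cong hits e) (trans (hits-single w) (cong ι (signed-cover A S w
                      (subst (λ T → lookup T w ≡ true) (sym e) (lookup-single w)))))
    go (suc (suc i)) (suc zero) eA eB = vanishes (γ (card S)) (𝔼 (λ x → χ SA x * y x ^ card SB)) (notA eA refl) (inj₂ (trans (linear eB)
      (trans (cong (λ z → - (q * (a⁻¹ * z))) none) (eq q a⁻¹))))
      where
      eq : ∀ q a → - (q * (a * 0ℚ)) ≡ 0ℚ
      eq = solve-∀ ℚ-ring
      none : hits SA ≡ 0ℚ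
      none = ∑-zero (allFin n) (λ {u} _ → trans (cong (ι (lookup A u) *_) (δ-≢ SA (single u) (λ p →
        ℕ.1+n≢0 (ℕ.suc-injective (trans (sym eA) (trans (cong card p) (card-single u))))))) (ℚ.*-zeroʳ (ι (lookup A u))))
    go i (suc (suc j)) eA eB = begin
      lower S                          ≡⟨ plain (notB eB refl) ⟩
      - (Γ * (a⁻¹ * (q * q)))          ≤⟨ neg-anti (*-monoˡ Γ≥0 (subst (_≤ℚ a⁻¹ * (q * q)) (ℚ.*-comm 𝔼m² (q * q)) (*-monoʳ (sq≥0 q) 𝔼-meanSign²))) ⟩
      - (Γ * ((q * q) * 𝔼m²))          ≤⟨ coeff-lower (∣γ∣≤Γ (card S)) (subst (∣ 𝔼 (λ x → χ SA x * y x ^ card SB) ∣ ≤ℚ_) (𝔼-*ˡ (q * q) (λ x → meanSign x * meanSign x)) (∣𝔼∣≤ (λ x → χ SA x * y x ^ card SB) pointwise)) ⟩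
      γ (card S) * 𝔼 (λ x → χ SA x * y x ^ card SB) ∎
      where
      open ℚ.≤-Reasoning
      𝔼m² = 𝔼 (λ x → meanSign x * meanSign x)
      eq : ∀ c q m z → c * (- (q * m) * (- (q * m) * z)) ≡ ((q * q) * (m * m)) * (c * z)
      eq = solve-∀ ℚ-ring
      pointwise : ∀ x → ∣ χ SA x * y x ^ card SB ∣ ≤ℚ (q * q) * (meanSign x * meanSign x)
      pointwise x = begin
        ∣ χ SA x * y x ^ card SB ∣
          ≡⟨ cong ∣_∣ (trans (cong (λ j → χ SA x * y x ^ j) eB) (eq (χ SA x) q (meanSign x) (y x ^ j))) ⟩
        ∣ ((q * q) * (meanSign x * meanSign x)) * (χ SA x * y x ^ j) ∣
          ≡⟨ ℚ.∣p*q∣≡∣p∣*∣q∣ ((q * q) * (meanSign x * meanSign x)) (χ SA x * y x ^ j) ⟩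
        ∣ (q * q) * (meanSign x * meanSign x) ∣ * ∣ χ SA x * y x ^ j ∣
          ≤⟨ *-monoˡ (ℚ.0≤∣p∣ ((q * q) * (meanSign x * meanSign x))) (∣*∣≤1 (∣χ∣≤1 SA x) (∣^∣≤1 (∣q*meanSign∣≤1 x) j)) ⟩
        ∣ (q * q) * (meanSign x * meanSign x) ∣ * 1ℚ
          ≡⟨ trans (ℚ.*-identityʳ ∣ (q * q) * (meanSign x * meanSign x) ∣) (ℚ.0≤p⇒∣p∣≡p (*≥0 (sq≥0 q) (sq≥0 (meanSign x)))) ⟩
        (q * q) * (meanSign x * meanSign x) ∎

  one-signed : Vec Bool n → ℚ
  one-signed e = ι (card (signedPart R e) ℕ.≡ᵇ 1)

  one-signed≤ : ∀ e → 2 ≤ card e → one-signed e ≤ℚ ∑ (subs e) (λ S → ι (crossing S))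
  one-signed≤ e 2≤ = go (card (signedPart R e)) refl
    where
    go : ∀ i → card (signedPart R e) ≡ i → one-signed e ≤ℚ ∑ (subs e) (λ S → ι (crossing S))
    go zero          eA = subst (_≤ℚ ∑ (subs e) (λ S → ι (crossing S))) (sym (cong (λ i → ι (i ℕ.≡ᵇ 1)) eA)) (∑≥0 (subs e) (λ S → ι≥0 (crossing S)))
    go (suc (suc i)) eA = subst (_≤ℚ ∑ (subs e) (λ S → ι (crossing S))) (sym (cong (λ i → ι (i ℕ.≡ᵇ 1)) eA)) (∑≥0 (subs e) (λ S → ι≥0 (crossing S)))
    go (suc zero)    eA with ∃-subset R e 1 1 (ℕ.≤-reflexive (sym eA))
           (ℕ.s≤s⁻¹ (subst (2 ≤_) (trans (card-roles R e (alive-cover A e)) (cong (ℕ._+ card (freePart R e)) eA)) 2≤))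
    ... | S , S∈ , a , b , _ = ℚ.≤-trans (≡⇒≤ (trans (cong (λ i → ι (i ℕ.≡ᵇ 1)) eA)
            (sym (cong ι (cong₂ (λ i j → (i ℕ.≡ᵇ 1) ∧ (j ℕ.≡ᵇ 1)) a b)))))
          (∈⇒≤∑ (λ S → ι (crossing S)) (λ S → ι≥0 (crossing S)) S∈)

  -- An edge with exactly one vertex in A has another one outside, hence contains a crossing set;
  -- the loss is charged to all 2^k subsets of every edge.
  cover-lemma : ∀ k es → 2 ≤ k → All (λ e → card e ≡ k) es → ∃[ t ] ((∀ i → ∣ t i ∣ ≤ℚ 1ℚ) ×
    a⁻¹ * ((- γ 2 * q) * ∑ es one-signed - (Γ * (q * q)) * (2ℚ ^ k * ⟦ length es ⟧)) ≤ℚ excessForm γ es t)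
  cover-lemma k es 2≤k unif with first-moment γ es weights (λ _ → lower) (λ _ {S} _ → term≥lower S)
  ... | x , p = weights x , ∣weights∣≤1 x , ℚ.≤-trans below p
    where
    open ℚ.≤-Reasoning
    c = - γ 2 * q
    d = Γ * (q * q)
    per-edge : ∀ {e} → e ∈ es → a⁻¹ * (c * one-signed e - d * 2ℚ ^ k) ≤ℚ ∑ (subs e) lower
    per-edge {e} e∈ = begin
      a⁻¹ * (c * one-signed e - d * 2ℚ ^ k)
        ≤⟨ *-monoˡ a⁻¹≥0 (ℚ.+-monoˡ-≤ (- (d * 2ℚ ^ k)) (*-monoˡ (*≥0 (ℚ.<⇒≤ -γ₂>0) q≥0)
             (one-signed≤ e (subst (2 ≤_) (sym (All.lookup unif e∈)) 2≤k)))) ⟩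
      a⁻¹ * (c * ∑ (subs e) (λ S → ι (crossing S)) - d * 2ℚ ^ k)
        ≡⟨ cong (a⁻¹ *_) (cong₂ _+_ (sym (∑-*ˡ c (subs e) (λ S → ι (crossing S))))
             (trans (eq d (2ℚ ^ k)) (trans (cong (λ j → 2ℚ ^ j * - d) (sym (All.lookup unif e∈))) (sym (∑-subs-const e (- d)))))) ⟩
      a⁻¹ * (∑ (subs e) (λ S → c * ι (crossing S)) + ∑ (subs e) (λ S → - d))
        ≡⟨ trans (cong (a⁻¹ *_) (sym (∑-+ (subs e) (λ S → c * ι (crossing S)) (λ S → - d)))) (sym (∑-*ˡ a⁻¹ (subs e) (λ S → c * ι (crossing S) - d))) ⟩
      ∑ (subs e) lower ∎
      where
      eq : ∀ d z → - (d * z) ≡ z * - d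
      eq = solve-∀ ℚ-ring
    below : a⁻¹ * (c * ∑ es one-signed - d * (2ℚ ^ k * ⟦ length es ⟧)) ≤ℚ ∑ es (λ e → ∑ (subs e) lower)
    below = begin
      a⁻¹ * (c * ∑ es one-signed - d * (2ℚ ^ k * ⟦ length es ⟧))
        ≡⟨ cong (a⁻¹ *_) (cong₂ _+_ (sym (∑-*ˡ c es one-signed)) (trans (eq d (2ℚ ^ k) ⟦ length es ⟧) (sym (∑-const es (- (d * 2ℚ ^ k)))))) ⟩
      a⁻¹ * (∑ es (λ e → c * one-signed e) + ∑ es (λ _ → - (d * 2ℚ ^ k)))
        ≡⟨ trans (cong (a⁻¹ *_) (sym (∑-+ es (λ e → c * one-signed e) (λ _ → - (d * 2ℚ ^ k)))))
                 (sym (∑-*ˡ a⁻¹ es (λ e → c * one-signed e - d * 2ℚ ^ k))) ⟩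
      ∑ es (λ e → a⁻¹ * (c * one-signed e - d * 2ℚ ^ k))
        ≤⟨ ∑-mono es per-edge ⟩
      ∑ es (λ e → ∑ (subs e) lower) ∎
      where
      eq : ∀ d z l → - (d * (z * l)) ≡ l * - (d * z)
      eq = solve-∀ ℚ-ring

-- Codegrees and opposite weights on matched pairs

mem : ∀ {n} → Fin n → Vec Bool n → ℚ
mem i e = ι (lookup e i)

mem≥0 : ∀ {n} (i : Fin n) e → 0ℚ ≤ℚ mem i e
mem≥0 i e = ι≥0 (lookup e i)

mem≤1 : ∀ {n} (i : Fin n) e → mem i e ≤ℚ 1ℚ
mem≤1 i e = ι≤1 (lookup e i)

codeg : ∀ {n} → List (Vec Bool n) → Fin n → Fin n → ℚ
codeg es i j = ∑ es (λ e → mem i e * mem j e)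

⊆⇒∈-subs : ∀ {n} (e S : Vec Bool n) → (∀ i → lookup S i ≡ true → lookup e i ≡ true) → S ∈ subs e
⊆⇒∈-subs []      []          p = here refl
⊆⇒∈-subs (b ∷ e) (false ∷ S) p = false∷∈subs b e (⊆⇒∈-subs e S (λ i → p (suc i)))
⊆⇒∈-subs (b ∷ e) (true ∷ S)  p with p zero refl
... | refl = true∷∈subs e (⊆⇒∈-subs e S (λ i → p (suc i)))

card-flip-remove : ∀ {n} i (S : Vec Bool n) → lookup S i ≡ true → card S ≡ suc (card (flip i S))
card-flip-remove zero    (true ∷ S)  refl = refl
card-flip-remove (suc i) (true ∷ S)  p    = cong suc (card-flip-remove i S p)
card-flip-remove (suc i) (false ∷ S) p    = card-flip-remove i S p

card-flip-add : ∀ {n} i (S : Vec Bool n) → lookup S i ≡ false → card (flip i S) ≡ suc (card S)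
card-flip-add zero    (false ∷ S) refl = refl
card-flip-add (suc i) (true ∷ S)  p    = cong suc (card-flip-add i S p)
card-flip-add (suc i) (false ∷ S) p    = card-flip-add i S p

mono-remove : ∀ {n} i (S : Vec Bool n) t → lookup S i ≡ true → mono S t ≡ t i * mono (flip i S) t
mono-remove zero    (true ∷ S)  t refl = refl
mono-remove (suc i) (true ∷ S)  t p    = trans (cong (t zero *_) (mono-remove i S (t ∘ suc) p))
  (eq (t zero) (t (suc i)) (mono (flip i S) (t ∘ suc)))
  where
  eq : ∀ a b c → a * (b * c) ≡ b * (a * c)
  eq = solve-∀ ℚ-ring
mono-remove (suc i) (false ∷ S) t p    = mono-remove i S (t ∘ suc) p

mono-two : ∀ {n} (W : Vec Bool n) {i j} → i ≢ j → lookup W i ≡ true → lookup W j ≡ true → ∀ t → mono W t ≡ t i * (t j * mono (flip j (flip i W)) t)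
mono-two W {i} {j} ne i∈ j∈ t = trans (mono-remove i W t i∈) (cong (t i *_) (mono-remove j (flip i W) t (trans (lookup-flip-≢ i j W ne) j∈)))

card-two : ∀ {n} (W : Vec Bool n) {i j} → i ≢ j → lookup W i ≡ true → lookup W j ≡ true → card W ≡ suc (suc (card (flip j (flip i W))))
card-two W {i} {j} ne i∈ j∈ = trans (card-flip-remove i W i∈) (cong suc (card-flip-remove j (flip i W) (trans (lookup-flip-≢ i j W ne) j∈)))

mono-cong : ∀ {n} (S : Vec Bool n) {t t′} → (∀ i → lookup S i ≡ true → t i ≡ t′ i) → mono S t ≡ mono S t′
mono-cong []          p = refl
mono-cong (true ∷ S)  p = cong₂ _*_ (p zero refl) (mono-cong S (λ i → p (suc i)))
mono-cong (false ∷ S) p = mono-cong S (λ i → p (suc i))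

lookup-single-≢ : ∀ {n} (i j : Fin n) → i ≢ j → lookup (single i) j ≡ false
lookup-single-≢ zero    zero    p = ⊥-elim (p refl)
lookup-single-≢ zero    (suc j) p = lookup-∅ j
lookup-single-≢ (suc i) zero    p = refl
lookup-single-≢ (suc i) (suc j) p = lookup-single-≢ i j (p ∘ cong suc)

b≢true : ∀ {b} → b ≢ true → b ≡ false
b≢true {true}  p = ⊥-elim (p refl)
b≢true {false} p = refl

single-injective : ∀ {n} {i j : Fin n} → single i ≡ single j → i ≡ j
single-injective {i = i} {j} p with i Fin.≟ j
... | yes e = e
... | no ne with trans (sym (lookup-single j)) (trans (cong (λ S → lookup S j) (sym p)) (lookup-single-≢ i j ne))
...   | ()

-- A matching is an involution π of the vertices; the unmatched vertices are its fixed points,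
-- and they automatically get weight 0.
module Matched (C : Coefficients) {n} (π : Fin n → Fin n) (inv : ∀ w → π (π w) ≡ w) {q : ℚ}
  (q≥0 : 0ℚ ≤ℚ q) (q≤1 : q ≤ℚ 1ℚ) where

  open Coefficients C

  -- The weights of w and `π w` are always opposite. Half the difference of two coins, instead of
  -- one coin per pair, avoids choosing an orientation of the pair.
  weights : Vec Bool n → Fin n → ℚ
  weights x w = q * (½ * (sgn (lookup x w) - sgn (lookup x (π w))))

  ∣weights∣≤q : ∀ x w → ∣ weights x w ∣ ≤ℚ q
  ∣weights∣≤q x w = subst₂ _≤ℚ_ (sym (trans (ℚ.∣p*q∣≡∣p∣*∣q∣ q y) (cong (_* ∣ y ∣) (ℚ.0≤p⇒∣p∣≡p q≥0)))) (ℚ.*-identityʳ q)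
    (*-monoˡ q≥0 (half (lookup x w) (lookup x (π w))))
    where
    y = ½ * (sgn (lookup x w) - sgn (lookup x (π w)))
    half : ∀ a b → ∣ ½ * (sgn a - sgn b) ∣ ≤ℚ 1ℚ
    half true  true  = 0≤1
    half true  false = ℚ.≤-refl
    half false true  = ℚ.≤-refl
    half false false = 0≤1

  ∣weights∣≤1 : ∀ x w → ∣ weights x w ∣ ≤ℚ 1ℚ
  ∣weights∣≤1 x w = ℚ.≤-trans (∣weights∣≤q x w) q≤1

  π-inj : ∀ {v w} → π v ≡ π w → v ≡ w
  π-inj {v} {w} p = trans (sym (inv v)) (trans (cong π p) (inv w))

  moved : Fin n → ℚ
  moved w = ι (not ⌊ π w Fin.≟ w ⌋)

  pairTerm : Vec Bool n → Fin n → ℚ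
  pairTerm S w = moved w * (mem w S * mem (π w) S)

  pairTerm≥0 : ∀ S w → 0ℚ ≤ℚ pairTerm S w
  pairTerm≥0 S w = *≥0 (ι≥0 (not ⌊ π w Fin.≟ w ⌋)) (*≥0 (mem≥0 w S) (mem≥0 (π w) S))

  pairTerm≤mem : ∀ S w → pairTerm S w ≤ℚ mem w S
  pairTerm≤mem S w = subst (pairTerm S w ≤ℚ_) (trans (ℚ.*-identityˡ _) (ℚ.*-identityʳ (mem w S)))
    (*-mono (*≥0 (mem≥0 w S) (mem≥0 (π w) S)) 0≤1 (ι≤1 (not ⌊ π w Fin.≟ w ⌋)) (*-monoˡ (mem≥0 w S) (mem≤1 (π w) S)))

  pairs : Vec Bool n → ℚ
  pairs S = ∑ (allFin n) (pairTerm S)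

  pairs≥0 : ∀ S → 0ℚ ≤ℚ pairs S
  pairs≥0 S = ∑≥0 (allFin n) (pairTerm≥0 S)

  pairs≤card : ∀ S → pairs S ≤ℚ ⟦ card S ⟧
  pairs≤card S = ℚ.≤-trans (∑-mono (allFin n) (λ {w} _ → pairTerm≤mem S w)) (≡⇒≤ (∑-ι-lookup S))

  two : Vec Bool n → ℚ
  two S = ι (card S ℕ.≡ᵇ 2)

  -- A quarter of q² and not a half, because `pairs` counts each matched pair from both ends.
  gain : ℚ
  gain = - γ 2 * (½ * (½ * (q * q)))

  gain≥0 : 0ℚ ≤ℚ gain
  gain≥0 = *≥0 (ℚ.<⇒≤ -γ₂>0) (*≥0 0≤½ (*≥0 0≤½ (sq≥0 q)))

  -- Sets with a matched pair and a third vertex have at least three factors of size at most q;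
  -- being cubic, this loses against `gain` for small q.
  loss : ℚ
  loss = Γ * (q * (q * q))

  loss≥0 : 0ℚ ≤ℚ loss
  loss≥0 = *≥0 Γ≥0 (*≥0 q≥0 (sq≥0 q))

  lower : Vec Bool n → ℚ
  lower S = gain * (two S * pairs S) - loss * pairs S

  full : Vec Bool n → Fin n → Set
  full S w = π w ≢ w × lookup S w ≡ true × lookup S (π w) ≡ true

  full? : ∀ S w → Dec (full S w)
  full? S w = ¬? (π w Fin.≟ w) ×-dec ((lookup S w Data.Bool.≟ true) ×-dec (lookup S (π w) Data.Bool.≟ true))

  pairTerm-full : ∀ S w → full S w → pairTerm S w ≡ 1ℚ
  pairTerm-full S w (ne , a , b) with π w Fin.≟ w
  ... | yes e = ⊥-elim (ne e)
  ... | no _  = trans (cong₂ (λ u v → 1ℚ * (ι u * ι v)) a b) refl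

  pairTerm-¬full : ∀ S w → ¬ full S w → pairTerm S w ≡ 0ℚ
  pairTerm-¬full S w nf with π w Fin.≟ w
  ... | yes _ = ℚ.*-zeroˡ (mem w S * mem (π w) S)
  ... | no ne with lookup S w in a | lookup S (π w) in b
  ...   | true  | true  = ⊥-elim (nf (ne , refl , refl))
  ...   | true  | false = refl
  ...   | false | true  = refl
  ...   | false | false = refl

  weights-flip : ∀ x w → π w ≢ w → ∀ v → v ≢ π w →
    weights (flip w (flip (π w) x)) v ≡ (if ⌊ v Fin.≟ w ⌋ then - weights x v else weights x v)
  weights-flip x w ne v v≢πw with v Fin.≟ w
  ... | yes refl = trans (cong₂ (λ a b → q * (½ * (a - b)))
        (trans (cong sgn (trans (lookup-flip-≡ w (flip (π w) x)) (cong not (lookup-flip-≢ (π w) w x ne)))) (sgn-not (lookup x w)))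
        (trans (cong sgn (trans (lookup-flip-≢ w (π w) (flip (π w) x) (ne ∘ sym)) (lookup-flip-≡ (π w) x))) (sgn-not (lookup x (π w)))))
        (eq q (sgn (lookup x w)) (sgn (lookup x (π w))))
    where
    eq : ∀ q a b → q * (½ * (- a - - b)) ≡ - (q * (½ * (a - b)))
    eq = solve-∀ ℚ-ring
  ... | no v≢w = cong₂ (λ a b → q * (½ * (sgn a - sgn b)))
        (trans (lookup-flip-≢ w v (flip (π w) x) (v≢w ∘ sym)) (lookup-flip-≢ (π w) v x (v≢πw ∘ sym)))
        (trans (lookup-flip-≢ w (π v) (flip (π w) x) (λ e → v≢πw (trans (sym (inv v)) (cong π (sym e)))))
               (lookup-flip-≢ (π w) (π v) x (λ e → v≢w (sym (π-inj e)))))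

  -- Flipping the coins of w and of its partner negates the weight of w and leaves the other factors
  -- alone, since the partner is not in S. If w is its own partner, its weight is zero.
  no-pair⇒0 : ∀ S w → lookup S w ≡ true → ¬ full S w → 𝔼 (λ x → mono S (weights x)) ≡ 0ℚ
  no-pair⇒0 S w w∈ nf with π w Fin.≟ w
  ... | yes e = 𝔼-zero (λ x → trans (mono-remove w S (weights x) w∈) (trans (cong (_* mono (flip w S) (weights x))
        (trans (cong (λ v → q * (½ * (sgn (lookup x w) - sgn (lookup x v)))) e) (eq q (sgn (lookup x w)))))
        (ℚ.*-zeroˡ (mono (flip w S) (weights x)))))
    where
    eq : ∀ q a → q * (½ * (a - a)) ≡ 0ℚ
    eq = solve-∀ ℚ-ring
  ... | no ne = trans (sym (½-double e₀)) (trans (cong (λ z → ½ * (e₀ + z)) flipped) (cancel e₀))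
    where
    e₀ = 𝔼 (λ x → mono S (weights x))
    cancel : ∀ e → ½ * (e + - 1ℚ * e) ≡ 0ℚ
    cancel = solve-∀ ℚ-ring
    πw∉ : lookup S (π w) ≡ false
    πw∉ = b≢true (λ p → nf (ne , w∈ , p))
    odd : ∀ x → mono S (weights (flip w (flip (π w) x))) ≡ - 1ℚ * mono S (weights x)
    odd x = trans (mono-remove w S _ w∈) (trans (cong₂ _*_ head tail) (trans (eq (weights x w) (mono (flip w S) (weights x)))
      (cong (- 1ℚ *_) (sym (mono-remove w S (weights x) w∈)))))
      where
      eq : ∀ a b → (- a) * b ≡ - 1ℚ * (a * b)
      eq = solve-∀ ℚ-ring
      head : weights (flip w (flip (π w) x)) w ≡ - weights x w
      head with weights-flip x w ne w (ne ∘ sym)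
      ... | p with w Fin.≟ w
      ...   | yes _ = p
      ...   | no n≢ = ⊥-elim (n≢ refl)
      tail : mono (flip w S) (weights (flip w (flip (π w) x))) ≡ mono (flip w S) (weights x)
      tail = mono-cong (flip w S) other
        where
        other : ∀ v → lookup (flip w S) v ≡ true → weights (flip w (flip (π w) x)) v ≡ weights x v
        other v v∈ with v Fin.≟ π w
        ... | yes refl with trans (sym v∈) (trans (lookup-flip-≢ w (π w) S (ne ∘ sym)) πw∉)
        ...   | ()
        other v v∈ | no v≢πw with weights-flip x w ne v v≢πw
        ... | p with v Fin.≟ w
        ...   | no _ = p
        ...   | yes refl with trans (sym v∈) (trans (lookup-flip-≡ v S) (cong not w∈))
        ...     | ()
    flipped : e₀ ≡ - 1ℚ * e₀
    flipped = trans (sym (trans (𝔼-flip (π w) (λ x → mono S (weights (flip w x)))) (𝔼-flip w (λ x → mono S (weights x)))))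
      (trans (𝔼-cong odd) (𝔼-*ˡ (- 1ℚ) (λ x → mono S (weights x))))

  mono-pair : ∀ S w → full S w → ∀ t → mono S t ≡ t w * (t (π w) * mono (flip (π w) (flip w S)) t)
  mono-pair S w (ne , a , b) = mono-two S (ne ∘ sym) a b

  card-pair : ∀ S w → full S w → card S ≡ suc (suc (card (flip (π w) (flip w S))))
  card-pair S w (ne , a , b) = card-two S (ne ∘ sym) a b

  -- With probability one half the two coins differ and the product is -q²; otherwise both weights
  -- vanish.
  𝔼-pair : ∀ w → π w ≢ w → 𝔼 (λ x → weights x w * weights x (π w)) ≡ - (½ * (q * q))
  𝔼-pair w ne = trans (𝔼-cong point) (trans (𝔼-+ (λ _ → - (½ * (q * q))) (λ x → (½ * (q * q)) * (χ (single w) x * χ (single (π w)) x)))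
    (trans (cong₂ _+_ (𝔼-const {n} (- (½ * (q * q)))) (trans (𝔼-*ˡ (½ * (q * q)) (λ x → χ (single w) x * χ (single (π w)) x))
      (cong ((½ * (q * q)) *_) (trans (𝔼-χχ (single w) (single (π w))) (δ-≢ (single w) (single (π w)) (λ e → ne (sym (single-injective e))))))))
      (eq₀ q)))
    where
    eq₀ : ∀ q → - (½ * (q * q)) + (½ * (q * q)) * 0ℚ ≡ - (½ * (q * q))
    eq₀ = solve-∀ ℚ-ring
    point : ∀ x → weights x w * weights x (π w) ≡ - (½ * (q * q)) + (½ * (q * q)) * (χ (single w) x * χ (single (π w)) x)
    point x = trans (cong (λ v → weights x w * (q * (½ * (sgn (lookup x (π w)) - sgn (lookup x v))))) (inv w))
      (trans (eq q (sgn (lookup x w)) (sgn (lookup x (π w))))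
      (trans (cong₂ (λ a b → - (½ * (½ * (q * q))) * (a + b) + (½ * (q * q)) * (sgn (lookup x w) * sgn (lookup x (π w)))) (sgn² (lookup x w)) (sgn² (lookup x (π w))))
      (trans (eq′ q (sgn (lookup x w) * sgn (lookup x (π w))))
      (cong (λ z → - (½ * (q * q)) + (½ * (q * q)) * z) (sym (cong₂ _*_ (χ-single w x) (χ-single (π w) x)))))))
      where
      eq : ∀ q a b → (q * (½ * (a - b))) * (q * (½ * (b - a))) ≡ - (½ * (½ * (q * q))) * (a * a + b * b) + (½ * (q * q)) * (a * b)
      eq = solve-∀ ℚ-ring
      eq′ : ∀ q m → - (½ * (½ * (q * q))) * (1ℚ + 1ℚ) + (½ * (q * q)) * m ≡ - (½ * (q * q)) + (½ * (q * q)) * m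
      eq′ = solve-∀ ℚ-ring

  -- A nonempty set without a matched pair has mean zero, and the empty set has coefficient `γ 0`. A
  -- matched pair by itself gains through the negative `γ 2`; a matched pair with further vertices
  -- is charged to `loss`.
  term≥lower : ∀ S → lower S ≤ℚ γ (card S) * 𝔼 (λ x → mono S (weights x))
  term≥lower S with Fin.any? (full? S)
  ... | no ¬p = ≡⇒≤ (trans (trans (cong (λ z → gain * (two S * z) - loss * z) none) (eq gain (two S) loss)) (sym (zero-term (card S) refl)))
    where
    eq : ∀ g t l → g * (t * 0ℚ) - l * 0ℚ ≡ 0ℚ
    eq = solve-∀ ℚ-ring
    none : pairs S ≡ 0ℚ
    none = ∑-zero (allFin n) (λ {w} _ → pairTerm-¬full S w (λ f → ¬p (w , f)))
    zero-term : ∀ c → card S ≡ c → γ (card S) * 𝔼 (λ x → mono S (weights x)) ≡ 0ℚ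
    zero-term zero    e = trans (cong (_* 𝔼 (λ x → mono S (weights x))) (trans (cong γ e) γ₀)) (ℚ.*-zeroˡ (𝔼 (λ x → mono S (weights x))))
    zero-term (suc c) e with card>0 S e
    ... | w , w∈ = trans (cong (γ (card S) *_) (no-pair⇒0 S w w∈ (λ f → ¬p (w , f)))) (ℚ.*-zeroʳ (γ (card S)))
  ... | yes (w , f) = go (card (flip (π w) (flip w S))) refl
    where
    open ℚ.≤-Reasoning
    S″ = flip (π w) (flip w S)
    go : ∀ c → card S″ ≡ c → lower S ≤ℚ γ (card S) * 𝔼 (λ x → mono S (weights x))
    go zero e = begin
      gain * (two S * pairs S) - loss * pairs S
        ≤⟨ ℚ.+-mono-≤ (*-monoˡ gain≥0 (*-mono (pairs≥0 S) 0≤1 (ι≤1 (card S ℕ.≡ᵇ 2)) (subst (pairs S ≤ℚ_) (cong ⟦_⟧ card2) (pairs≤card S))))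
                      (neg-anti (*≥0 loss≥0 (pairs≥0 S))) ⟩
      gain * (1ℚ * ⟦ 2 ⟧) - 0ℚ
        ≡⟨ eq (γ 2) q ⟩
      γ 2 * - (½ * (q * q))
        ≡⟨ sym (cong₂ _*_ (cong γ card2) (trans (𝔼-cong (λ x → trans (mono-pair S w f (weights x))
             (cong (weights x w *_) (trans (cong (weights x (π w) *_) (mono-empty S″ (weights x) e))
               (ℚ.*-identityʳ (weights x (π w))))))) (𝔼-pair w (proj₁ f)))) ⟩
      γ (card S) * 𝔼 (λ x → mono S (weights x)) ∎
      where
      card2 : card S ≡ 2
      card2 = trans (card-pair S w f) (cong (λ c → suc (suc c)) e)
      eq : ∀ g q → (- g * (½ * (½ * (q * q)))) * (1ℚ * (1ℚ + (1ℚ + 0ℚ))) - 0ℚ ≡ g * - (½ * (q * q))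
      eq = solve-∀ ℚ-ring
    go (suc c) e with card>0 S″ e
    ... | u , u∈ = begin
      gain * (two S * pairs S) - loss * pairs S
        ≤⟨ ℚ.+-mono-≤ (≡⇒≤ (trans (cong (λ b → gain * (ι b * pairs S)) not2) (eq gain (pairs S))))
             (neg-anti (subst (_≤ℚ loss * pairs S) (ℚ.*-identityʳ loss) (*-monoˡ loss≥0
               (subst (_≤ℚ pairs S) (pairTerm-full S w f) (∈⇒≤∑ (pairTerm S) (pairTerm≥0 S) (∈-allFin w)))))) ⟩
      0ℚ - loss
        ≡⟨ ℚ.+-identityˡ (- loss) ⟩
      - loss
        ≤⟨ coeff-lower (∣γ∣≤Γ (card S)) (subst (∣ 𝔼 (λ x → mono S (weights x)) ∣ ≤ℚ_) (𝔼-const {n} (q * (q * q)))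
             (∣𝔼∣≤ (λ x → mono S (weights x)) bound)) ⟩
      γ (card S) * 𝔼 (λ x → mono S (weights x)) ∎
      where
      eq : ∀ g p → g * (0ℚ * p) ≡ 0ℚ
      eq = solve-∀ ℚ-ring
      not2 : (card S ℕ.≡ᵇ 2) ≡ false
      not2 = cong (ℕ._≡ᵇ 2) (trans (card-pair S w f) (cong (λ c → suc (suc c)) e))
      ∣*∣≤* : ∀ {x y c d} → ∣ x ∣ ≤ℚ c → ∣ y ∣ ≤ℚ d → ∣ x * y ∣ ≤ℚ c * d
      ∣*∣≤* {x} {y} {c} {d} p r = subst (_≤ℚ c * d) (sym (ℚ.∣p*q∣≡∣p∣*∣q∣ x y))
        (*-mono (ℚ.0≤∣p∣ y) (ℚ.≤-trans (ℚ.0≤∣p∣ x) p) p r)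
      bound : ∀ x → ∣ mono S (weights x) ∣ ≤ℚ q * (q * q)
      bound x = subst₂ _≤ℚ_ (cong ∣_∣ (sym (trans (mono-pair S w f (weights x))
          (cong (λ z → weights x w * (weights x (π w) * z)) (mono-remove u S″ (weights x) u∈)))))
          (cong (λ z → q * (q * z)) (ℚ.*-identityʳ q))
        (∣*∣≤* (∣weights∣≤q x w) (∣*∣≤* (∣weights∣≤q x (π w)) (∣*∣≤* (∣weights∣≤q x u)
          (∣mono∣≤1 (flip u S″) (∣weights∣≤1 x)))))

  pairs-mono : ∀ {e S} → S ∈ subs e → pairs S ≤ℚ pairs e
  pairs-mono {e} {S} S∈ = ∑-mono (allFin n) (λ {w} _ → *-monoˡ (ι≥0 (not ⌊ π w Fin.≟ w ⌋))
    (*-mono (mem≥0 (π w) S) (mem≥0 w e) (mem-mono w) (mem-mono (π w))))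
    where
    mem-mono : ∀ i → mem i S ≤ℚ mem i e
    mem-mono i with lookup S i in p
    ... | false = mem≥0 i e
    ... | true  = ≡⇒≤ (sym (cong ι (∈-subs⇒⊆ e S∈ i p)))

  pairTerm≤∑two : ∀ e w → pairTerm e w ≤ℚ ∑ (subs e) (λ S → two S * pairTerm S w)
  pairTerm≤∑two e w with full? e w
  ... | no nf = ℚ.≤-trans (≡⇒≤ (pairTerm-¬full e w nf)) (∑≥0 (subs e) (λ S → *≥0 (ι≥0 (card S ℕ.≡ᵇ 2)) (pairTerm≥0 S w)))
  ... | yes f@(ne , a , b) = ℚ.≤-trans (≡⇒≤ (trans (pairTerm-full e w f) (sym (cong₂ _*_ (cong (λ c → ι (c ℕ.≡ᵇ 2)) card2) (pairTerm-full S w full-S)))))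
      (∈⇒≤∑ (λ S → two S * pairTerm S w) (λ S → *≥0 (ι≥0 (card S ℕ.≡ᵇ 2)) (pairTerm≥0 S w)) (⊆⇒∈-subs e S S⊆e))
    where
    S = flip (π w) (single w)
    πw∉ : lookup (single w) (π w) ≡ false
    πw∉ = lookup-single-≢ w (π w) (ne ∘ sym)
    card2 : card S ≡ 2
    card2 = trans (card-flip-add (π w) (single w) πw∉) (cong suc (card-single w))
    full-S : full S w
    full-S = ne , trans (lookup-flip-≢ (π w) w (single w) ne) (lookup-single w) ,
             trans (lookup-flip-≡ (π w) (single w)) (cong not πw∉)
    S⊆e : ∀ i → lookup S i ≡ true → lookup e i ≡ true
    S⊆e i p with i Fin.≟ w | i Fin.≟ π w
    ... | yes refl | _        = a
    ... | no _     | yes refl = b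
    ... | no i≢w   | no i≢πw  with trans (sym p) (trans (lookup-flip-≢ (π w) i (single w) (i≢πw ∘ sym)) (lookup-single-≢ w i (i≢w ∘ sym)))
    ...   | ()

  -- Every matched pair inside an edge is one of its two-element subsets, while each of its 2^k
  -- subsets contains at most as many matched pairs as the edge. Exchanging the sums over edges and
  -- vertices turns the number of pairs into codegrees.
  matching-lemma : ∀ k es → All (λ e → card e ≡ k) es → ∃[ t ] ((∀ i → ∣ t i ∣ ≤ℚ 1ℚ) ×
    (gain - loss * 2ℚ ^ k) * ∑ (allFin n) (λ w → moved w * codeg es w (π w)) ≤ℚ excessForm γ es t)
  matching-lemma k es unif with first-moment γ es weights (λ _ → lower) (λ _ {S} _ → term≥lower S)
  ... | x , p = weights x , ∣weights∣≤1 x , ℚ.≤-trans below p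
    where
    open ℚ.≤-Reasoning
    c = gain - loss * 2ℚ ^ k
    ∑two≥ : ∀ e → pairs e ≤ℚ ∑ (subs e) (λ S → two S * pairs S)
    ∑two≥ e = begin
      pairs e                                                              ≤⟨ ∑-mono (allFin n) (λ {w} _ → pairTerm≤∑two e w) ⟩
      ∑ (allFin n) (λ w → ∑ (subs e) (λ S → two S * pairTerm S w))         ≡⟨ ∑-swap (allFin n) (subs e) (λ w S → two S * pairTerm S w) ⟩
      ∑ (subs e) (λ S → ∑ (allFin n) (λ w → two S * pairTerm S w))         ≡⟨ ∑-cong (subs e) (λ {S} _ → ∑-*ˡ (two S) (allFin n) (pairTerm S)) ⟩
      ∑ (subs e) (λ S → two S * pairs S)                                   ∎
    per-edge : ∀ {e} → e ∈ es → c * pairs e ≤ℚ ∑ (subs e) lower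
    per-edge {e} e∈ = begin
      c * pairs e
        ≡⟨ eq gain loss (2ℚ ^ k) (pairs e) ⟩
      gain * pairs e + - loss * (2ℚ ^ k * pairs e)
        ≡⟨ cong (λ z → gain * pairs e + - loss * z) (trans (cong (λ j → 2ℚ ^ j * pairs e) (sym (All.lookup unif e∈))) (sym (∑-subs-const e (pairs e)))) ⟩
      gain * pairs e + - loss * ∑ (subs e) (λ _ → pairs e)
        ≤⟨ ℚ.+-mono-≤ (*-monoˡ gain≥0 (∑two≥ e)) (≤-diff (subst (0ℚ ≤ℚ_)
             (eq′ loss (∑ (subs e) (λ _ → pairs e)) (∑ (subs e) pairs))
             (*≥0 loss≥0 (diff-≥0 (∑-mono (subs e) (pairs-mono {e})))))) ⟩
      gain * ∑ (subs e) (λ S → two S * pairs S) + - loss * ∑ (subs e) pairs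
        ≡⟨ cong₂ _+_ (sym (∑-*ˡ gain (subs e) (λ S → two S * pairs S))) (sym (∑-*ˡ (- loss) (subs e) pairs)) ⟩
      ∑ (subs e) (λ S → gain * (two S * pairs S)) + ∑ (subs e) (λ S → - loss * pairs S)
        ≡⟨ sym (∑-+ (subs e) (λ S → gain * (two S * pairs S)) (λ S → - loss * pairs S)) ⟩
      ∑ (subs e) (λ S → gain * (two S * pairs S) + - loss * pairs S)
        ≡⟨ ∑-cong (subs e) (λ {S} _ → eq″ (gain * (two S * pairs S)) loss (pairs S)) ⟩
      ∑ (subs e) lower ∎
      where
      eq : ∀ g l z p → (g - l * z) * p ≡ g * p + - l * (z * p)
      eq = solve-∀ ℚ-ring
      eq′ : ∀ l a b → l * (a - b) ≡ - l * b - - l * a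
      eq′ = solve-∀ ℚ-ring
      eq″ : ∀ g l p → g + - l * p ≡ g - l * p
      eq″ = solve-∀ ℚ-ring
    below : c * ∑ (allFin n) (λ w → moved w * codeg es w (π w)) ≤ℚ ∑ es (λ e → ∑ (subs e) lower)
    below = begin
      c * ∑ (allFin n) (λ w → moved w * codeg es w (π w))
        ≡⟨ cong (c *_) (∑-cong (allFin n) (λ {w} _ → sym (∑-*ˡ (moved w) es (λ e → mem w e * mem (π w) e)))) ⟩
      c * ∑ (allFin n) (λ w → ∑ es (λ e → pairTerm e w))
        ≡⟨ cong (c *_) (∑-swap (allFin n) es (λ w e → pairTerm e w)) ⟩
      c * ∑ es pairs
        ≡⟨ sym (∑-*ˡ c es pairs) ⟩
      ∑ es (λ e → c * pairs e)
        ≤⟨ ∑-mono es per-edge ⟩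
      ∑ es (λ e → ∑ (subs e) lower) ∎

-- Fourier expansion of the linear coefficients

flags : ∀ {n} → List (Vec Bool n) → List (Vec Bool n × Vec Bool n)
flags []       = []
flags (e ∷ es) = List.map (e ,_) (subs e) ++ flags es

∑-flags : ∀ {n} (es : List (Vec Bool n)) f → ∑ (flags es) f ≡ ∑ es (λ e → ∑ (subs e) (λ S → f (e , S)))
∑-flags []       f = trans (∑-[] f) (sym (∑-[] _))
∑-flags (e ∷ es) f = trans (∑-++ (List.map (e ,_) (subs e)) (flags es) f) (trans
  (cong₂ _+_ (∑-map (e ,_) (subs e) f) (∑-flags es f)) (sym (∑-∷ e es (λ e → ∑ (subs e) (λ S → f (e , S))))))

∈-flags : ∀ {n} (es : List (Vec Bool n)) {p} → p ∈ flags es → proj₁ p ∈ es × proj₂ p ∈ subs (proj₁ p)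
∈-flags (e ∷ es) i with ∈-++⁻ (List.map (e ,_) (subs e)) i
... | inj₂ j = there (proj₁ (∈-flags es j)) , proj₂ (∈-flags es j)
... | inj₁ j with ∈-map⁻ (e ,_) j
...   | S , S∈ , refl = here refl , S∈

∑-flags-edge : ∀ {n} k (es : List (Vec Bool n)) → All (λ e → card e ≡ k) es → ∀ f →
               ∑ (flags es) (λ p → f (proj₁ p)) ≡ 2ℚ ^ k * ∑ es f
∑-flags-edge k es unif f = trans (∑-flags es (λ p → f (proj₁ p))) (trans
  (∑-cong es (λ {e} e∈ → trans (∑-subs-const e (f e)) (cong (λ j → 2ℚ ^ j * f e) (All.lookup unif e∈))))
  (∑-*ˡ (2ℚ ^ k) es f))

∧-true : ∀ a {b} → a ∧ b ≡ true → a ≡ true × b ≡ true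
∧-true true p = refl , p

≡ᵇ-true : ∀ m n → (m ℕ.≡ᵇ n) ≡ true → m ≡ n
≡ᵇ-true zero    zero    p = refl
≡ᵇ-true (suc m) (suc n) p = cong suc (≡ᵇ-true m n p)

≡ᵇ-refl : ∀ n → (n ℕ.≡ᵇ n) ≡ true
≡ᵇ-refl zero    = refl
≡ᵇ-refl (suc n) = ≡ᵇ-refl n

-- a v is the part of the linear coefficient of the free vertex v that comes from the monomials of size ℓ + 1
-- whose other vertices are all signed.
module Linear (C : Coefficients) {n} (R : Vec Role n) (es : List (Vec Bool n)) where

  open Coefficients C

  -- An edge with one of its subsets. A set lying in several edges gives several flags, exactly as
  -- it is counted by `excessForm`.
  Flag : Set
  Flag = Vec Bool n × Vec Bool n

  SA SB : Flag → Vec Bool n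
  SA p = signedPart R (proj₂ p)
  SB p = freePart R (proj₂ p)

  typed : Flag → Bool
  typed p = alive R (proj₂ p) ∧ ((card (SB p) ℕ.≡ᵇ 1) ∧ (card (SA p) ℕ.≡ᵇ ℓ))

  typed⇒cards : ∀ p → typed p ≡ true → alive R (proj₂ p) ≡ true × card (SB p) ≡ 1 × card (SA p) ≡ ℓ
  typed⇒cards p t with ∧-true (alive R (proj₂ p)) t
  ... | a , b with ∧-true (card (SB p) ℕ.≡ᵇ 1) b
  ...   | c , d = a , ≡ᵇ-true _ _ c , ≡ᵇ-true _ _ d

  cards⇒typed : ∀ p → alive R (proj₂ p) ≡ true → card (SB p) ≡ 1 → card (SA p) ≡ ℓ → typed p ≡ true
  cards⇒typed p a b c = trans (cong₂ (λ u v → u ∧ ((v ℕ.≡ᵇ 1) ∧ (card (SA p) ℕ.≡ᵇ ℓ))) a b)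
    (trans (cong (ℕ._≡ᵇ ℓ) c) (≡ᵇ-refl ℓ))

  occurs : Flag → Fin n → Bool
  occurs p v = typed p ∧ lookup (SB p) v

  ω : Flag → Fin n → ℚ
  ω p v = ι (occurs p v)

  ω≥0 : ∀ p v → 0ℚ ≤ℚ ω p v
  ω≥0 p v = ι≥0 (occurs p v)

  a : Fin n → Vec Bool n → ℚ
  a v x = ∑ (flags es) (λ p → ω p v * χ (SA p) x)

  Q : Fin n → ℚ
  Q v = 𝔼² (a v)

  Q≥0 : ∀ v → 0ℚ ≤ℚ Q v
  Q≥0 v = 𝔼²≥0 (a v)

  -- The Fourier coefficient of `a v` at M. As γ is left out of `a v`, it is a count and cannot be
  -- negative.
  corr : Vec Bool n → Fin n → ℚ
  corr M v = ∑ (flags es) (λ p → ω p v * δ M (SA p))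

  𝔼-χ-a : ∀ M v → 𝔼 (λ x → χ M x * a v x) ≡ corr M v
  𝔼-χ-a M v = trans (𝔼-cong (λ x → trans (sym (∑-*ˡ (χ M x) (flags es) (λ p → ω p v * χ (SA p) x)))
      (∑-cong (flags es) (λ {p} _ → eq (χ M x) (ω p v) (χ (SA p) x)))))
    (trans (𝔼-∑ (flags es) (λ p x → ω p v * (χ M x * χ (SA p) x)))
      (∑-cong (flags es) (λ {p} _ → trans (𝔼-*ˡ (ω p v) (λ x → χ M x * χ (SA p) x)) (cong (ω p v *_) (𝔼-χχ M (SA p))))))
    where
    eq : ∀ c a b → c * (a * b) ≡ a * (c * b)
    eq = solve-∀ ℚ-ring

  Q≡ : ∀ v → Q v ≡ ∑ (flags es) (λ p → ω p v * corr (SA p) v)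
  Q≡ v = trans (𝔼-cong (λ x → trans (sym (∑-*ʳ (a v x) (flags es) (λ p → ω p v * χ (SA p) x)))
      (∑-cong (flags es) (λ {p} _ → ℚ.*-assoc (ω p v) (χ (SA p) x) (a v x)))))
    (trans (𝔼-∑ (flags es) (λ p x → ω p v * (χ (SA p) x * a v x)))
      (∑-cong (flags es) (λ {p} _ → trans (𝔼-*ˡ (ω p v) (λ x → χ (SA p) x * a v x)) (cong (ω p v *_) (𝔼-χ-a (SA p) v)))))

  -- The Fourier coefficient at M of the product of `a v` and `a v′`: it counts pairs of typed flags
  -- whose signed parts have symmetric difference M.
  corr² : Vec Bool n → Fin n → Fin n → ℚ
  corr² M v v′ = ∑ (flags es) (λ p → ∑ (flags es) (λ p′ → ω p v * (ω p′ v′ * δ (SA p ⊕ SA p′) M)))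

  corr²≥0 : ∀ M v v′ → 0ℚ ≤ℚ corr² M v v′
  corr²≥0 M v v′ = ∑≥0 (flags es) (λ p → ∑≥0 (flags es) (λ p′ → *≥0 (ω≥0 p v) (*≥0 (ω≥0 p′ v′) (δ≥0 (SA p ⊕ SA p′) M))))

  𝔼-χ-aa : ∀ M v v′ → 𝔼 (λ x → χ M x * (a v x * a v′ x)) ≡ corr² M v v′
  𝔼-χ-aa M v v′ = trans (𝔼-cong (λ x → trans (cong (χ M x *_) (∑-*-∑ (flags es) (flags es) (λ p → ω p v * χ (SA p) x) (λ p → ω p v′ * χ (SA p) x)))
      (trans (sym (∑-*ˡ (χ M x) (flags es) _)) (∑-cong (flags es) (λ {p} _ → trans (sym (∑-*ˡ (χ M x) (flags es) _))
        (∑-cong (flags es) (λ {p′} _ → trans (eq (χ M x) (ω p v) (χ (SA p) x) (ω p′ v′) (χ (SA p′) x))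
          (cong (λ z → (ω p v * ω p′ v′) * (z * χ M x)) (χ-⊕ (SA p) (SA p′) x)))))))))
    (trans (𝔼-∑ (flags es) (λ p x → ∑ (flags es) (λ p′ → (ω p v * ω p′ v′) * (χ (SA p ⊕ SA p′) x * χ M x))))
      (∑-cong (flags es) (λ {p} _ → trans (𝔼-∑ (flags es) (λ p′ x → (ω p v * ω p′ v′) * (χ (SA p ⊕ SA p′) x * χ M x)))
        (∑-cong (flags es) (λ {p′} _ → trans (𝔼-*ˡ (ω p v * ω p′ v′) (λ x → χ (SA p ⊕ SA p′) x * χ M x))
          (trans (cong ((ω p v * ω p′ v′) *_) (𝔼-χχ (SA p ⊕ SA p′) M)) (ℚ.*-assoc (ω p v) (ω p′ v′) _)))))))
    where
    eq : ∀ c a b a′ b′ → c * ((a * b) * (a′ * b′)) ≡ (a * a′) * ((b * b′) * c)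
    eq = solve-∀ ℚ-ring

  Deg-a : ∀ v → Deg n ℓ (a v)
  Deg-a v = Deg-∑ n ℓ (flags es) term
    where
    term : ∀ p → Deg n ℓ (λ x → ω p v * χ (SA p) x)
    term p with typed p in t
    ... | false = Deg-cong n ℓ (λ x → sym (ℚ.*-zeroˡ (χ (SA p) x))) (Deg-zero n ℓ)
    ... | true  = Deg-*ˡ n ℓ (ι (lookup (SB p) v)) (Deg-χ n ℓ (SA p) (ℕ.≤-reflexive (proj₂ (proj₂ (typed⇒cards p t)))))

  𝔼-a⁴ : ∀ v → 𝔼²² (a v) (a v) ≤ℚ (3ℚ ^ ℓ * 3ℚ ^ ℓ) * (Q v * Q v)
  𝔼-a⁴ v = bonami n ℓ ℓ (Deg-a v) (Deg-a v)

  ω-idem : ∀ p v → ω p v * ω p v ≡ ω p v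
  ω-idem p v with occurs p v
  ... | true  = refl
  ... | false = refl

  -- By Parseval `Q v` is a sum of squares of counts, so no cancellation occurs: every typed flag at
  -- v contributes at least its coincidence with itself.
  typed≤∑Q : ∑ (flags es) (λ p → ι (typed p)) ≤ℚ ∑ (allFin n) Q
  typed≤∑Q = begin
    ∑ (flags es) (λ p → ι (typed p))
      ≡⟨ ∑-cong (flags es) (λ {p} _ → sym (count p)) ⟩
    ∑ (flags es) (λ p → ∑ (allFin n) (λ v → ω p v))
      ≡⟨ ∑-swap (flags es) (allFin n) ω ⟩
    ∑ (allFin n) (λ v → ∑ (flags es) (λ p → ω p v))
      ≤⟨ ∑-mono (allFin n) (λ {v} _ → ∑-mono (flags es) (λ {p} p∈ → own p∈ v)) ⟩
    ∑ (allFin n) (λ v → ∑ (flags es) (λ p → ω p v * corr (SA p) v))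
      ≡⟨ ∑-cong (allFin n) (λ {v} _ → sym (Q≡ v)) ⟩
    ∑ (allFin n) Q ∎
    where
    open ℚ.≤-Reasoning
    own : ∀ {p} → p ∈ flags es → ∀ v → ω p v ≤ℚ ω p v * corr (SA p) v
    own {p} p∈ v = subst (_≤ℚ ω p v * corr (SA p) v) (ω-idem p v) (*-monoˡ (ω≥0 p v)
      (subst (_≤ℚ corr (SA p) v) (trans (cong (ω p v *_) (δ-refl (SA p))) (ℚ.*-identityʳ (ω p v)))
        (∈⇒≤∑ (λ p′ → ω p′ v * δ (SA p) (SA p′)) (λ p′ → *≥0 (ω≥0 p′ v) (δ≥0 (SA p) (SA p′))) p∈)))
    count : ∀ p → ∑ (allFin n) (λ v → ω p v) ≡ ι (typed p)
    count p with typed p in t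
    ... | false = ∑-zero (allFin n) (λ _ → refl)
    ... | true  = trans (∑-ι-lookup (SB p)) (trans (cong ⟦_⟧ (proj₁ (proj₂ (typed⇒cards p t)))) (ℚ.+-identityʳ 1ℚ))

-- Counting coincidences under a codegree bound

ι*≤ : ∀ b {x y} → 0ℚ ≤ℚ y → (b ≡ true → x ≤ℚ y) → ι b * x ≤ℚ y
ι*≤ true  {x} p f = subst (_≤ℚ _) (sym (ℚ.*-identityˡ x)) (f refl)
ι*≤ false {x} p f = subst (_≤ℚ _) (sym (ℚ.*-zeroˡ x)) p

⊆-card : ∀ {n} (S S′ : Vec Bool n) → (∀ i → lookup S i ≡ true → lookup S′ i ≡ true) → card S ≤ card S′
⊆-card []          []          p = z≤n
⊆-card (true ∷ S)  (true ∷ S′)  p = s≤s (⊆-card S S′ (λ i → p (suc i)))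
⊆-card (true ∷ S)  (false ∷ S′) p with p zero refl
... | ()
⊆-card (false ∷ S) (true ∷ S′)  p = ℕ.m≤n⇒m≤1+n (⊆-card S S′ (λ i → p (suc i)))
⊆-card (false ∷ S) (false ∷ S′) p = ⊆-card S S′ (λ i → p (suc i))

⊆-card-≡ : ∀ {n} (S S′ : Vec Bool n) → (∀ i → lookup S i ≡ true → lookup S′ i ≡ true) → card S′ ≤ card S → S ≡ S′
⊆-card-≡ []          []           p q = refl
⊆-card-≡ (true ∷ S)  (true ∷ S′)  p q = cong (true ∷_) (⊆-card-≡ S S′ (λ i → p (suc i)) (ℕ.s≤s⁻¹ q))
⊆-card-≡ (true ∷ S)  (false ∷ S′) p q with p zero refl
... | ()
⊆-card-≡ (false ∷ S) (true ∷ S′)  p q = ⊥-elim (ℕ.<-irrefl refl (ℕ.≤-trans q (⊆-card S S′ (λ i → p (suc i)))))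
⊆-card-≡ (false ∷ S) (false ∷ S′) p q = cong (false ∷_) (⊆-card-≡ S S′ (λ i → p (suc i)) q)

∃-∖ : ∀ {n} (S S′ : Vec Bool n) → S ≢ S′ → card S′ ≤ card S → ∃[ i ] (lookup S i ≡ true × lookup S′ i ≡ false)
∃-∖ S S′ ne q with Fin.any? (λ i → (lookup S i Data.Bool.≟ true) ×-dec (lookup S′ i Data.Bool.≟ false))
... | yes p = p
... | no ¬p = ⊥-elim (ne (⊆-card-≡ S S′ inside q))
  where
  inside : ∀ i → lookup S i ≡ true → lookup S′ i ≡ true
  inside i p with lookup S′ i in r
  ... | true  = refl
  ... | false = ⊥-elim (¬p (i , p , r))

∃-two : ∀ {n} (S : Vec Bool n) → 2 ≤ card S → ∃[ i ] ∃[ j ] (i ≢ j × lookup S i ≡ true × lookup S j ≡ true)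
∃-two S q with card S in c
∃-two S (s≤s (s≤s q)) | suc (suc m) with card>0 S c
... | i , i∈ with card>0 (flip i S) (ℕ.suc-injective (trans (sym (card-flip-remove i S i∈)) c))
... | j , j∈ with i Fin.≟ j
...   | no i≢j = i , j , i≢j , i∈ , trans (sym (lookup-flip-≢ i j S i≢j)) j∈
...   | yes refl with trans (sym j∈) (trans (lookup-flip-≡ i S) (cong not i∈))
...     | ()

lookup-⊕ : ∀ {n} (S S′ : Vec Bool n) i → lookup (S ⊕ S′) i ≡ (lookup S i xor lookup S′ i)
lookup-⊕ (a ∷ S) (b ∷ S′) zero    = refl
lookup-⊕ (a ∷ S) (b ∷ S′) (suc i) = lookup-⊕ S S′ i

not≟ : ∀ {n} {i j : Fin n} → i ≢ j → not ⌊ i Fin.≟ j ⌋ ≡ true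
not≟ {i = i} {j} ne with i Fin.≟ j
... | yes e = ⊥-elim (ne e)
... | no _  = refl

deg : ∀ {n} → List (Vec Bool n) → Fin n → ℚ
deg es i = ∑ es (mem i)

∑-deg : ∀ {n} k (es : List (Vec Bool n)) → All (λ e → card e ≡ k) es → ∑ (allFin n) (deg es) ≡ ⟦ k ⟧ * ⟦ length es ⟧
∑-deg {n} k es unif = trans (∑-swap (allFin n) es mem) (trans (∑-cong es (λ {e} e∈ →
  trans (∑-ι-lookup e) (cong ⟦_⟧ (All.lookup unif e∈)))) (trans (∑-const es ⟦ k ⟧) (ℚ.*-comm ⟦ length es ⟧ ⟦ k ⟧)))

module Counting (C : Coefficients) {n} (R : Vec Role n) (es : List (Vec Bool n)) (k : ℕ)
  (unif : All (λ e → card e ≡ k) es) {D : ℚ} (D≥0 : 0ℚ ≤ℚ D)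
  (light : ∀ i j → i ≢ j → lookup R i ≢ dead → lookup R j ≢ dead → codeg es i j ≤ℚ D) where

  open Coefficients C
  open Linear C R es

  live : Fin n → Bool
  live i = not (isDead (lookup R i))

  -- The condition under which `light` applies, as a Boolean, so that its indicator can stay inside
  -- sums over all vertices.
  distinct : Fin n → Fin n → Bool
  distinct i j = not ⌊ i Fin.≟ j ⌋ ∧ (live i ∧ live j)

  codeg′≤D : ∀ i j → ι (distinct i j) * codeg es i j ≤ℚ D
  codeg′≤D i j = ι*≤ (distinct i j) D≥0 below
    where
    below : distinct i j ≡ true → codeg es i j ≤ℚ D
    below t with i Fin.≟ j
    ... | no ne = light i j ne
        (λ e → case₁ (trans (sym (proj₁ (∧-true (live i) t))) (cong (not ∘ isDead) e)))
        (λ e → case₁ (trans (sym (proj₂ (∧-true (live i) t))) (cong (not ∘ isDead) e)))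
      where
      case₁ : true ≡ false → ⊥
      case₁ ()

  SA⇒S : ∀ p i → lookup (SA p) i ≡ true → lookup (proj₂ p) i ≡ true × lookup R i ≡ signed
  SA⇒S p i t with ∧-true (lookup (proj₂ p) i) (trans (sym (lookup-signedPart R (proj₂ p) i)) t)
  ... | a , b with lookup R i
  ...   | signed = a , refl

  SB⇒S : ∀ p i → lookup (SB p) i ≡ true → lookup (proj₂ p) i ≡ true × lookup R i ≡ free
  SB⇒S p i t with ∧-true (lookup (proj₂ p) i) (trans (sym (lookup-freePart R (proj₂ p) i)) t)
  ... | a , b with lookup R i
  ...   | free = a , refl

  SA⇒e : ∀ {p} → p ∈ flags es → ∀ i → lookup (SA p) i ≡ true → lookup (proj₁ p) i ≡ true
  SA⇒e {p} p∈ i t = ∈-subs⇒⊆ (proj₁ p) (proj₂ (∈-flags es p∈)) i (proj₁ (SA⇒S p i t))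

  SB⇒e : ∀ {p} → p ∈ flags es → ∀ i → lookup (SB p) i ≡ true → lookup (proj₁ p) i ≡ true
  SB⇒e {p} p∈ i t = ∈-subs⇒⊆ (proj₁ p) (proj₂ (∈-flags es p∈)) i (proj₁ (SB⇒S p i t))

  distinct-intro : ∀ {i j} → i ≢ j → live i ≡ true → live j ≡ true → distinct i j ≡ true
  distinct-intro ne a b = trans (cong₂ _∧_ (not≟ ne) (cong₂ _∧_ a b)) refl

  signed-live : ∀ {i} → lookup R i ≡ signed → live i ≡ true
  signed-live e = cong (not ∘ isDead) e

  free-live : ∀ {i} → lookup R i ≡ free → live i ≡ true
  free-live e = cong (not ∘ isDead) e

  signed≢free : ∀ {i j} → lookup R i ≡ signed → lookup R j ≡ free → i ≢ j
  signed≢free a b refl with trans (sym a) b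
  ... | ()

  ∑-size : ∀ {e} → e ∈ es → ∑ (allFin n) (λ i → mem i e) ≡ ⟦ k ⟧
  ∑-size {e} e∈ = trans (∑-ι-lookup e) (cong ⟦_⟧ (All.lookup unif e∈))

  K : ℚ
  K = 2ℚ ^ k

  K≥0 : 0ℚ ≤ℚ K
  K≥0 = ^≥0 (ℚ.nonNegative⁻¹ 2ℚ) k

  -- Typed sets at v with equal signed parts lie in edges sharing v and a further vertex, so D bounds their number.
  Q≤ : ∀ {Δ} → (∀ v → lookup R v ≡ free → deg es v ≤ℚ Δ) → 0ℚ ≤ℚ Δ →
       ∀ v → Q v ≤ℚ (2ℚ ^ k * 2ℚ ^ k) * (D * Δ)
  Q≤ {Δ} deg≤ Δ≥0 v = begin
    Q v
      ≡⟨ Q≡ v ⟩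
    ∑ (flags es) (λ p → ω p v * corr (SA p) v)
      ≤⟨ ∑-mono (flags es) (λ {p} p∈ → bound p p∈) ⟩
    ∑ (flags es) (λ p → (K * D) * (ι (isFree (lookup R v)) * mem v (proj₁ p)))
      ≡⟨ ∑-flags-edge k es unif (λ e → (K * D) * (ι (isFree (lookup R v)) * mem v e)) ⟩
    K * ∑ es (λ e → (K * D) * (ι (isFree (lookup R v)) * mem v e))
      ≡⟨ cong (K *_) (trans (∑-*ˡ (K * D) es (λ e → ι (isFree (lookup R v)) * mem v e)) (cong ((K * D) *_) (∑-*ˡ (ι (isFree (lookup R v))) es (mem v)))) ⟩
    K * ((K * D) * (ι (isFree (lookup R v)) * deg es v))
      ≤⟨ *-monoˡ K≥0 (*-monoˡ (*≥0 K≥0 D≥0) (ι*≤ (isFree (lookup R v)) Δ≥0 free-deg)) ⟩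
    K * ((K * D) * Δ)
      ≡⟨ eq K D Δ ⟩
    (K * K) * (D * Δ) ∎
    where
    open ℚ.≤-Reasoning
    eq : ∀ K D Δ → K * ((K * D) * Δ) ≡ (K * K) * (D * Δ)
    eq = solve-∀ ℚ-ring
    free-deg : isFree (lookup R v) ≡ true → deg es v ≤ℚ Δ
    free-deg t with lookup R v in r
    ... | free = deg≤ v r
    nn : ∀ p → 0ℚ ≤ℚ (K * D) * (ι (isFree (lookup R v)) * mem v (proj₁ p))
    nn p = *≥0 (*≥0 K≥0 D≥0) (*≥0 (ι≥0 (isFree (lookup R v))) (mem≥0 v (proj₁ p)))
    bound : ∀ p → p ∈ flags es → ω p v * corr (SA p) v ≤ℚ (K * D) * (ι (isFree (lookup R v)) * mem v (proj₁ p))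
    bound p p∈ = ι*≤ (occurs p v) (nn p) inner
      where
      inner : occurs p v ≡ true → corr (SA p) v ≤ℚ (K * D) * (ι (isFree (lookup R v)) * mem v (proj₁ p))
      inner t with ∧-true (typed p) t
      ... | ty , v∈ with card>0 (SA p) (trans (proj₂ (proj₂ (typed⇒cards p ty))) (ℓ≡ 2≤ℓ))
        where
        ℓ≡ : ∀ {m} → 2 ≤ m → m ≡ suc (ℕ.pred m)
        ℓ≡ (s≤s _) = refl
      ... | w , w∈ = begin
        corr (SA p) v
          ≤⟨ ∑-mono (flags es) (λ {p′} p′∈ → share p′ p′∈) ⟩
        ∑ (flags es) (λ p′ → ι (distinct w v) * (mem w (proj₁ p′) * mem v (proj₁ p′)))
          ≡⟨ ∑-flags-edge k es unif (λ e → ι (distinct w v) * (mem w e * mem v e)) ⟩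
        K * ∑ es (λ e → ι (distinct w v) * (mem w e * mem v e))
          ≡⟨ cong (K *_) (∑-*ˡ (ι (distinct w v)) es (λ e → mem w e * mem v e)) ⟩
        K * (ι (distinct w v) * codeg es w v)
          ≤⟨ *-monoˡ K≥0 (codeg′≤D w v) ⟩
        K * D
          ≡⟨ sym (trans (cong₂ (λ a b → (K * D) * (ι (isFree a) * ι b)) (proj₂ (SB⇒S p v v∈)) (SB⇒e p∈ v v∈)) (trans (cong ((K * D) *_) (ℚ.*-identityʳ 1ℚ)) (ℚ.*-identityʳ (K * D)))) ⟩
        (K * D) * (ι (isFree (lookup R v)) * mem v (proj₁ p)) ∎
        where
        dwv : distinct w v ≡ true
        dwv = distinct-intro (signed≢free (proj₂ (SA⇒S p w w∈)) (proj₂ (SB⇒S p v v∈)))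
                             (signed-live (proj₂ (SA⇒S p w w∈))) (free-live (proj₂ (SB⇒S p v v∈)))
        share : ∀ p′ → p′ ∈ flags es → ω p′ v * δ (SA p) (SA p′) ≤ℚ ι (distinct w v) * (mem w (proj₁ p′) * mem v (proj₁ p′))
        share p′ p′∈ = ι*≤ (occurs p′ v) (*≥0 (ι≥0 (distinct w v)) (*≥0 (mem≥0 w (proj₁ p′)) (mem≥0 v (proj₁ p′)))) both
          where
          both : occurs p′ v ≡ true → δ (SA p) (SA p′) ≤ℚ ι (distinct w v) * (mem w (proj₁ p′) * mem v (proj₁ p′))
          both t′ with δ-cases (SA p) (SA p′)
          ... | inj₂ (_ , e) = subst (_≤ℚ ι (distinct w v) * (mem w (proj₁ p′) * mem v (proj₁ p′))) (sym e)
                                 (*≥0 (ι≥0 (distinct w v)) (*≥0 (mem≥0 w (proj₁ p′)) (mem≥0 v (proj₁ p′))))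
          ... | inj₁ (s , e) = ≡⇒≤ (trans e (sym (cong₂ _*_ (cong ι dwv) (cong₂ _*_
                (cong ι (SA⇒e p′∈ w (subst (λ T → lookup T w ≡ true) s w∈)))
                (cong ι (SB⇒e p′∈ v (proj₂ (∧-true (typed p′) t′))))))))

  pairWeight : Flag → Fin n → Fin n → ℚ
  pairWeight p v v′ = ι (not ⌊ v Fin.≟ v′ ⌋) * (ι (lookup (SB p) v) * ι (lookup (SB p) v′))

  F : List Flag
  F = flags es

  V : List (Fin n)
  V = allFin n

  κ : ℚ
  κ = ⟦ k ⟧

  ∑³ : (Flag → Flag → Flag → ℚ) → ℚ
  ∑³ f = ∑ F (λ p₀ → ∑ F (λ p₁ → ∑ F (λ p₂ → f p₀ p₁ p₂)))

  ∑³-∑ : ∀ (f : Flag → Flag → Flag → Fin n → ℚ) → ∑³ (λ p₀ p₁ p₂ → ∑ V (f p₀ p₁ p₂)) ≡ ∑ V (λ w → ∑³ (λ p₀ p₁ p₂ → f p₀ p₁ p₂ w))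
  ∑³-∑ f = trans (∑-cong F (λ {p₀} _ → trans (∑-cong F (λ {p₁} _ → ∑-swap F V (f p₀ p₁)))
    (∑-swap F V (λ p₁ w → ∑ F (λ p₂ → f p₀ p₁ p₂ w))))) (∑-swap F V (λ p₀ w → ∑ F (λ p₁ → ∑ F (λ p₂ → f p₀ p₁ p₂ w))))

  ∑³-+ : ∀ f g → ∑³ (λ p₀ p₁ p₂ → f p₀ p₁ p₂ + g p₀ p₁ p₂) ≡ ∑³ f + ∑³ g
  ∑³-+ f g = trans (∑-cong F (λ {p₀} _ → trans (∑-cong F (λ {p₁} _ → ∑-+ F (f p₀ p₁) (g p₀ p₁)))
    (∑-+ F (λ p₁ → ∑ F (f p₀ p₁)) (λ p₁ → ∑ F (g p₀ p₁))))) (∑-+ F (λ p₀ → ∑ F (λ p₁ → ∑ F (f p₀ p₁))) (λ p₀ → ∑ F (λ p₁ → ∑ F (g p₀ p₁))))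

  ∑³-product : ∀ c (x y z : Vec Bool n → ℚ) → ∑³ (λ p₀ p₁ p₂ → c * (x (proj₁ p₀) * (y (proj₁ p₁) * z (proj₁ p₂))))
    ≡ (K * (K * K)) * (c * (∑ es x * (∑ es y * ∑ es z)))
  ∑³-product c x y z = trans (∑-cong F (λ {p₀} _ → trans (∑-cong F (λ {p₁} _ →
      trans (∑-*ˡ c F (λ p₂ → x (proj₁ p₀) * (y (proj₁ p₁) * z (proj₁ p₂)))) (cong (c *_)
      (trans (∑-*ˡ (x (proj₁ p₀)) F (λ p₂ → y (proj₁ p₁) * z (proj₁ p₂))) (cong (x (proj₁ p₀) *_) (∑-*ˡ (y (proj₁ p₁)) F (λ p₂ → z (proj₁ p₂))))))))
      (trans (∑-*ˡ c F (λ p₁ → x (proj₁ p₀) * (y (proj₁ p₁) * Z))) (cong (c *_)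
      (trans (∑-*ˡ (x (proj₁ p₀)) F (λ p₁ → y (proj₁ p₁) * Z)) (cong (x (proj₁ p₀) *_) (∑-*ʳ Z F (λ p₁ → y (proj₁ p₁)))))))))
    (trans (∑-*ˡ c F (λ p₀ → x (proj₁ p₀) * (Y * Z))) (trans (cong (c *_) (∑-*ʳ (Y * Z) F (λ p₀ → x (proj₁ p₀))))
      (trans (cong₂ (λ a b → c * (a * b)) (∑-flags-edge k es unif x) (cong₂ _*_ (∑-flags-edge k es unif y) (∑-flags-edge k es unif z)))
        (eq c K (∑ es x) (∑ es y) (∑ es z)))))
    where
    Y = ∑ F (λ p → y (proj₁ p))
    Z = ∑ F (λ p → z (proj₁ p))
    eq : ∀ c K x y z → c * ((K * x) * ((K * y) * (K * z))) ≡ (K * (K * K)) * (c * (x * (y * z)))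
    eq = solve-∀ ℚ-ring

  -- Either the two monomials agree and the edges e₁, e₂ share two vertices w, w′, or each of the two
  -- monomials has a vertex in e₀.
  c₁ c₂ : Fin n → Fin n → Fin n → Fin n → ℚ
  c₁ v v′ w w′ = ι (distinct w w′) * ι (distinct v v′)
  c₂ v v′ w w′ = ι (distinct v w) * ι (distinct v′ w′)

  x₁ x₂ x₃ y₁ : Fin n → Fin n → Fin n → Fin n → Vec Bool n → ℚ
  x₁ v v′ w w′ e = mem v e * mem v′ e
  x₂ v v′ w w′ e = (mem w e * mem w′ e) * mem v e
  x₃ v v′ w w′ e = (mem w e * mem w′ e) * mem v′ e
  y₁ v v′ w w′ e = ((mem v e * mem v′ e) * mem w e) * mem w′ e

  I₁ I₂ : Fin n → Fin n → Fin n → Fin n → Flag → Flag → Flag → ℚ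
  I₁ v v′ w w′ p₀ p₁ p₂ = c₁ v v′ w w′ * (x₁ v v′ w w′ (proj₁ p₀) * (x₂ v v′ w w′ (proj₁ p₁) * x₃ v v′ w w′ (proj₁ p₂)))
  I₂ v v′ w w′ p₀ p₁ p₂ = c₂ v v′ w w′ * (y₁ v v′ w w′ (proj₁ p₀) * ((mem v (proj₁ p₁) * mem w (proj₁ p₁)) * (mem v′ (proj₁ p₂) * mem w′ (proj₁ p₂))))

  I₁≥0 : ∀ v v′ w w′ p₀ p₁ p₂ → 0ℚ ≤ℚ I₁ v v′ w w′ p₀ p₁ p₂
  I₁≥0 v v′ w w′ (e₀ , _) (e₁ , _) (e₂ , _) = *≥0 (*≥0 (ι≥0 (distinct w w′)) (ι≥0 (distinct v v′))) (*≥0 (*≥0 (mem≥0 v e₀) (mem≥0 v′ e₀))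
    (*≥0 (*≥0 (*≥0 (mem≥0 w e₁) (mem≥0 w′ e₁)) (mem≥0 v e₁)) (*≥0 (*≥0 (mem≥0 w e₂) (mem≥0 w′ e₂)) (mem≥0 v′ e₂))))

  I₂≥0 : ∀ v v′ w w′ p₀ p₁ p₂ → 0ℚ ≤ℚ I₂ v v′ w w′ p₀ p₁ p₂
  I₂≥0 v v′ w w′ (e₀ , _) (e₁ , _) (e₂ , _) = *≥0 (*≥0 (ι≥0 (distinct v w)) (ι≥0 (distinct v′ w′)))
    (*≥0 (*≥0 (*≥0 (*≥0 (mem≥0 v e₀) (mem≥0 v′ e₀)) (mem≥0 w e₀)) (mem≥0 w′ e₀))
    (*≥0 (*≥0 (mem≥0 v e₁) (mem≥0 w e₁)) (*≥0 (mem≥0 v′ e₂) (mem≥0 w′ e₂))))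

  configurations : Fin n → Fin n → Flag → Flag → Flag → ℚ
  configurations v v′ p₀ p₁ p₂ = ∑ V (λ w → ∑ V (λ w′ → I₁ v v′ w w′ p₀ p₁ p₂ + I₂ v v′ w w′ p₀ p₁ p₂))

  configurations≥ : ∀ v v′ p₀ p₁ p₂ w w′ → I₁ v v′ w w′ p₀ p₁ p₂ + I₂ v v′ w w′ p₀ p₁ p₂ ≤ℚ configurations v v′ p₀ p₁ p₂
  configurations≥ v v′ p₀ p₁ p₂ w w′ = ℚ.≤-trans (∈⇒≤∑ (g w) (nn w) (∈-allFin w′))
    (∈⇒≤∑ (λ w → ∑ V (g w)) (λ w → ∑≥0 V (nn w)) (∈-allFin w))
    where
    g : Fin n → Fin n → ℚ
    g w w′ = I₁ v v′ w w′ p₀ p₁ p₂ + I₂ v v′ w w′ p₀ p₁ p₂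
    nn : ∀ w w′ → 0ℚ ≤ℚ g w w′
    nn w w′ = +≥0 (I₁≥0 v v′ w w′ p₀ p₁ p₂) (I₂≥0 v v′ w w′ p₀ p₁ p₂)

  configurations≥0 : ∀ v v′ p₀ p₁ p₂ → 0ℚ ≤ℚ configurations v v′ p₀ p₁ p₂
  configurations≥0 v v′ p₀ p₁ p₂ = ∑≥0 V (λ w → ∑≥0 V (λ w′ → +≥0 (I₁≥0 v v′ w w′ p₀ p₁ p₂) (I₂≥0 v v′ w w′ p₀ p₁ p₂)))

  -- Both signed parts have ℓ vertices. If they are equal, ℓ ≥ 2 supplies two common vertices w and
  -- w′. If not, equal size gives each a vertex outside the other; both of these lie in the
  -- symmetric difference, which is the signed part of `p₀`, hence in its edge.
  coincidence : ∀ v v′ {p₀ p₁ p₂} → p₀ ∈ F → p₁ ∈ F → p₂ ∈ F →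
    ι (not ⌊ v Fin.≟ v′ ⌋) * (ι (lookup (SB p₀) v) * (ι (lookup (SB p₀) v′) * (ω p₁ v * (ω p₂ v′ * δ (SA p₁ ⊕ SA p₂) (SA p₀)))))
    ≤ℚ configurations v v′ p₀ p₁ p₂
  coincidence v v′ {p₀} {p₁} {p₂} i₀ i₁ i₂ =
    ι*≤ (not ⌊ v Fin.≟ v′ ⌋) nn λ ne → ι*≤ (lookup (SB p₀) v) nn λ v∈₀ → ι*≤ (lookup (SB p₀) v′) nn λ v′∈₀ →
    ι*≤ (occurs p₁ v) nn λ t₁ → ι*≤ (occurs p₂ v′) nn λ t₂ → main (unequal ne) v∈₀ v′∈₀ t₁ t₂
    where
    nn = configurations≥0 v v′ p₀ p₁ p₂
    unequal : not ⌊ v Fin.≟ v′ ⌋ ≡ true → v ≢ v′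
    unequal t e with v Fin.≟ v′
    unequal () e | yes _
    ... | no ne = ne e
    1* : ∀ {x y} → x ≡ 1ℚ → y ≡ 1ℚ → x * y ≡ 1ℚ
    1* refl refl = refl
    main : v ≢ v′ → lookup (SB p₀) v ≡ true → lookup (SB p₀) v′ ≡ true → occurs p₁ v ≡ true → occurs p₂ v′ ≡ true →
           δ (SA p₁ ⊕ SA p₂) (SA p₀) ≤ℚ configurations v v′ p₀ p₁ p₂
    main v≢v′ v∈₀ v′∈₀ t₁ t₂ with δ-cases (SA p₁ ⊕ SA p₂) (SA p₀)
    ... | inj₂ (_ , e) = subst (_≤ℚ configurations v v′ p₀ p₁ p₂) (sym e) nn
    ... | inj₁ (s , e) with ∧-true (typed p₁) t₁ | ∧-true (typed p₂) t₂
    ...   | ty₁ , v∈₁ | ty₂ , v′∈₂ with Vec.≡-dec Data.Bool._≟_ (SA p₁) (SA p₂)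
    ...     | yes same = agree (∃-two (SA p₁) (subst (2 ≤_) (sym (proj₂ (proj₂ (typed⇒cards p₁ ty₁)))) 2≤ℓ))
      where
      agree : ∃[ w ] ∃[ w′ ] (w ≢ w′ × lookup (SA p₁) w ≡ true × lookup (SA p₁) w′ ≡ true) → δ (SA p₁ ⊕ SA p₂) (SA p₀) ≤ℚ configurations v v′ p₀ p₁ p₂
      agree (w , w′ , w≢w′ , w∈ , w′∈) = ℚ.≤-trans (≡⇒≤ (trans e (sym one))) (ℚ.≤-trans
          (subst (_≤ℚ I₁ v v′ w w′ p₀ p₁ p₂ + I₂ v v′ w w′ p₀ p₁ p₂) (ℚ.+-identityʳ (I₁ v v′ w w′ p₀ p₁ p₂)) (ℚ.+-monoʳ-≤ (I₁ v v′ w w′ p₀ p₁ p₂) (I₂≥0 v v′ w w′ p₀ p₁ p₂)))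
          (configurations≥ v v′ p₀ p₁ p₂ w w′))
        where
        w∈₂ = subst (λ T → lookup T w ≡ true) same w∈
        w′∈₂ = subst (λ T → lookup T w′ ≡ true) same w′∈
        one : I₁ v v′ w w′ p₀ p₁ p₂ ≡ 1ℚ
        one = 1* (1* (cong ι (distinct-intro w≢w′ (signed-live (proj₂ (SA⇒S p₁ w w∈))) (signed-live (proj₂ (SA⇒S p₁ w′ w′∈)))))
                     (cong ι (distinct-intro v≢v′ (free-live (proj₂ (SB⇒S p₀ v v∈₀))) (free-live (proj₂ (SB⇒S p₀ v′ v′∈₀))))))
                 (1* (1* (cong ι (SB⇒e i₀ v v∈₀)) (cong ι (SB⇒e i₀ v′ v′∈₀)))
                     (1* (1* (1* (cong ι (SA⇒e i₁ w w∈)) (cong ι (SA⇒e i₁ w′ w′∈))) (cong ι (SB⇒e i₁ v v∈₁)))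
                         (1* (1* (cong ι (SA⇒e i₂ w w∈₂)) (cong ι (SA⇒e i₂ w′ w′∈₂))) (cong ι (SB⇒e i₂ v′ v′∈₂)))))
    ...     | no differ = disagree (∃-∖ (SA p₁) (SA p₂) differ (ℕ.≤-reflexive (trans card₂ (sym card₁))))
                                   (∃-∖ (SA p₂) (SA p₁) (differ ∘ sym) (ℕ.≤-reflexive (trans card₁ (sym card₂))))
      where
      card₁ = proj₂ (proj₂ (typed⇒cards p₁ ty₁))
      card₂ = proj₂ (proj₂ (typed⇒cards p₂ ty₂))
      disagree : ∃[ w ] (lookup (SA p₁) w ≡ true × lookup (SA p₂) w ≡ false) → ∃[ w ] (lookup (SA p₂) w ≡ true × lookup (SA p₁) w ≡ false) →
                 δ (SA p₁ ⊕ SA p₂) (SA p₀) ≤ℚ configurations v v′ p₀ p₁ p₂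
      disagree (w , w∈ , w∉) (w′ , w′∈ , w′∉) = ℚ.≤-trans (≡⇒≤ (trans e (sym one))) (ℚ.≤-trans
          (subst (_≤ℚ I₁ v v′ w w′ p₀ p₁ p₂ + I₂ v v′ w w′ p₀ p₁ p₂) (ℚ.+-identityˡ (I₂ v v′ w w′ p₀ p₁ p₂)) (ℚ.+-monoˡ-≤ (I₂ v v′ w w′ p₀ p₁ p₂) (I₁≥0 v v′ w w′ p₀ p₁ p₂)))
          (configurations≥ v v′ p₀ p₁ p₂ w w′))
        where
        w∈₀ : lookup (SA p₀) w ≡ true
        w∈₀ = trans (cong (λ T → lookup T w) (sym s)) (trans (lookup-⊕ (SA p₁) (SA p₂) w) (cong₂ _xor_ w∈ w∉))
        w′∈₀ : lookup (SA p₀) w′ ≡ true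
        w′∈₀ = trans (cong (λ T → lookup T w′) (sym s)) (trans (lookup-⊕ (SA p₁) (SA p₂) w′) (cong₂ _xor_ w′∉ w′∈))
        one : I₂ v v′ w w′ p₀ p₁ p₂ ≡ 1ℚ
        one = 1* (1* (cong ι (distinct-intro (signed≢free (proj₂ (SA⇒S p₁ w w∈)) (proj₂ (SB⇒S p₀ v v∈₀)) ∘ sym) (free-live (proj₂ (SB⇒S p₀ v v∈₀))) (signed-live (proj₂ (SA⇒S p₁ w w∈)))))
                     (cong ι (distinct-intro (signed≢free (proj₂ (SA⇒S p₂ w′ w′∈)) (proj₂ (SB⇒S p₀ v′ v′∈₀)) ∘ sym) (free-live (proj₂ (SB⇒S p₀ v′ v′∈₀))) (signed-live (proj₂ (SA⇒S p₂ w′ w′∈))))))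
                 (1* (1* (1* (1* (cong ι (SB⇒e i₀ v v∈₀)) (cong ι (SB⇒e i₀ v′ v′∈₀))) (cong ι (SA⇒e i₀ w w∈₀))) (cong ι (SA⇒e i₀ w′ w′∈₀)))
                     (1* (1* (cong ι (SB⇒e i₁ v v∈₁)) (cong ι (SA⇒e i₁ w w∈))) (1* (cong ι (SB⇒e i₂ v′ v′∈₂)) (cong ι (SA⇒e i₂ w′ w′∈)))))

  κ≥0 : 0ℚ ≤ℚ κ
  κ≥0 = ⟦⟧≥0 k

  m : ℚ
  m = ⟦ length es ⟧

  collapse : ∀ (f : Vec Bool n → ℚ) → ∑ V (λ i → ∑ es (λ e → f e * mem i e)) ≡ κ * ∑ es f
  collapse f = trans (∑-swap V es (λ i e → f e * mem i e)) (trans (∑-cong es (λ {e} e∈ →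
    trans (∑-*ˡ (f e) V (λ i → mem i e)) (trans (cong (f e *_) (∑-size e∈)) (ℚ.*-comm (f e) κ)))) (∑-*ˡ κ es f))

  ∑-codeg : ∑ V (λ i → ∑ V (λ j → codeg es i j)) ≡ κ * (κ * m)
  ∑-codeg = trans (∑-cong V (λ {i} _ → collapse (mem i))) (trans (∑-*ˡ κ V (deg es)) (cong (κ *_) (∑-deg k es unif)))

  ∑⁴ : (Fin n → Fin n → Fin n → Fin n → ℚ) → ℚ
  ∑⁴ f = ∑ V (λ v → ∑ V (λ v′ → ∑ V (λ w → ∑ V (λ w′ → f v v′ w w′))))

  ∑⁴-mono : ∀ {f g} → (∀ v v′ w w′ → f v v′ w w′ ≤ℚ g v v′ w w′) → ∑⁴ f ≤ℚ ∑⁴ g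
  ∑⁴-mono p = ∑-mono V (λ {v} _ → ∑-mono V (λ {v′} _ → ∑-mono V (λ {w} _ → ∑-mono V (λ {w′} _ → p v v′ w w′))))

  ∑⁴-*ˡ : ∀ c f → ∑⁴ (λ v v′ w w′ → c * f v v′ w w′) ≡ c * ∑⁴ f
  ∑⁴-*ˡ c f = trans (∑-cong V (λ {v} _ → trans (∑-cong V (λ {v′} _ → trans (∑-cong V (λ {w} _ → ∑-*ˡ c V (f v v′ w)))
    (∑-*ˡ c V (λ w → ∑ V (f v v′ w))))) (∑-*ˡ c V (λ v′ → ∑ V (λ w → ∑ V (f v v′ w))))))
    (∑-*ˡ c V (λ v → ∑ V (λ v′ → ∑ V (λ w → ∑ V (f v v′ w)))))

  ∑⁴-+ : ∀ f g → ∑⁴ (λ v v′ w w′ → f v v′ w w′ + g v v′ w w′) ≡ ∑⁴ f + ∑⁴ g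
  ∑⁴-+ f g = trans (∑-cong V (λ {v} _ → trans (∑-cong V (λ {v′} _ → trans (∑-cong V (λ {w} _ → ∑-+ V (f v v′ w) (g v v′ w)))
    (∑-+ V (λ w → ∑ V (f v v′ w)) (λ w → ∑ V (g v v′ w))))) (∑-+ V (λ v′ → ∑ V (λ w → ∑ V (f v v′ w))) (λ v′ → ∑ V (λ w → ∑ V (g v v′ w))))))
    (∑-+ V (λ v → ∑ V (λ v′ → ∑ V (λ w → ∑ V (f v v′ w)))) (λ v → ∑ V (λ v′ → ∑ V (λ w → ∑ V (g v v′ w)))))

  ∑⁴-swap : ∀ f → ∑⁴ f ≡ ∑⁴ (λ w w′ v v′ → f v v′ w w′)
  ∑⁴-swap f = trans (∑-cong V (λ {v} _ → trans (∑-swap V V (λ v′ w → ∑ V (f v v′ w))) (∑-cong V (λ {w} _ → ∑-swap V V (λ v′ → f v v′ w)))))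
    (trans (∑-swap V V (λ v w → ∑ V (λ w′ → ∑ V (λ v′ → f v v′ w w′)))) (∑-cong V (λ {w} _ → ∑-swap V V (λ v w′ → ∑ V (λ v′ → f v v′ w w′)))))

  deg₃ : Fin n → Fin n → Fin n → ℚ
  deg₃ v w w′ = ∑ es (λ e → (mem w e * mem w′ e) * mem v e)

  deg₃≥0 : ∀ v w w′ → 0ℚ ≤ℚ deg₃ v w w′
  deg₃≥0 v w w′ = ∑≥0 es (λ e → *≥0 (*≥0 (mem≥0 w e) (mem≥0 w′ e)) (mem≥0 v e))

  deg₄ : Fin n → Fin n → Fin n → Fin n → ℚ
  deg₄ v v′ w w′ = ∑ es (y₁ v v′ w w′)

  codeg≥0 : ∀ i j → 0ℚ ≤ℚ codeg es i j
  codeg≥0 i j = ∑≥0 es (λ e → *≥0 (mem≥0 i e) (mem≥0 j e))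

  -- One factor D comes from the codegree of v and v′. Summing over v and v′ then leaves κ² times
  -- the squared codegree of w and w′, whose one factor gives the second D while the other sums to
  -- κ² m.
  bound₁ : ∑⁴ (λ v v′ w w′ → c₁ v v′ w w′ * (codeg es v v′ * (deg₃ v w w′ * deg₃ v′ w w′))) ≤ℚ (D * D) * (κ * (κ * (κ * (κ * m))))
  bound₁ = begin
    ∑⁴ (λ v v′ w w′ → c₁ v v′ w w′ * (codeg es v v′ * (deg₃ v w w′ * deg₃ v′ w w′)))
      ≤⟨ ∑⁴-mono (λ v v′ w w′ → ℚ.≤-trans
           (≡⇒≤ (eq (ι (distinct w w′)) (ι (distinct v v′)) (codeg es v v′) (deg₃ v w w′ * deg₃ v′ w w′)))
           (*-monoʳ (*≥0 (ι≥0 (distinct w w′)) (*≥0 (deg₃≥0 v w w′) (deg₃≥0 v′ w w′))) (codeg′≤D v v′))) ⟩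
    ∑⁴ (λ v v′ w w′ → D * (ι (distinct w w′) * (deg₃ v w w′ * deg₃ v′ w w′)))
      ≡⟨ trans (∑⁴-*ˡ D (λ v v′ w w′ → ι (distinct w w′) * (deg₃ v w w′ * deg₃ v′ w w′)))
           (cong (D *_) (∑⁴-swap (λ v v′ w w′ → ι (distinct w w′) * (deg₃ v w w′ * deg₃ v′ w w′)))) ⟩
    D * ∑⁴ (λ w w′ v v′ → ι (distinct w w′) * (deg₃ v w w′ * deg₃ v′ w w′))
      ≡⟨ cong (D *_) (∑-cong V (λ {w} _ → ∑-cong V (λ {w′} _ → inner w w′))) ⟩
    D * ∑ V (λ w → ∑ V (λ w′ → (ι (distinct w w′) * codeg es w w′) * ((κ * κ) * codeg es w w′)))
      ≤⟨ *-monoˡ D≥0 (∑-mono V (λ {w} _ → ∑-mono V (λ {w′} _ → *-monoʳ (*≥0 (*≥0 κ≥0 κ≥0) (codeg≥0 w w′)) (codeg′≤D w w′)))) ⟩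
    D * ∑ V (λ w → ∑ V (λ w′ → D * ((κ * κ) * codeg es w w′)))
      ≡⟨ cong (D *_) (trans (∑-cong V (λ {w} _ → trans (∑-cong V (λ {w′} _ → sym (ℚ.*-assoc D (κ * κ) (codeg es w w′)))) (∑-*ˡ (D * (κ * κ)) V (codeg es w))))
           (trans (∑-*ˡ (D * (κ * κ)) V (λ w → ∑ V (codeg es w))) (cong ((D * (κ * κ)) *_) ∑-codeg))) ⟩
    D * ((D * (κ * κ)) * (κ * (κ * m)))
      ≡⟨ eq′ D κ m ⟩
    (D * D) * (κ * (κ * (κ * (κ * m)))) ∎
    where
    open ℚ.≤-Reasoning
    eq : ∀ i j c d → (i * j) * (c * d) ≡ (j * c) * (i * d)
    eq = solve-∀ ℚ-ring
    eq′ : ∀ D κ m → D * ((D * (κ * κ)) * (κ * (κ * m))) ≡ (D * D) * (κ * (κ * (κ * (κ * m))))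
    eq′ = solve-∀ ℚ-ring
    inner : ∀ w w′ → ∑ V (λ v → ∑ V (λ v′ → ι (distinct w w′) * (deg₃ v w w′ * deg₃ v′ w w′)))
      ≡ (ι (distinct w w′) * codeg es w w′) * ((κ * κ) * codeg es w w′)
    inner w w′ = trans (∑-cong V (λ {v} _ → ∑-*ˡ (ι (distinct w w′)) V (λ v′ → deg₃ v w w′ * deg₃ v′ w w′)))
      (trans (∑-*ˡ (ι (distinct w w′)) V (λ v → ∑ V (λ v′ → deg₃ v w w′ * deg₃ v′ w w′)))
      (trans (cong (ι (distinct w w′) *_) (trans (sym (∑-*-∑ V V (λ v → deg₃ v w w′) (λ v → deg₃ v w w′)))
        (cong₂ _*_ (collapse (λ e → mem w e * mem w′ e)) (collapse (λ e → mem w e * mem w′ e)))))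
        (eq″ (ι (distinct w w′)) κ (codeg es w w′))))
      where
      eq″ : ∀ i κ c → i * ((κ * c) * (κ * c)) ≡ (i * c) * ((κ * κ) * c)
      eq″ = solve-∀ ℚ-ring

  -- Two codegrees give D²; what remains counts quadruples of vertices of one edge.
  bound₂ : ∑⁴ (λ v v′ w w′ → c₂ v v′ w w′ * (deg₄ v v′ w w′ * (codeg es v w * codeg es v′ w′))) ≤ℚ (D * D) * (κ * (κ * (κ * (κ * m))))
  bound₂ = begin
    ∑⁴ (λ v v′ w w′ → c₂ v v′ w w′ * (deg₄ v v′ w w′ * (codeg es v w * codeg es v′ w′)))
      ≤⟨ ∑⁴-mono (λ v v′ w w′ → ℚ.≤-trans
           (≡⇒≤ (eq (ι (distinct v w)) (ι (distinct v′ w′)) (codeg es v w) (codeg es v′ w′) (deg₄ v v′ w w′)))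
           (*-monoʳ (deg₄≥0 v v′ w w′) (*-mono (*≥0 (ι≥0 (distinct v′ w′)) (codeg≥0 v′ w′)) D≥0 (codeg′≤D v w) (codeg′≤D v′ w′)))) ⟩
    ∑⁴ (λ v v′ w w′ → (D * D) * deg₄ v v′ w w′)
      ≡⟨ ∑⁴-*ˡ (D * D) deg₄ ⟩
    (D * D) * ∑⁴ deg₄
      ≡⟨ cong ((D * D) *_) total ⟩
    (D * D) * (κ * (κ * (κ * (κ * m)))) ∎
    where
    open ℚ.≤-Reasoning
    eq : ∀ i j c d f → (i * j) * (f * (c * d)) ≡ ((i * c) * (j * d)) * f
    eq = solve-∀ ℚ-ring
    deg₄≥0 : ∀ v v′ w w′ → 0ℚ ≤ℚ deg₄ v v′ w w′
    deg₄≥0 v v′ w w′ = ∑≥0 es (λ e → *≥0 (*≥0 (*≥0 (mem≥0 v e) (mem≥0 v′ e)) (mem≥0 w e)) (mem≥0 w′ e))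
    total : ∑⁴ deg₄ ≡ κ * (κ * (κ * (κ * m)))
    total = trans (∑-cong V (λ {v} _ → trans (∑-cong V (λ {v′} _ → trans (∑-cong V (λ {w} _ → collapse (λ e → (mem v e * mem v′ e) * mem w e)))
        (trans (∑-*ˡ κ V (λ w → ∑ es (λ e → (mem v e * mem v′ e) * mem w e))) (cong (κ *_) (collapse (λ e → mem v e * mem v′ e))))))
        (trans (∑-*ˡ κ V (λ v′ → κ * codeg es v v′)) (cong (κ *_) (trans (∑-*ˡ κ V (codeg es v)) (cong (κ *_) (collapse (mem v))))))))
      (trans (∑-*ˡ κ V (λ v → κ * (κ * deg es v))) (cong (κ *_) (trans (∑-*ˡ κ V (λ v → κ * deg es v)) (cong (κ *_) (trans (∑-*ˡ κ V (deg es)) (cong (κ *_) (∑-deg k es unif)))))))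

  count : ℚ
  count = (K * (K * K)) * (2ℚ * ((D * D) * (κ * (κ * (κ * (κ * m))))))

  -- The near-independence of the linear coefficients: a free pair v, v′ inside a flag pays the
  -- Fourier coefficient of the product of `a v` and `a v′` at the signed part of that flag, and the
  -- total is O(D² m).
  counting-lemma : ∑ V (λ v → ∑ V (λ v′ → ∑ F (λ p₀ → pairWeight p₀ v v′ * corr² (SA p₀) v v′))) ≤ℚ count
  counting-lemma = begin
    ∑ V (λ v → ∑ V (λ v′ → ∑ F (λ p₀ → pairWeight p₀ v v′ * corr² (SA p₀) v v′)))
      ≤⟨ ∑-mono V (λ {v} _ → ∑-mono V (λ {v′} _ → per-pair v v′)) ⟩
    ∑⁴ (λ v v′ w w′ → ∑³ (λ p₀ p₁ p₂ → I₁ v v′ w w′ p₀ p₁ p₂ + I₂ v v′ w w′ p₀ p₁ p₂))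
      ≡⟨ ∑-cong V (λ {v} _ → ∑-cong V (λ {v′} _ → ∑-cong V (λ {w} _ → ∑-cong V (λ {w′} _ → trans
           (∑³-+ (I₁ v v′ w w′) (I₂ v v′ w w′)) (cong₂ _+_
             (∑³-product (c₁ v v′ w w′) (x₁ v v′ w w′) (x₂ v v′ w w′) (x₃ v v′ w w′))
             (∑³-product (c₂ v v′ w w′) (y₁ v v′ w w′) (λ e → mem v e * mem w e) (λ e → mem v′ e * mem w′ e))))))) ⟩
    ∑⁴ (λ v v′ w w′ → K³ * T₁ v v′ w w′ + K³ * T₂ v v′ w w′)
      ≡⟨ trans (∑⁴-+ (λ v v′ w w′ → K³ * T₁ v v′ w w′) (λ v v′ w w′ → K³ * T₂ v v′ w w′)) (cong₂ _+_ (∑⁴-*ˡ K³ T₁) (∑⁴-*ˡ K³ T₂)) ⟩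
    K³ * ∑⁴ T₁ + K³ * ∑⁴ T₂
      ≤⟨ ℚ.+-mono-≤ (*-monoˡ K³≥0 bound₁) (*-monoˡ K³≥0 bound₂) ⟩
    K³ * ((D * D) * (κ * (κ * (κ * (κ * m))))) + K³ * ((D * D) * (κ * (κ * (κ * (κ * m)))))
      ≡⟨ eq K³ ((D * D) * (κ * (κ * (κ * (κ * m))))) ⟩
    count ∎
    where
    open ℚ.≤-Reasoning
    K³ = K * (K * K)
    K³≥0 : 0ℚ ≤ℚ K³
    K³≥0 = *≥0 K≥0 (*≥0 K≥0 K≥0)
    T₁ T₂ : Fin n → Fin n → Fin n → Fin n → ℚ
    T₁ v v′ w w′ = c₁ v v′ w w′ * (codeg es v v′ * (deg₃ v w w′ * deg₃ v′ w w′))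
    T₂ v v′ w w′ = c₂ v v′ w w′ * (deg₄ v v′ w w′ * (codeg es v w * codeg es v′ w′))
    eq : ∀ a b → a * b + a * b ≡ a * (2ℚ * b)
    eq = solve-∀ ℚ-ring
    per-pair : ∀ v v′ → ∑ F (λ p₀ → pairWeight p₀ v v′ * corr² (SA p₀) v v′)
      ≤ℚ ∑ V (λ w → ∑ V (λ w′ → ∑³ (λ p₀ p₁ p₂ → I₁ v v′ w w′ p₀ p₁ p₂ + I₂ v v′ w w′ p₀ p₁ p₂)))
    per-pair v v′ = begin
      ∑ F (λ p₀ → pairWeight p₀ v v′ * corr² (SA p₀) v v′)
        ≡⟨ ∑-cong F (λ {p₀} _ → trans (sym (∑-*ˡ (pairWeight p₀ v v′) F (λ p₁ → ∑ F (λ p₂ → ω p₁ v * (ω p₂ v′ * δ (SA p₁ ⊕ SA p₂) (SA p₀))))))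
             (∑-cong F (λ {p₁} _ → trans (sym (∑-*ˡ (pairWeight p₀ v v′) F (λ p₂ → ω p₁ v * (ω p₂ v′ * δ (SA p₁ ⊕ SA p₂) (SA p₀)))))
               (∑-cong F (λ {p₂} _ → eq₃ (ι (not ⌊ v Fin.≟ v′ ⌋)) (ι (lookup (SB p₀) v)) (ι (lookup (SB p₀) v′)) (ω p₁ v * (ω p₂ v′ * δ (SA p₁ ⊕ SA p₂) (SA p₀)))))))) ⟩
      ∑³ (λ p₀ p₁ p₂ → ι (not ⌊ v Fin.≟ v′ ⌋) * (ι (lookup (SB p₀) v) * (ι (lookup (SB p₀) v′) * (ω p₁ v * (ω p₂ v′ * δ (SA p₁ ⊕ SA p₂) (SA p₀))))))
        ≤⟨ ∑-mono F (λ i₀ → ∑-mono F (λ i₁ → ∑-mono F (λ i₂ → coincidence v v′ i₀ i₁ i₂))) ⟩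
      ∑³ (configurations v v′)
        ≡⟨ trans (∑³-∑ (λ p₀ p₁ p₂ w → ∑ V (λ w′ → I₁ v v′ w w′ p₀ p₁ p₂ + I₂ v v′ w w′ p₀ p₁ p₂)))
             (∑-cong V (λ {w} _ → ∑³-∑ (λ p₀ p₁ p₂ w′ → I₁ v v′ w w′ p₀ p₁ p₂ + I₂ v v′ w w′ p₀ p₁ p₂))) ⟩
      ∑ V (λ w → ∑ V (λ w′ → ∑³ (λ p₀ p₁ p₂ → I₁ v v′ w w′ p₀ p₁ p₂ + I₂ v v′ w w′ p₀ p₁ p₂))) ∎
      where
      eq₃ : ∀ a b c d → (a * (b * c)) * d ≡ a * (b * (c * d))
      eq₃ = solve-∀ ℚ-ring

-- Truncation

trunc : ℚ → ℚ
trunc z = if ⌊ ∣ z ∣ ℚ.≤? 1ℚ ⌋ then z else 0ℚ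

cube : ℚ → ℚ
cube x = x * (x * x)

cube≥0 : ∀ {x} → 0ℚ ≤ℚ x → 0ℚ ≤ℚ cube x
cube≥0 {x} p = *≥0 p (sq≥0 x)

trunc-cases : ∀ z → (∣ z ∣ ≤ℚ 1ℚ × trunc z ≡ z) ⊎ (1ℚ ≤ℚ ∣ z ∣ × trunc z ≡ 0ℚ)
trunc-cases z with ∣ z ∣ ℚ.≤? 1ℚ
... | yes p = inj₁ (p , refl)
... | no ¬p = inj₂ (ℚ.<⇒≤ (ℚ.≰⇒> ¬p) , refl)

∣trunc∣≤1 : ∀ z → ∣ trunc z ∣ ≤ℚ 1ℚ
∣trunc∣≤1 z with trunc-cases z
... | inj₁ (p , e) = subst (λ u → ∣ u ∣ ≤ℚ 1ℚ) (sym e) p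
... | inj₂ (p , e) = subst (λ u → ∣ u ∣ ≤ℚ 1ℚ) (sym e) 0≤1

∣trunc∣≤ : ∀ z → ∣ trunc z ∣ ≤ℚ ∣ z ∣
∣trunc∣≤ z with trunc-cases z
... | inj₁ (p , e) = ≡⇒≤ (cong ∣_∣ e)
... | inj₂ (p , e) = subst (λ u → ∣ u ∣ ≤ℚ ∣ z ∣) (sym e) (ℚ.0≤∣p∣ z)

≤cube : ∀ {x} → 1ℚ ≤ℚ x → x ≤ℚ cube x
≤cube {x} p = subst (_≤ℚ cube x) (ℚ.*-identityʳ x) (*-monoˡ x≥0 (*-mono 0≤1 x≥0 p p))
  where x≥0 = ℚ.≤-trans 0≤1 p

≤+ˡ : ∀ x {y} → 0ℚ ≤ℚ y → x ≤ℚ x + y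
≤+ˡ x {y} p = subst (_≤ℚ x + y) (ℚ.+-identityʳ x) (ℚ.+-monoʳ-≤ x p)

≤+ʳ : ∀ x {y} → 0ℚ ≤ℚ y → x ≤ℚ y + x
≤+ʳ x {y} p = subst (_≤ℚ y + x) (ℚ.+-identityˡ x) (ℚ.+-monoˡ-≤ x p)

-- The larger factor is at least 1, so the product is at most its square and hence at most its cube.
product≤cubes : ∀ {x y} → 0ℚ ≤ℚ x → 0ℚ ≤ℚ y → (1ℚ ≤ℚ x ⊎ 1ℚ ≤ℚ y) → x * y ≤ℚ cube x + cube y
product≤cubes {x} {y} p q r with ℚ.≤-total x y
... | inj₁ x≤y = ℚ.≤-trans (*-monoʳ q x≤y) (ℚ.≤-trans
      (subst (_≤ℚ cube y) (ℚ.*-identityˡ (y * y)) (*-monoʳ (sq≥0 y) 1≤y)) (≤+ʳ (cube y) (cube≥0 p)))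
  where
  1≤y : 1ℚ ≤ℚ y
  1≤y = [ (λ s → ℚ.≤-trans s x≤y) , id ]′ r
... | inj₂ y≤x = ℚ.≤-trans (*-monoˡ p y≤x) (ℚ.≤-trans
      (subst (_≤ℚ cube x) (ℚ.*-identityˡ (x * x)) (*-monoʳ (sq≥0 x) 1≤x)) (≤+ˡ (cube x) (cube≥0 q)))
  where
  1≤x : 1ℚ ≤ℚ x
  1≤x = [ id , (λ s → ℚ.≤-trans s y≤x) ]′ r

triple≤cubes : ∀ {x y z} → 0ℚ ≤ℚ x → 0ℚ ≤ℚ y → 0ℚ ≤ℚ z → x * (y * z) ≤ℚ cube x + (cube y + cube z)
triple≤cubes {x} {y} {z} p q r with ℚ.≤-total x y
... | inj₁ x≤y with ℚ.≤-total y z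
...   | inj₁ y≤z = ℚ.≤-trans (*-mono (*≥0 q r) r (ℚ.≤-trans x≤y y≤z) (*-monoʳ r y≤z)) (ℚ.≤-trans (≤+ʳ (cube z) (cube≥0 q)) (≤+ʳ (cube y + cube z) (cube≥0 p)))
...   | inj₂ z≤y = ℚ.≤-trans (*-mono (*≥0 q r) q x≤y (*-monoˡ q z≤y)) (ℚ.≤-trans (≤+ˡ (cube y) (cube≥0 r)) (≤+ʳ (cube y + cube z) (cube≥0 p)))
triple≤cubes {x} {y} {z} p q r | inj₂ y≤x with ℚ.≤-total x z
...   | inj₁ x≤z = ℚ.≤-trans (*-mono (*≥0 q r) r x≤z (*-monoʳ r (ℚ.≤-trans y≤x x≤z))) (ℚ.≤-trans (≤+ʳ (cube z) (cube≥0 q)) (≤+ʳ (cube y + cube z) (cube≥0 p)))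
...   | inj₂ z≤x = ℚ.≤-trans (*-monoˡ p (*-mono r p y≤x z≤x)) (≤+ˡ (cube x) (+≥0 (cube≥0 q) (cube≥0 r)))

∣cube∣ : ℚ → ℚ
∣cube∣ z = cube ∣ z ∣

∣cube∣≥0 : ∀ z → 0ℚ ≤ℚ ∣cube∣ z
∣cube∣≥0 z = cube≥0 (ℚ.0≤∣p∣ z)

∣a-a∣ : ∀ a → ∣ a - a ∣ ≡ 0ℚ
∣a-a∣ a = cong ∣_∣ (ℚ.+-inverseʳ a)

-- Either z is kept, or |z| ≥ 1 and the error |z| is at most |z|³. Sending large values to 0 instead
-- of to ±1 makes the error the discarded quantity itself, here and for products.
trunc-error : ∀ z → ∣ trunc z - z ∣ ≤ℚ ∣cube∣ z
trunc-error z with trunc-cases z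
... | inj₁ (p , e) = subst (λ u → ∣ u - z ∣ ≤ℚ ∣cube∣ z) (sym e) (subst (_≤ℚ ∣cube∣ z) (sym (∣a-a∣ z)) (∣cube∣≥0 z))
... | inj₂ (p , e) = subst (λ u → ∣ u - z ∣ ≤ℚ ∣cube∣ z) (sym e)
      (subst (_≤ℚ ∣cube∣ z) (trans (sym (ℚ.∣-p∣≡∣p∣ z)) (cong ∣_∣ (sym (ℚ.+-identityˡ (- z))))) (≤cube p))

trunc-error₂ : ∀ z z′ → ∣ trunc z * trunc z′ - z * z′ ∣ ≤ℚ ∣cube∣ z + ∣cube∣ z′
trunc-error₂ z z′ = go (trunc-cases z) (trunc-cases z′)
  where
  big : trunc z * trunc z′ ≡ 0ℚ → (1ℚ ≤ℚ ∣ z ∣ ⊎ 1ℚ ≤ℚ ∣ z′ ∣) → ∣ trunc z * trunc z′ - z * z′ ∣ ≤ℚ ∣cube∣ z + ∣cube∣ z′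
  big e r = subst (λ u → ∣ u - z * z′ ∣ ≤ℚ ∣cube∣ z + ∣cube∣ z′) (sym e)
    (subst (_≤ℚ ∣cube∣ z + ∣cube∣ z′) (trans (sym (ℚ.∣p*q∣≡∣p∣*∣q∣ z z′)) (trans (sym (ℚ.∣-p∣≡∣p∣ (z * z′))) (cong ∣_∣ (sym (ℚ.+-identityˡ (- (z * z′)))))))
      (product≤cubes (ℚ.0≤∣p∣ z) (ℚ.0≤∣p∣ z′) r))
  go : _ → _ → ∣ trunc z * trunc z′ - z * z′ ∣ ≤ℚ ∣cube∣ z + ∣cube∣ z′
  go (inj₁ (_ , e)) (inj₁ (_ , e′)) = subst (_≤ℚ ∣cube∣ z + ∣cube∣ z′)
    (sym (trans (cong (λ u → ∣ u - z * z′ ∣) (cong₂ _*_ e e′)) (∣a-a∣ (z * z′)))) (+≥0 (∣cube∣≥0 z) (∣cube∣≥0 z′))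
  go (inj₂ (p , e)) _ = big (trans (cong (_* trunc z′) e) (ℚ.*-zeroˡ (trunc z′))) (inj₁ p)
  go (inj₁ _) (inj₂ (p , e)) = big (trans (cong (trunc z *_) e) (ℚ.*-zeroʳ (trunc z))) (inj₂ p)

-- From three free factors on, no main term is compared with: the whole product is already of third
-- order.
trunc-error₃ : ∀ z z′ z″ {r} → ∣ r ∣ ≤ℚ 1ℚ → ∣ trunc z * (trunc z′ * (trunc z″ * r)) ∣ ≤ℚ ∣cube∣ z + (∣cube∣ z′ + ∣cube∣ z″)
trunc-error₃ z z′ z″ {r} p = ℚ.≤-trans (subst (_≤ℚ ∣ z ∣ * (∣ z′ ∣ * ∣ z″ ∣)) (sym expand)
    (*-mono (*≥0 (ℚ.0≤∣p∣ (trunc z′)) (*≥0 (ℚ.0≤∣p∣ (trunc z″)) (ℚ.0≤∣p∣ r))) (ℚ.0≤∣p∣ z) (∣trunc∣≤ z)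
      (*-mono (*≥0 (ℚ.0≤∣p∣ (trunc z″)) (ℚ.0≤∣p∣ r)) (ℚ.0≤∣p∣ z′) (∣trunc∣≤ z′)
        (subst (∣ trunc z″ ∣ * ∣ r ∣ ≤ℚ_) (ℚ.*-identityʳ ∣ z″ ∣) (*-mono (ℚ.0≤∣p∣ r) (ℚ.0≤∣p∣ z″) (∣trunc∣≤ z″) p)))))
  (triple≤cubes (ℚ.0≤∣p∣ z) (ℚ.0≤∣p∣ z′) (ℚ.0≤∣p∣ z″))
  where
  expand : ∣ trunc z * (trunc z′ * (trunc z″ * r)) ∣ ≡ ∣ trunc z ∣ * (∣ trunc z′ ∣ * (∣ trunc z″ ∣ * ∣ r ∣))
  expand = trans (ℚ.∣p*q∣≡∣p∣*∣q∣ (trunc z) (trunc z′ * (trunc z″ * r))) (cong (∣ trunc z ∣ *_)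
    (trans (ℚ.∣p*q∣≡∣p∣*∣q∣ (trunc z′) (trunc z″ * r)) (cong (∣ trunc z′ ∣ *_) (ℚ.∣p*q∣≡∣p∣*∣q∣ (trunc z″) r))))

-- Either |a| ≤ θ, or |a| ≤ θ⁻¹ a². This bounds third moments by second and fourth ones without a
-- square root.
∣cube∣≤ : ∀ {θ θ⁻¹} → 0ℚ ≤ℚ θ → 0ℚ ≤ℚ θ⁻¹ → θ * θ⁻¹ ≡ 1ℚ → ∀ a → ∣cube∣ a ≤ℚ θ * (a * a) + θ⁻¹ * ((a * a) * (a * a))
∣cube∣≤ {θ} {θ⁻¹} θ≥0 θ⁻¹≥0 inv a = subst₂ _≤ℚ_ (cong (∣ a ∣ *_) (sym (∣∣*∣∣ a))) (distr θ θ⁻¹ (a * a))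
  (*-monoʳ (sq≥0 a) small)
  where
  distr : ∀ t u s → (t + u * s) * s ≡ t * s + u * (s * s)
  distr = solve-∀ ℚ-ring
  small : ∣ a ∣ ≤ℚ θ + θ⁻¹ * (a * a)
  small with ℚ.≤-total ∣ a ∣ θ
  ... | inj₁ p = ℚ.≤-trans p (≤+ˡ θ (*≥0 θ⁻¹≥0 (sq≥0 a)))
  ... | inj₂ p = ℚ.≤-trans (subst₂ _≤ℚ_ (trans (assoc θ θ⁻¹ ∣ a ∣) (trans (cong (_* ∣ a ∣) inv) (ℚ.*-identityˡ ∣ a ∣)))
        (cong (θ⁻¹ *_) (∣∣*∣∣ a)) (*-monoˡ θ⁻¹≥0 (*-monoʳ (ℚ.0≤∣p∣ a) p))) (≤+ʳ (θ⁻¹ * (a * a)) θ≥0)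
    where
    assoc : ∀ t u x → u * (t * x) ≡ (t * u) * x
    assoc = solve-∀ ℚ-ring

-- Weights from truncated linear coefficients

∑-single : ∀ {n} (v : Fin n) (f : Fin n → ℚ) → ∑ (allFin n) (λ u → ι (lookup (single v) u) * f u) ≡ f v
∑-single {n} v f = trans (∑-cong (allFin n) (λ {u} _ → trans (ℚ.*-comm (ι (lookup (single v) u)) (f u)) (cong (f u *_) (same u)))) (∑-δ-single v f)
  where
  same : ∀ u → ι (lookup (single v) u) ≡ δ (single v) (single u)
  same u with v Fin.≟ u
  ... | yes refl = trans (cong ι (lookup-single v)) (sym (δ-refl (single v)))
  ... | no ne    = trans (cong ι (lookup-single-≢ v u ne)) (sym (δ-≢ (single v) (single u) (ne ∘ single-injective)))

-- Characters are bounded by 1, so replacing f by its main term changes a Fourier coefficient by at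
-- most the mean error.
coeff-approx : ∀ {n} {Γ c} → ∣ c ∣ ≤ℚ Γ → ∀ M (f main h : Vec Bool n → ℚ) → (∀ x → ∣ f x - main x ∣ ≤ℚ h x) →
  c * 𝔼 (λ x → χ M x * main x) - Γ * 𝔼 h ≤ℚ c * 𝔼 (λ x → χ M x * f x)
coeff-approx {n} {Γ} {c} c≤ M f main h p = begin
  c * 𝔼 (λ x → χ M x * main x) - Γ * 𝔼 h
    ≤⟨ ℚ.+-monoʳ-≤ (c * 𝔼 (λ x → χ M x * main x)) (coeff-lower c≤ (∣𝔼∣≤ (λ x → χ M x * (f x - main x)) small)) ⟩
  c * 𝔼 (λ x → χ M x * main x) + c * 𝔼 (λ x → χ M x * (f x - main x))
    ≡⟨ sym (ℚ.*-distribˡ-+ c _ _) ⟩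
  c * (𝔼 (λ x → χ M x * main x) + 𝔼 (λ x → χ M x * (f x - main x)))
    ≡⟨ cong (c *_) (trans (sym (𝔼-+ (λ x → χ M x * main x) (λ x → χ M x * (f x - main x)))) (𝔼-cong (λ x → eq (χ M x) (main x) (f x)))) ⟩
  c * 𝔼 (λ x → χ M x * f x) ∎
  where
  open ℚ.≤-Reasoning
  eq : ∀ k m f → k * m + k * (f - m) ≡ k * f
  eq = solve-∀ ℚ-ring
  small : ∀ x → ∣ χ M x * (f x - main x) ∣ ≤ℚ h x
  small x = ℚ.≤-trans (subst₂ _≤ℚ_ (sym (ℚ.∣p*q∣≡∣p∣*∣q∣ (χ M x) (f x - main x))) (ℚ.*-identityˡ ∣ f x - main x ∣)
    (*-monoʳ (ℚ.0≤∣p∣ (f x - main x)) (∣χ∣≤1 M x))) (p x)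

-- Free vertices take the truncation of τ times their linear coefficient.
module Chaos (C : Coefficients) {n} (R : Vec Role n) (es : List (Vec Bool n)) (k : ℕ)
  (unif : All (λ e → card e ≡ k) es) {D : ℚ} (D≥0 : 0ℚ ≤ℚ D)
  (light : ∀ i j → i ≢ j → lookup R i ≢ dead → lookup R j ≢ dead → codeg es i j ≤ℚ D)
  {Δ : ℚ} (Δ≥0 : 0ℚ ≤ℚ Δ) (deg≤Δ : ∀ v → lookup R v ≡ free → deg es v ≤ℚ Δ) (τ : ℚ) where

  open Coefficients C
  open Linear C R es
  open Counting C R es k unif D≥0 light

  y g : Fin n → Vec Bool n → ℚ
  y v x = τ * a v x
  g v x = trunc (y v x)

  weights : Vec Bool n → Fin n → ℚ
  weights x = roleWeights R (λ v → g v x) x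

  ∣weights∣≤1 : ∀ x i → ∣ weights x i ∣ ≤ℚ 1ℚ
  ∣weights∣≤1 x = ∣roleWeights∣≤1 R x (λ v → ∣trunc∣≤1 (y v x))

  err : Fin n → ℚ
  err v = 𝔼 (λ x → ∣cube∣ (y v x))

  err≥0 : ∀ v → 0ℚ ≤ℚ err v
  err≥0 v = 𝔼≥0 (λ x → ∣cube∣≥0 (y v x))

  -- The gain of a typed flag, the correlations of its pairs of free vertices, and the truncation
  -- errors of its free vertices.
  first second third : Flag → ℚ
  first p  = ∑ V (λ v → ω p v * corr (SA p) v)
  second p = ∑ V (λ v → ∑ V (λ v′ → pairWeight p v v′ * corr² (SA p) v v′))
  third p  = ∑ V (λ v → ι (lookup (SB p) v) * err v)

  second≥0 : ∀ p → 0ℚ ≤ℚ second p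
  second≥0 p = ∑≥0 V (λ v → ∑≥0 V (λ v′ → *≥0 (*≥0 (ι≥0 (not ⌊ v Fin.≟ v′ ⌋)) (*≥0 (ι≥0 (lookup (SB p) v)) (ι≥0 (lookup (SB p) v′)))) (corr²≥0 (SA p) v v′)))

  third≥0 : ∀ p → 0ℚ ≤ℚ third p
  third≥0 p = ∑≥0 V (λ v → *≥0 (ι≥0 (lookup (SB p) v)) (err≥0 v))

  err≤third : ∀ p v → lookup (SB p) v ≡ true → err v ≤ℚ third p
  err≤third p v t = subst (_≤ℚ third p) (trans (cong (λ b → ι b * err v) t) (ℚ.*-identityˡ (err v)))
    (∈⇒≤∑ (λ v → ι (lookup (SB p) v) * err v) (λ v → *≥0 (ι≥0 (lookup (SB p) v)) (err≥0 v)) (∈-allFin v))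

  lower : Flag → ℚ
  lower p = (γ (suc ℓ) * τ) * first p + (- (Γ * ((τ * τ) * second p)) + - (Γ * (3ℚ * third p)))

  second-cost third-cost : Flag → ℚ
  second-cost p = - (Γ * ((τ * τ) * second p))
  third-cost p  = - (Γ * (3ℚ * third p))

  second-cost≤0 : ∀ p → second-cost p ≤ℚ 0ℚ
  second-cost≤0 p = neg-anti (*≥0 Γ≥0 (*≥0 (sq≥0 τ) (second≥0 p)))

  third-cost≤0 : ∀ p → third-cost p ≤ℚ 0ℚ
  third-cost≤0 p = neg-anti (*≥0 Γ≥0 (*≥0 (ℚ.nonNegative⁻¹ 3ℚ) (third≥0 p)))

  untyped⇒first≡0 : ∀ p → typed p ≡ false → first p ≡ 0ℚ
  untyped⇒first≡0 p t = ∑-zero V (λ {v} _ → trans (cong (λ b → ι (b ∧ lookup (SB p) v) * corr (SA p) v) t) (ℚ.*-zeroˡ (corr (SA p) v)))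

  𝔼-χ-y : ∀ M v → 𝔼 (λ x → χ M x * y v x) ≡ τ * corr M v
  𝔼-χ-y M v = trans (𝔼-cong (λ x → eq (χ M x) τ (a v x))) (trans (𝔼-*ˡ τ (λ x → χ M x * a v x)) (cong (τ *_) (𝔼-χ-a M v)))
    where
    eq : ∀ c t a → c * (t * a) ≡ t * (c * a)
    eq = solve-∀ ℚ-ring

  𝔼-χ-yy : ∀ M v v′ → 𝔼 (λ x → χ M x * (y v x * y v′ x)) ≡ (τ * τ) * corr² M v v′
  𝔼-χ-yy M v v′ = trans (𝔼-cong (λ x → eq (χ M x) τ (a v x) (a v′ x)))
    (trans (𝔼-*ˡ (τ * τ) (λ x → χ M x * (a v x * a v′ x))) (cong ((τ * τ) *_) (𝔼-χ-aa M v v′)))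
    where
    eq : ∀ c t a b → c * ((t * a) * (t * b)) ≡ (t * t) * (c * (a * b))
    eq = solve-∀ ℚ-ring

  -- `a v` is homogeneous of degree ℓ. Hence flags with one free vertex but another number of signed
  -- vertices have no main term, and among the coefficients only `γ (suc ℓ)` multiplies the gain.
  corr-wrong-size : ∀ M v → card M ≢ ℓ → corr M v ≡ 0ℚ
  corr-wrong-size M v ne = ∑-zero (flags es) (λ {p} _ → zero-term p)
    where
    zero-term : ∀ p → ω p v * δ M (SA p) ≡ 0ℚ
    zero-term p with occurs p v in t
    ... | false = ℚ.*-zeroˡ (δ M (SA p))
    ... | true  = trans (ℚ.*-identityˡ (δ M (SA p))) (δ-≢ M (SA p) (λ s → ne (trans (cong card s)
                    (proj₂ (proj₂ (typed⇒cards p (proj₁ (∧-true (typed p) t))))))))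

  module Term (p : Flag) (ok : alive R (proj₂ p) ≡ true) where

    S = proj₂ p
    A = SA p
    B = SB p
    c = γ (card S)
    value = c * 𝔼 (λ x → χ A x * mono B (λ v → g v x))

    cards : card S ≡ card A ℕ.+ card B
    cards = card-roles R S ok

    wrongB : card B ≢ 1 → typed p ≡ false
    wrongB ne = b≢true (λ t → ne (proj₁ (proj₂ (typed⇒cards p t))))

    open ℚ.≤-Reasoning

    untyped-lower : typed p ≡ false → lower p ≡ second-cost p + third-cost p
    untyped-lower t = trans (cong (λ z → (γ (suc ℓ) * τ) * z + (second-cost p + third-cost p)) (untyped⇒first≡0 p t)) (eq (γ (suc ℓ) * τ) (second-cost p + third-cost p))
      where
      eq : ∀ u v → u * 0ℚ + v ≡ v
      eq = solve-∀ ℚ-ring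

    drop-second : ∀ {z} → third-cost p ≤ℚ z → second-cost p + third-cost p ≤ℚ z
    drop-second {z} q = ℚ.≤-trans (ℚ.+-mono-≤ (second-cost≤0 p) q) (≡⇒≤ (ℚ.+-identityˡ z))

    -- The monomial is a character: its mean is zero unless the set is empty, and then `γ 0` is
    -- zero.
    case₀ : card B ≡ 0 → lower p ≤ℚ value
    case₀ eB = begin
      lower p                       ≡⟨ untyped-lower (wrongB (λ e → ℕ.0≢1+n (trans (sym eB) e))) ⟩
      second-cost p + third-cost p  ≤⟨ drop-second (third-cost≤0 p) ⟩
      0ℚ                            ≡⟨ sym (vanish (card A) refl) ⟩
      value                         ∎
      where
      vanish : ∀ i → card A ≡ i → value ≡ 0ℚ
      vanish zero    eA = trans (cong (_* 𝔼 (λ x → χ A x * mono B (λ v → g v x))) (trans (cong γ (trans cards (cong₂ ℕ._+_ eA eB))) γ₀)) (ℚ.*-zeroˡ (𝔼 (λ x → χ A x * mono B (λ v → g v x))))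
      vanish (suc i) eA = trans (cong (c *_) (trans (𝔼-cong (λ x → cong (χ A x *_) (trans (mono-empty B (λ v → g v x) eB) (sym (χ-∅ x)))))
        (trans (𝔼-χχ A (Vec.replicate n false)) (δ-≢ A (Vec.replicate n false) (λ q → ℕ.0≢1+n (trans (sym (card-∅ n)) (trans (cong card (sym q)) eA))))))) (ℚ.*-zeroʳ c)

    Γ*3≥ : ∀ {h} → h ≤ℚ 3ℚ * third p → third-cost p ≤ℚ - (Γ * h)
    Γ*3≥ q = neg-anti (*-monoˡ Γ≥0 q)

    t≤3t : third p ≤ℚ 3ℚ * third p
    t≤3t = subst (_≤ℚ 3ℚ * third p) (ℚ.*-identityˡ (third p)) (*-monoʳ (third≥0 p) 1≤3)

    -- Before truncation the value is τ times a Fourier coefficient of the linear coefficient of v,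
    -- which is the gain; truncation costs one third moment.
    case₁ : card B ≡ 1 → lower p ≤ℚ value
    case₁ eB with card≡1 B eB
    ... | v , B≡ = begin
      lower p
        ≡⟨ cong (_+ (second-cost p + third-cost p)) head ⟩
      c * (τ * corr A v) + (second-cost p + third-cost p)
        ≤⟨ ℚ.+-monoʳ-≤ (c * (τ * corr A v)) (drop-second (Γ*3≥ (ℚ.≤-trans (err≤third p v v∈) t≤3t))) ⟩
      c * (τ * corr A v) - Γ * err v
        ≡⟨ cong (λ z → c * z - Γ * err v) (sym (𝔼-χ-y A v)) ⟩
      c * 𝔼 (λ x → χ A x * y v x) - Γ * err v
        ≤⟨ coeff-approx (∣γ∣≤Γ (card S)) A (λ x → mono B (λ v → g v x)) (y v) (λ x → ∣cube∣ (y v x))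
             (λ x → subst (λ z → ∣ z - y v x ∣ ≤ℚ ∣cube∣ (y v x)) (sym (mono-B x)) (trunc-error (y v x))) ⟩
      value ∎
      where
      v∈ : lookup B v ≡ true
      v∈ = trans (cong (λ W → lookup W v) B≡) (lookup-single v)
      mono-B : ∀ x → mono B (λ v → g v x) ≡ g v x
      mono-B x = trans (mono-remove v B (λ v → g v x) v∈) (trans (cong (g v x *_) (mono-empty (flip v B) (λ v → g v x)
        (ℕ.suc-injective (trans (sym (card-flip-remove v B v∈)) eB)))) (ℚ.*-identityʳ (g v x)))
      head : (γ (suc ℓ) * τ) * first p ≡ c * (τ * corr A v)
      head with card A ℕ.≟ ℓ
      ... | no ne = trans (cong ((γ (suc ℓ) * τ) *_) (untyped⇒first≡0 p (b≢true (λ t → ne (proj₂ (proj₂ (typed⇒cards p t)))))))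
                     (trans (eq (γ (suc ℓ) * τ) c τ) (cong (λ z → c * (τ * z)) (sym (corr-wrong-size A v ne))))
        where
        eq : ∀ u c t → u * 0ℚ ≡ c * (t * 0ℚ)
        eq = solve-∀ ℚ-ring
      ... | yes eA = trans (cong₂ (λ s z → (γ s * τ) * z) (trans (ℕ.+-comm 1 ℓ) (sym (trans cards (cong₂ ℕ._+_ eA eB)))) one-term) (ℚ.*-assoc c τ (corr A v))
        where
        one-term : first p ≡ corr A v
        one-term = trans (∑-cong V (λ {u} _ → cong (λ b → ι b * corr A u) (trans (cong (_∧ lookup B u) (cards⇒typed p ok eB eA)) (cong (λ W → lookup W u) B≡))))
                         (∑-single v (corr A))

    -- The sign of the main term is unknown, so the correlation of v and v′ is charged in absolute
    -- value; truncation costs two third moments.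
    case₂ : ∀ v v′ → v ≢ v′ → lookup B v ≡ true → lookup B v′ ≡ true → card B ≡ 2 → lower p ≤ℚ value
    case₂ v v′ ne v∈ v′∈ eB = begin
      lower p
        ≡⟨ untyped-lower (wrongB (λ e → ℕ.1+n≢0 (ℕ.suc-injective (trans (sym eB) e)))) ⟩
      second-cost p + third-cost p
        ≤⟨ ℚ.+-mono-≤ (ℚ.≤-trans (neg-anti (*-monoˡ Γ≥0 (*-monoˡ (sq≥0 τ) pair≤))) (coeff-lower (∣γ∣≤Γ (card S)) ∣main∣≤))
             (Γ*3≥ (subst₂ _≤ℚ_ (sym (𝔼-+ (λ x → ∣cube∣ (y v x)) (λ x → ∣cube∣ (y v′ x)))) (eq (third p))
               (ℚ.≤-trans (ℚ.+-mono-≤ (err≤third p v v∈) (err≤third p v′ v′∈)) (≤+ʳ (third p + third p) (third≥0 p))))) ⟩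
      c * 𝔼 (λ x → χ A x * (y v x * y v′ x)) - Γ * 𝔼 (λ x → ∣cube∣ (y v x) + ∣cube∣ (y v′ x))
        ≤⟨ coeff-approx (∣γ∣≤Γ (card S)) A (λ x → mono B (λ v → g v x)) (λ x → y v x * y v′ x) (λ x → ∣cube∣ (y v x) + ∣cube∣ (y v′ x))
             (λ x → subst (λ z → ∣ z - y v x * y v′ x ∣ ≤ℚ ∣cube∣ (y v x) + ∣cube∣ (y v′ x)) (sym (mono-B x)) (trunc-error₂ (y v x) (y v′ x))) ⟩
      value ∎
      where
      eq : ∀ t → t + (t + t) ≡ 3ℚ * t
      eq = solve-∀ ℚ-ring
      mono-B : ∀ x → mono B (λ v → g v x) ≡ g v x * g v′ x
      mono-B x = trans (mono-two B ne v∈ v′∈ (λ v → g v x)) (cong (g v x *_) (trans (cong (g v′ x *_)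
        (mono-empty (flip v′ (flip v B)) (λ v → g v x) (ℕ.suc-injective (ℕ.suc-injective (trans (sym (card-two B ne v∈ v′∈)) eB))))) (ℚ.*-identityʳ (g v′ x))))
      ∣main∣≤ : ∣ 𝔼 (λ x → χ A x * (y v x * y v′ x)) ∣ ≤ℚ (τ * τ) * corr² A v v′
      ∣main∣≤ = ≡⇒≤ (trans (cong ∣_∣ (𝔼-χ-yy A v v′)) (ℚ.0≤p⇒∣p∣≡p (*≥0 (sq≥0 τ) (corr²≥0 A v v′))))
      pair≤ : corr² A v v′ ≤ℚ second p
      pair≤ = ℚ.≤-trans (≡⇒≤ (sym (trans (cong₂ (λ b z → (ι b * z) * corr² A v v′) (not≟ ne) (cong₂ (λ b b′ → ι b * ι b′) v∈ v′∈)) (ℚ.*-identityˡ (corr² A v v′)))))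
        (ℚ.≤-trans (∈⇒≤∑ (h v) (nn v) (∈-allFin v′)) (∈⇒≤∑ (λ v → ∑ V (h v)) (λ v → ∑≥0 V (nn v)) (∈-allFin v)))
        where
        h : Fin n → Fin n → ℚ
        h v v′ = pairWeight p v v′ * corr² A v v′
        nn : ∀ v v′ → 0ℚ ≤ℚ h v v′
        nn v v′ = *≥0 (*≥0 (ι≥0 (not ⌊ v Fin.≟ v′ ⌋)) (*≥0 (ι≥0 (lookup B v)) (ι≥0 (lookup B v′)))) (corr²≥0 A v v′)

    -- Three free factors are bounded by the sum of their cubes and the remaining factors by 1,
    -- which explains the 3 in `third-cost`.
    case₃ : ∀ v v′ u → v ≢ v′ → lookup B v ≡ true → lookup B v′ ≡ true → lookup (flip v′ (flip v B)) u ≡ true → lookup B u ≡ true →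
            card B ≢ 1 → lower p ≤ℚ value
    case₃ v v′ u ne v∈ v′∈ u∈″ u∈ eB = begin
      lower p
        ≡⟨ untyped-lower (wrongB eB) ⟩
      second-cost p + third-cost p
        ≤⟨ drop-second (Γ*3≥ (subst₂ _≤ℚ_ (sym (trans (𝔼-+ (λ x → ∣cube∣ (y v x)) (λ x → ∣cube∣ (y v′ x) + ∣cube∣ (y u x)))
             (cong (err v +_) (𝔼-+ (λ x → ∣cube∣ (y v′ x)) (λ x → ∣cube∣ (y u x)))))) (eq (third p))
             (ℚ.+-mono-≤ (err≤third p v v∈) (ℚ.+-mono-≤ (err≤third p v′ v′∈) (err≤third p u u∈))))) ⟩
      - (Γ * 𝔼 (λ x → ∣cube∣ (y v x) + (∣cube∣ (y v′ x) + ∣cube∣ (y u x))))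
        ≤⟨ coeff-lower (∣γ∣≤Γ (card S)) (∣𝔼∣≤ (λ x → χ A x * mono B (λ v → g v x)) bound) ⟩
      value ∎
      where
      eq : ∀ t → t + (t + t) ≡ 3ℚ * t
      eq = solve-∀ ℚ-ring
      W = flip u (flip v′ (flip v B))
      swap : ∀ c a b d r → c * (a * (b * (d * r))) ≡ a * (b * (d * (c * r)))
      swap = solve-∀ ℚ-ring
      bound : ∀ x → ∣ χ A x * mono B (λ v → g v x) ∣ ≤ℚ ∣cube∣ (y v x) + (∣cube∣ (y v′ x) + ∣cube∣ (y u x))
      bound x = subst (λ z → ∣ z ∣ ≤ℚ ∣cube∣ (y v x) + (∣cube∣ (y v′ x) + ∣cube∣ (y u x)))
        (sym (trans (cong (χ A x *_) (trans (mono-two B ne v∈ v′∈ (λ v → g v x)) (cong (λ z → g v x * (g v′ x * z)) (mono-remove u (flip v′ (flip v B)) (λ v → g v x) u∈″))))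
          (swap (χ A x) (g v x) (g v′ x) (g u x) (mono W (λ v → g v x)))))
        (trunc-error₃ (y v x) (y v′ x) (y u x) (∣*∣≤1 (∣χ∣≤1 A x) (∣mono∣≤1 W (λ v → ∣trunc∣≤1 (y v x)))))

    value≥lower : lower p ≤ℚ value
    value≥lower = go (card B) refl
      where
      go : ∀ j → card B ≡ j → lower p ≤ℚ value
      go zero          eB = case₀ eB
      go (suc zero)    eB = case₁ eB
      go (suc (suc j)) eB with ∃-two B (subst (2 ≤_) (sym eB) (s≤s (s≤s z≤n)))
      ... | v , v′ , ne , v∈ , v′∈ with card (flip v′ (flip v B)) in r
      ...   | zero  = case₂ v v′ ne v∈ v′∈ (trans (card-two B ne v∈ v′∈) (cong (λ z → suc (suc z)) r))
      ...   | suc _ with card>0 (flip v′ (flip v B)) r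
      ...     | u , u∈″ = case₃ v v′ u ne v∈ v′∈ u∈″ u∈ (λ e → ℕ.1+n≢0 (ℕ.suc-injective (trans (sym eB) e)))
        where
        u∈ : lookup B u ≡ true
        u∈ with u Fin.≟ v | u Fin.≟ v′
        ... | yes refl | _        = v∈
        ... | no _     | yes refl = v′∈
        ... | no u≢v   | no u≢v′  = trans (sym (trans (lookup-flip-≢ v′ u (flip v B) (u≢v′ ∘ sym)) (lookup-flip-≢ v u B (u≢v ∘ sym)))) u∈″

  term≥lower : ∀ p → lower p ≤ℚ γ (card (proj₂ p)) * 𝔼 (λ x → mono (proj₂ p) (weights x))
  term≥lower p = go (alive R (proj₂ p)) refl
    where
    go : ∀ b → alive R (proj₂ p) ≡ b → lower p ≤ℚ γ (card (proj₂ p)) * 𝔼 (λ x → mono (proj₂ p) (weights x))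
    go true  ok = subst (λ z → lower p ≤ℚ γ (card (proj₂ p)) * z)
      (sym (𝔼-cong (λ x → trans (mono-roles R (λ v → g v x) x (proj₂ p)) (trans (cong (λ b → ι b * (χ (SA p) x * mono (SB p) (λ v → g v x))) ok)
        (ℚ.*-identityˡ (χ (SA p) x * mono (SB p) (λ v → g v x)))))))
      (Term.value≥lower p ok)
    go false ok = subst (lower p ≤ℚ_) (sym (trans (cong (γ (card (proj₂ p)) *_) (𝔼-zero (λ x → trans (mono-roles R (λ v → g v x) x (proj₂ p))
        (trans (cong (λ b → ι b * (χ (SA p) x * mono (SB p) (λ v → g v x))) ok) (ℚ.*-zeroˡ (χ (SA p) x * mono (SB p) (λ v → g v x))))))) (ℚ.*-zeroʳ (γ (card (proj₂ p))))))
      (ℚ.≤-trans (ℚ.+-mono-≤ (≡⇒≤ (trans (cong ((γ (suc ℓ) * τ) *_) (untyped⇒first≡0 p (cong (_∧ ((card (SB p) ℕ.≡ᵇ 1) ∧ (card (SA p) ℕ.≡ᵇ ℓ))) ok))) (ℚ.*-zeroʳ (γ (suc ℓ) * τ))))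
        (ℚ.+-mono-≤ (second-cost≤0 p) (third-cost≤0 p))) (≡⇒≤ refl))

  SQ : ℚ
  SQ = ∑ V Q

  SQ≥0 : 0ℚ ≤ℚ SQ
  SQ≥0 = ∑≥0 V Q≥0

  -- Parseval, summed over all vertices: the total gain is the sum of the variances of the linear
  -- coefficients.
  ∑-first : ∑ F first ≡ SQ
  ∑-first = trans (∑-swap F V (λ p v → ω p v * corr (SA p) v)) (∑-cong V (λ {v} _ → sym (Q≡ v)))

  ∑-second : ∑ F second ≤ℚ count
  ∑-second = ℚ.≤-trans (≡⇒≤ (trans (∑-swap F V (λ p v → ∑ V (λ v′ → pairWeight p v v′ * corr² (SA p) v v′)))
    (∑-cong V (λ {v} _ → ∑-swap F V (λ p v′ → pairWeight p v v′ * corr² (SA p) v v′))))) counting-lemma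

  module _ {θ θ⁻¹ : ℚ} (θ≥0 : 0ℚ ≤ℚ θ) (θ⁻¹≥0 : 0ℚ ≤ℚ θ⁻¹) (θ*θ⁻¹ : θ * θ⁻¹ ≡ 1ℚ) where

    open ℚ.≤-Reasoning

    -- Bounds the third absolute moment of `a v` relative to `Q v`: Bonami gives the fourth moment
    -- as 9^ℓ `Q v`², and `Q≤` bounds one of the two factors.
    moment : ℚ
    moment = θ + θ⁻¹ * ((3ℚ ^ ℓ * 3ℚ ^ ℓ) * ((K * K) * (D * Δ)))

    err≤ : ∀ v → err v ≤ℚ (∣cube∣ τ * moment) * Q v
    err≤ v = begin
      err v
        ≡⟨ trans (𝔼-cong (λ x → trans (cong cube (ℚ.∣p*q∣≡∣p∣*∣q∣ τ (a v x))) (cube-* ∣ τ ∣ ∣ a v x ∣))) (𝔼-*ˡ (∣cube∣ τ) (λ x → ∣cube∣ (a v x))) ⟩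
      ∣cube∣ τ * 𝔼 (λ x → ∣cube∣ (a v x))
        ≤⟨ *-monoˡ (∣cube∣≥0 τ) (𝔼-mono (λ x → ∣cube∣≤ θ≥0 θ⁻¹≥0 θ*θ⁻¹ (a v x))) ⟩
      ∣cube∣ τ * 𝔼 (λ x → θ * (a v x * a v x) + θ⁻¹ * ((a v x * a v x) * (a v x * a v x)))
        ≡⟨ cong (∣cube∣ τ *_) (trans (𝔼-+ (λ x → θ * (a v x * a v x)) (λ x → θ⁻¹ * ((a v x * a v x) * (a v x * a v x))))
             (cong₂ _+_ (𝔼-*ˡ θ (λ x → a v x * a v x)) (𝔼-*ˡ θ⁻¹ (λ x → (a v x * a v x) * (a v x * a v x))))) ⟩
      ∣cube∣ τ * (θ * Q v + θ⁻¹ * 𝔼²² (a v) (a v))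
        ≤⟨ *-monoˡ (∣cube∣≥0 τ) (ℚ.+-monoʳ-≤ (θ * Q v) (*-monoˡ θ⁻¹≥0 (ℚ.≤-trans (𝔼-a⁴ v)
             (*-monoˡ (*≥0 (3^≥0 ℓ) (3^≥0 ℓ)) (*-monoʳ (Q≥0 v) (Q≤ deg≤Δ Δ≥0 v)))))) ⟩
      ∣cube∣ τ * (θ * Q v + θ⁻¹ * ((3ℚ ^ ℓ * 3ℚ ^ ℓ) * (((K * K) * (D * Δ)) * Q v)))
        ≡⟨ eq (∣cube∣ τ) θ (Q v) θ⁻¹ (3ℚ ^ ℓ * 3ℚ ^ ℓ) ((K * K) * (D * Δ)) ⟩
      (∣cube∣ τ * moment) * Q v ∎
      where
      cube-* : ∀ s a → (s * a) * ((s * a) * (s * a)) ≡ (s * (s * s)) * (a * (a * a))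
      cube-* = solve-∀ ℚ-ring
      eq : ∀ c θ q i t d → c * (θ * q + i * (t * (d * q))) ≡ (c * (θ + i * (t * d))) * q
      eq = solve-∀ ℚ-ring

    ∑-free : ∀ v → ∑ F (λ p → ι (lookup (SB p) v)) ≤ℚ K * Δ
    ∑-free v = begin
      ∑ F (λ p → ι (lookup (SB p) v))
        ≤⟨ ∑-mono F (λ {p} p∈ → inside p p∈) ⟩
      ∑ F (λ p → ι (isFree (lookup R v)) * mem v (proj₁ p))
        ≡⟨ trans (∑-flags-edge k es unif (λ e → ι (isFree (lookup R v)) * mem v e)) (cong (K *_) (∑-*ˡ (ι (isFree (lookup R v))) es (mem v))) ⟩
      K * (ι (isFree (lookup R v)) * deg es v)
        ≤⟨ *-monoˡ K≥0 (ι*≤ (isFree (lookup R v)) Δ≥0 free-deg) ⟩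
      K * Δ ∎
      where
      free-deg : isFree (lookup R v) ≡ true → deg es v ≤ℚ Δ
      free-deg t with lookup R v in r
      ... | free = deg≤Δ v r
      inside : ∀ p → p ∈ F → ι (lookup (SB p) v) ≤ℚ ι (isFree (lookup R v)) * mem v (proj₁ p)
      inside p p∈ with lookup (SB p) v in t
      ... | false = *≥0 (ι≥0 (isFree (lookup R v))) (mem≥0 v (proj₁ p))
      ... | true  = ≡⇒≤ (sym (cong₂ (λ r b → ι (isFree r) * ι b) (proj₂ (SB⇒S p v t)) (SB⇒e p∈ v t)))

    -- A free vertex pays its error once for each flag that contains it, and there are at most K Δ
    -- of these.
    ∑-third : ∑ F third ≤ℚ ((K * Δ) * (∣cube∣ τ * moment)) * SQ
    ∑-third = begin
      ∑ F third
        ≡⟨ trans (∑-swap F V (λ p v → ι (lookup (SB p) v) * err v)) (∑-cong V (λ {v} _ → ∑-*ʳ (err v) F (λ p → ι (lookup (SB p) v)))) ⟩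
      ∑ V (λ v → ∑ F (λ p → ι (lookup (SB p) v)) * err v)
        ≤⟨ ∑-mono V (λ {v} _ → *-mono (err≥0 v) (*≥0 K≥0 Δ≥0) (∑-free v) (err≤ v)) ⟩
      ∑ V (λ v → (K * Δ) * ((∣cube∣ τ * moment) * Q v))
        ≡⟨ trans (∑-cong V (λ {v} _ → sym (ℚ.*-assoc (K * Δ) (∣cube∣ τ * moment) (Q v)))) (∑-*ˡ ((K * Δ) * (∣cube∣ τ * moment)) V Q) ⟩
      ((K * Δ) * (∣cube∣ τ * moment)) * SQ ∎

    chaos-lemma : ∃[ t ] ((∀ i → ∣ t i ∣ ≤ℚ 1ℚ) ×
      (γ (suc ℓ) * τ) * SQ - (Γ * ((τ * τ) * count) + Γ * (3ℚ * (((K * Δ) * (∣cube∣ τ * moment)) * SQ))) ≤ℚ excessForm γ es t)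
    chaos-lemma with first-moment γ es weights (λ e S → lower (e , S)) (λ {e} _ {S} _ → term≥lower (e , S))
    ... | x , q = weights x , ∣weights∣≤1 x , (begin
      (γ (suc ℓ) * τ) * SQ - (Γ * ((τ * τ) * count) + Γ * (3ℚ * (((K * Δ) * (∣cube∣ τ * moment)) * SQ)))
        ≤⟨ ℚ.+-mono-≤ (≡⇒≤ (cong ((γ (suc ℓ) * τ) *_) (sym ∑-first))) (neg-anti (ℚ.+-mono-≤ (*-monoˡ Γ≥0 (*-monoˡ (sq≥0 τ) ∑-second))
             (*-monoˡ Γ≥0 (*-monoˡ (ℚ.nonNegative⁻¹ 3ℚ) ∑-third)))) ⟩
      (γ (suc ℓ) * τ) * ∑ F first - (Γ * ((τ * τ) * ∑ F second) + Γ * (3ℚ * ∑ F third))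
        ≡⟨ eq (γ (suc ℓ) * τ) (∑ F first) Γ (τ * τ) (∑ F second) (∑ F third) ⟩
      (γ (suc ℓ) * τ) * ∑ F first + ((- (Γ * (τ * τ))) * ∑ F second + (- (Γ * 3ℚ)) * ∑ F third)
        ≡⟨ sym (trans (∑-+ F (λ p → (γ (suc ℓ) * τ) * first p) (λ p → (- (Γ * (τ * τ))) * second p + (- (Γ * 3ℚ)) * third p))
             (cong₂ _+_ (∑-*ˡ (γ (suc ℓ) * τ) F first) (trans (∑-+ F (λ p → (- (Γ * (τ * τ))) * second p) (λ p → (- (Γ * 3ℚ)) * third p))
               (cong₂ _+_ (∑-*ˡ (- (Γ * (τ * τ))) F second) (∑-*ˡ (- (Γ * 3ℚ)) F third))))) ⟩
      ∑ F (λ p → (γ (suc ℓ) * τ) * first p + ((- (Γ * (τ * τ))) * second p + (- (Γ * 3ℚ)) * third p))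
        ≡⟨ ∑-cong F (λ {p} _ → cong ((γ (suc ℓ) * τ) * first p +_) (eq′ Γ (τ * τ) (second p) (third p))) ⟩
      ∑ F lower
        ≡⟨ ∑-flags es lower ⟩
      ∑ es (λ e → ∑ (subs e) (λ S → lower (e , S)))
        ≤⟨ q ⟩
      excessForm γ es (weights x) ∎)
      where
      eq : ∀ g f Γ t s u → g * f - (Γ * (t * s) + Γ * (3ℚ * u)) ≡ g * f + ((- (Γ * t)) * s + (- (Γ * 3ℚ)) * u)
      eq = solve-∀ ℚ-ring
      eq′ : ∀ Γ t s u → (- (Γ * t)) * s + (- (Γ * 3ℚ)) * u ≡ - (Γ * (t * s)) + - (Γ * (3ℚ * u))
      eq′ = solve-∀ ℚ-ring

  good : Vec Bool n → Bool
  good e = alive R e ∧ (card (freePart R e) ℕ.≡ᵇ 1)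

  -- A good edge has one free vertex and no dead one, so its k - 1 ≥ ℓ signed vertices suffice for a
  -- typed subset.
  good≤SQ : suc ℓ ≤ k → ∑ es (λ e → ι (good e)) ≤ℚ SQ
  good≤SQ ℓ<k = ℚ.≤-trans (∑-mono es per-edge) (ℚ.≤-trans (≡⇒≤ (sym (∑-flags es (λ p → ι (typed p))))) typed≤∑Q)
    where
    per-edge : ∀ {e} → e ∈ es → ι (good e) ≤ℚ ∑ (subs e) (λ S → ι (typed (e , S)))
    per-edge {e} e∈ with good e in t
    ... | false = ∑≥0 (subs e) (λ S → ι≥0 (typed (e , S)))
    ... | true with ∧-true (alive R e) t
    ...   | al , b with ∃-subset R e ℓ 1 (ℕ.s≤s⁻¹ (subst (suc ℓ ≤_) size ℓ<k)) (ℕ.≤-reflexive (sym one))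
      where
      one : card (freePart R e) ≡ 1
      one = ≡ᵇ-true (card (freePart R e)) 1 b
      size : k ≡ suc (card (signedPart R e))
      size = trans (sym (All.lookup unif e∈)) (trans (card-roles R e al) (trans (cong (card (signedPart R e) ℕ.+_) one) (ℕ.+-comm (card (signedPart R e)) 1)))
    ...     | S , S∈ , i , j , al′ = ℚ.≤-trans (≡⇒≤ (sym (cong ι (cards⇒typed (e , S) al′ j i))))
              (∈⇒≤∑ (λ S → ι (typed (e , S))) (λ S → ι≥0 (typed (e , S))) S∈)

-- Random subsets, heavy matchings and covers

_∩_ : ∀ {n} → Vec Bool n → Vec Bool n → Vec Bool n
_∩_ = Vec.zipWith _∧_

nonempty : ∀ {n} → Vec Bool n → Bool
nonempty T = not (card T ℕ.≡ᵇ 0)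

miss-prob : ∀ {n} (T : Vec Bool n) → 𝔼 (λ B → ι (card (T ∩ B) ℕ.≡ᵇ 0)) ≡ ½ ^ card T
miss-prob []          = 𝔼-[] _
miss-prob (false ∷ T) = trans (𝔼-∷ (λ B → ι (card ((false ∷ T) ∩ B) ℕ.≡ᵇ 0))) (trans (½-double _) (miss-prob T))
miss-prob {suc n} (true ∷ T) = trans (𝔼-∷ (λ B → ι (card ((true ∷ T) ∩ B) ℕ.≡ᵇ 0)))
  (cong (½ *_) (trans (cong₂ _+_ (𝔼-const {n} 0ℚ) (miss-prob T)) (ℚ.+-identityˡ (½ ^ card T))))

-- The single outcome in which the first element of T is chosen and the others are not already has
-- this probability.
single-prob : ∀ {n} (T : Vec Bool n) {c} → card T ≡ suc c → ½ ^ card T ≤ℚ 𝔼 (λ B → ι (card (T ∩ B) ℕ.≡ᵇ 1))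
single-prob (false ∷ T) e = ℚ.≤-trans (single-prob T e) (≡⇒≤ (sym (trans (𝔼-∷ (λ B → ι (card ((false ∷ T) ∩ B) ℕ.≡ᵇ 1))) (½-double _))))
single-prob {suc n} (true ∷ T) e = ℚ.≤-trans (*-monoˡ 0≤½ (ℚ.≤-trans (≡⇒≤ (sym (miss-prob T)))
    (≤+ˡ (𝔼 (λ B → ι (card (T ∩ B) ℕ.≡ᵇ 0))) (𝔼≥0 (λ B → ι≥0 (card (T ∩ B) ℕ.≡ᵇ 1))))))
  (≡⇒≤ (sym (𝔼-∷ (λ B → ι (card ((true ∷ T) ∩ B) ℕ.≡ᵇ 1)))))

½^-anti : ∀ {m n} → m ≤ n → ½ ^ n ≤ℚ ½ ^ m
½^-anti {n = n} z≤n = ^≤1 0≤½ (≤-diff {½} {1ℚ} (ℚ.nonNegative⁻¹ ½)) n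
½^-anti (s≤s p) = *-monoˡ 0≤½ (½^-anti p)

-- `T e` is the part of e from which exactly one vertex should be selected: the trace on A for
-- covers, the whole edge when it avoids A for the choice of free vertices.
random-subset : ∀ {n k} (es : List (Vec Bool n)) (T : Vec Bool n → Vec Bool n) → (∀ {e} → e ∈ es → card (T e) ≤ k) →
  ∃[ B ] ½ ^ k * ∑ es (λ e → ι (nonempty (T e))) ≤ℚ ∑ es (λ e → ι (card (T e ∩ B) ℕ.≡ᵇ 1))
random-subset {n} {k} es T small with 𝔼-max (λ B → ∑ es (λ e → ι (card (T e ∩ B) ℕ.≡ᵇ 1)))
... | B , p = B , ℚ.≤-trans (ℚ.≤-trans (≡⇒≤ (sym (∑-*ˡ (½ ^ k) es (λ e → ι (nonempty (T e))))))
      (ℚ.≤-trans (∑-mono es (λ {e} e∈ → each e∈ (card (T e)) refl)) (≡⇒≤ (sym (𝔼-∑ es (λ e B → ι (card (T e ∩ B) ℕ.≡ᵇ 1))))))) p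
  where
  each : ∀ {e} → e ∈ es → ∀ c → card (T e) ≡ c → ½ ^ k * ι (nonempty (T e)) ≤ℚ 𝔼 (λ B → ι (card (T e ∩ B) ℕ.≡ᵇ 1))
  each {e} e∈ zero    eq = ℚ.≤-trans (≡⇒≤ (trans (cong (λ c → ½ ^ k * ι (not (c ℕ.≡ᵇ 0))) eq) (ℚ.*-zeroʳ (½ ^ k))))
    (𝔼≥0 (λ B → ι≥0 (card (T e ∩ B) ℕ.≡ᵇ 1)))
  each {e} e∈ (suc c) eq = ℚ.≤-trans (≡⇒≤ (trans (cong (λ c → ½ ^ k * ι (not (c ℕ.≡ᵇ 0))) eq) (ℚ.*-identityʳ (½ ^ k))))
    (ℚ.≤-trans (½^-anti (small e∈)) (single-prob (T e) eq))

opaque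
  -- The witness is ε / (ε + X). In each of the three cases the losses carry at least one more
  -- factor of it than the gain.
  small-factor : ∀ {ε X} → 0ℚ < ε → 0ℚ ≤ℚ X → ∃[ q ] (0ℚ < q × q ≤ℚ 1ℚ × X * q ≤ℚ ε)
  small-factor {ε} {X} ε>0 X≥0 with recip (+>0ˡ ε>0 X≥0)
  ... | r , r>0 , e = ε * r , *>0 ε>0 r>0 ,
        subst (ε * r ≤ℚ_) e (*-monoʳ r≥0 (≤+ˡ ε X≥0)) ,
        ℚ.≤-trans (≡⇒≤ (eq X ε r)) (ℚ.≤-trans (*-monoˡ (ℚ.<⇒≤ ε>0) (subst (X * r ≤ℚ_) e (*-monoʳ r≥0 (≤+ʳ X (ℚ.<⇒≤ ε>0))))) (≡⇒≤ (ℚ.*-identityʳ ε)))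
    where
    r≥0 : 0ℚ ≤ℚ r
    r≥0 = ℚ.<⇒≤ r>0
    eq : ∀ X ε r → X * (ε * r) ≡ ε * (X * r)
    eq = solve-∀ ℚ-ring

-- A matching of j heavy pairs as an involution; `support` holds its moved points as a set, so that
-- they can be counted.
record HeavyMatching {n} (weight : Fin n → Fin n → ℚ) (D : ℚ) (j : ℕ) : Set where
  field
    π       : Fin n → Fin n
    inv     : ∀ w → π (π w) ≡ w
    support : Vec Bool n
    moves   : ∀ w → lookup support w ≡ not ⌊ π w Fin.≟ w ⌋
    size    : card support ≡ j ℕ.+ j
    heavy   : ∀ w → π w ≢ w → D ≤ℚ weight w (π w)

module _ {n} {weight : Fin n → Fin n → ℚ} (weight-sym : ∀ i j → weight i j ≡ weight j i) {D : ℚ} where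

  extend : ∀ {j} (M : HeavyMatching weight D j) → let open HeavyMatching M in
    ∀ u v → u ≢ v → π u ≡ u → π v ≡ v → D ≤ℚ weight u v → HeavyMatching weight D (suc j)
  extend {j} M u v u≢v πu πv h = record
    { π = π′ ; inv = inv′ ; support = flip u (flip v support) ; moves = moves′ ; size = size′ ; heavy = heavy′ }
    where
    open HeavyMatching M
    π′ : Fin n → Fin n
    π′ w = if ⌊ w Fin.≟ u ⌋ then v else if ⌊ w Fin.≟ v ⌋ then u else π w
    π′u : π′ u ≡ v
    π′u with u Fin.≟ u
    ... | yes _ = refl
    ... | no ne = ⊥-elim (ne refl)
    π′v : π′ v ≡ u
    π′v with v Fin.≟ u | v Fin.≟ v
    ... | yes e | _     = ⊥-elim (u≢v (sym e))
    ... | no _  | yes _ = refl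
    ... | no _  | no ne = ⊥-elim (ne refl)
    π′w : ∀ {w} → w ≢ u → w ≢ v → π′ w ≡ π w
    π′w {w} a b with w Fin.≟ u | w Fin.≟ v
    ... | yes e | _     = ⊥-elim (a e)
    ... | no _  | yes e = ⊥-elim (b e)
    ... | no _  | no _  = refl
    off : ∀ {w x} → π x ≡ x → w ≢ x → π w ≢ x
    off {w} {x} e ne p = ne (trans (sym (inv w)) (trans (cong π p) e))
    inv′ : ∀ w → π′ (π′ w) ≡ w
    inv′ w with w Fin.≟ u | w Fin.≟ v
    ... | yes refl | _        = π′v
    ... | no _     | yes refl = π′u
    ... | no a     | no b     = trans (π′w (off πu a) (off πv b)) (inv w)
    unmoved : ∀ {x} → π x ≡ x → lookup support x ≡ false
    unmoved {x} e with moves x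
    ... | p with π x Fin.≟ x
    ...   | yes _ = p
    ...   | no ne = ⊥-elim (ne e)
    v∉ : lookup support v ≡ false
    v∉ = unmoved πv
    u∉ : lookup (flip v support) u ≡ false
    u∉ = trans (lookup-flip-≢ v u support (u≢v ∘ sym)) (unmoved πu)
    size′ : card (flip u (flip v support)) ≡ suc j ℕ.+ suc j
    size′ = trans (card-flip-add u (flip v support) u∉) (cong suc (trans (card-flip-add v support v∉) (trans (cong suc size) (sym (ℕ.+-suc j j)))))
    moves′ : ∀ w → lookup (flip u (flip v support)) w ≡ not ⌊ π′ w Fin.≟ w ⌋
    moves′ w = go (w Fin.≟ u) (w Fin.≟ v)
      where
      go : Dec (w ≡ u) → Dec (w ≡ v) → lookup (flip u (flip v support)) w ≡ not ⌊ π′ w Fin.≟ w ⌋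
      go (yes refl) _ = trans (trans (lookup-flip-≡ u (flip v support)) (cong not u∉)) (sym (not≟ (λ e → u≢v (trans (sym e) π′u))))
      go (no a) (yes refl) = trans (trans (lookup-flip-≢ u v (flip v support) u≢v) (trans (lookup-flip-≡ v support) (cong not v∉)))
        (sym (not≟ (λ e → u≢v (trans (sym π′v) e))))
      go (no a) (no b) = trans (trans (lookup-flip-≢ u w (flip v support) (a ∘ sym)) (lookup-flip-≢ v w support (b ∘ sym)))
        (trans (moves w) (cong (λ z → not ⌊ z Fin.≟ w ⌋) (sym (π′w a b))))
    heavy′ : ∀ w → π′ w ≢ w → D ≤ℚ weight w (π′ w)
    heavy′ w ne = go (w Fin.≟ u) (w Fin.≟ v)
      where
      go : Dec (w ≡ u) → Dec (w ≡ v) → D ≤ℚ weight w (π′ w)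
      go (yes refl) _          = subst (λ z → D ≤ℚ weight u z) (sym π′u) h
      go (no _)     (yes refl) = subst (D ≤ℚ_) (trans (weight-sym u v) (cong (weight v) (sym π′v))) h
      go (no a)     (no b)     = subst (λ z → D ≤ℚ weight w z) (sym (π′w a b)) (heavy w (λ e → ne (trans (π′w a b) e)))

  -- Greedy extension: when no heavy pair of unmatched vertices remains, the matched vertices meet
  -- all heavy pairs.
  matching-or-cover : ∀ j → HeavyMatching weight D j ⊎
    (∃[ A ] (card A ≤ j ℕ.+ j × (∀ u v → u ≢ v → lookup A u ≡ false → lookup A v ≡ false → weight u v ≤ℚ D)))
  matching-or-cover zero = inj₁ record { π = id ; inv = λ _ → refl ; support = Vec.replicate n false
    ; moves = λ w → trans (lookup-∅ w) (sym (fixed w)) ; size = card-∅ n ; heavy = λ w ne → ⊥-elim (ne refl) }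
    where
    fixed : ∀ (w : Fin n) → not ⌊ w Fin.≟ w ⌋ ≡ false
    fixed w with w Fin.≟ w
    ... | yes _ = refl
    ... | no ne = ⊥-elim (ne refl)
  matching-or-cover (suc j) with matching-or-cover j
  ... | inj₂ (A , s , c) = inj₂ (A , ℕ.≤-trans s (ℕ.+-mono-≤ (ℕ.n≤1+n j) (ℕ.n≤1+n j)) , c)
  ... | inj₁ M with Fin.any? (λ u → Fin.any? (λ v → ¬? (u Fin.≟ v) ×-dec ((HeavyMatching.π M u Fin.≟ u) ×-dec ((HeavyMatching.π M v Fin.≟ v) ×-dec (D ℚ.≤? weight u v)))))
  ...   | yes (u , v , ne , πu , πv , h) = inj₁ (extend M u v ne πu πv h)
  ...   | no none = inj₂ (support , ℕ.≤-trans (ℕ.≤-reflexive size) (ℕ.+-mono-≤ (ℕ.n≤1+n j) (ℕ.n≤1+n j)) , light)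
    where
    open HeavyMatching M
    fixed : ∀ u → lookup support u ≡ false → π u ≡ u
    fixed u e with moves u
    ... | p with π u Fin.≟ u
    ...   | yes q = q
    ...   | no _ with trans (sym e) p
    ...     | ()
    light : ∀ u v → u ≢ v → lookup support u ≡ false → lookup support v ≡ false → weight u v ≤ℚ D
    light u v ne a b = ℚ.<⇒≤ (ℚ.≰⇒> (λ h → none (u , v , ne , fixed u a , fixed v b , h)))

signedPart-∩ : ∀ {n} (A B e : Vec Bool n) → signedPart (coverRoles (A ∩ B)) e ≡ signedPart (coverRoles A) e ∩ B
signedPart-∩ []      []      []      = refl
signedPart-∩ (a ∷ A) (b ∷ B) (s ∷ e) = cong₂ _∷_ (head a b s) (signedPart-∩ A B e)
  where
  head : ∀ a b s → (s ∧ isSigned (if a ∧ b then signed else free)) ≡ ((s ∧ isSigned (if a then signed else free)) ∧ b)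
  head true  true  true  = refl
  head true  true  false = refl
  head true  false true  = refl
  head true  false false = refl
  head false b     true  = refl
  head false b     false = refl

card-∩ : ∀ {n} (A B : Vec Bool n) → card (A ∩ B) ≤ card A
card-∩ []          []          = z≤n
card-∩ (true ∷ A)  (true ∷ B)  = s≤s (card-∩ A B)
card-∩ (true ∷ A)  (false ∷ B) = ℕ.m≤n⇒m≤1+n (card-∩ A B)
card-∩ (false ∷ A) (b ∷ B)     = card-∩ A B

_∪_ : ∀ {n} → Vec Bool n → Vec Bool n → Vec Bool n
_∪_ = Vec.zipWith _∨_

card-∪ : ∀ {n} (A B : Vec Bool n) → card (A ∪ B) ≤ card A ℕ.+ card B
card-∪ []          []          = z≤n
card-∪ (true ∷ A)  (true ∷ B)  = s≤s (ℕ.≤-trans (card-∪ A B) (ℕ.+-monoʳ-≤ (card A) (ℕ.n≤1+n (card B))))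
card-∪ (true ∷ A)  (false ∷ B) = s≤s (card-∪ A B)
card-∪ (false ∷ A) (true ∷ B)  = ℕ.≤-trans (s≤s (card-∪ A B)) (ℕ.≤-reflexive (sym (ℕ.+-suc (card A) (card B))))
card-∪ (false ∷ A) (false ∷ B) = card-∪ A B

∪-false : ∀ {n} (A B : Vec Bool n) i → lookup (A ∪ B) i ≡ false → lookup A i ≡ false × lookup B i ≡ false
∪-false (false ∷ A) (false ∷ B) zero    p = refl , refl
∪-false (a ∷ A)     (b ∷ B)     (suc i) p = ∪-false A B i p

avoidRoles : ∀ {n} → Vec Bool n → Vec Bool n → Vec Role n
avoidRoles = Vec.zipWith (λ a b → if a then dead else (if b then free else signed))

avoidRoles-live : ∀ {n} (A B : Vec Bool n) i → lookup (avoidRoles A B) i ≢ dead → lookup A i ≡ false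
avoidRoles-live (true ∷ A)  (b ∷ B) zero    p = ⊥-elim (p refl)
avoidRoles-live (false ∷ A) (b ∷ B) zero    p = refl
avoidRoles-live (a ∷ A)     (b ∷ B) (suc i) p = avoidRoles-live A B i p

touches : ∀ {n} → Vec Bool n → Vec Bool n → Bool
touches A e = nonempty (signedPart (coverRoles A) e)

untouched : ∀ {n} (A B e : Vec Bool n) → card (signedPart (coverRoles A) e) ≡ 0 →
  alive (avoidRoles A B) e ≡ true × freePart (avoidRoles A B) e ≡ e ∩ B
untouched []          []          []          p = refl , refl
untouched (true ∷ A)  (b ∷ B)     (false ∷ e) p = proj₁ (untouched A B e p) , cong (false ∷_) (proj₂ (untouched A B e p))
untouched (false ∷ A) (b ∷ B)     (false ∷ e) p = proj₁ (untouched A B e p) , cong (false ∷_) (proj₂ (untouched A B e p))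
untouched (false ∷ A) (true ∷ B)  (true ∷ e)  p = proj₁ (untouched A B e p) , cong (true ∷_) (proj₂ (untouched A B e p))
untouched (false ∷ A) (false ∷ B) (true ∷ e)  p = proj₁ (untouched A B e p) , cong (false ∷_) (proj₂ (untouched A B e p))

-- Edges that meet A are replaced by the empty set, so that `random-subset` only looks at the
-- others.
avoiding : ∀ {n} → Vec Bool n → Vec Bool n → Vec Bool n
avoiding {n} A e = if touches A e then Vec.replicate n false else e

avoiding≤ : ∀ {n k} (A e : Vec Bool n) → card e ≡ k → card (avoiding A e) ≤ k
avoiding≤ {n} A e p with touches A e
... | true  = ℕ.≤-trans (ℕ.≤-reflexive (card-∅ n)) z≤n
... | false = ℕ.≤-reflexive p

free≢dead : free ≢ dead
free≢dead ()

card-signedPart : ∀ {n} (R : Vec Role n) e → card (signedPart R e) ≤ card e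
card-signedPart R e = ⊆-card (signedPart R e) e (λ i t → proj₁ (∧-true (lookup e i) (trans (sym (lookup-signedPart R e i)) t)))

-- The three sources of excess and their combination

⅛ : ℚ
⅛ = ½ * (½ * ½)

opaque
  ⅓ : ℚ
  ⅓ = proj₁ (recip {3ℚ} (ℚ.positive⁻¹ 3ℚ))

  ⅓>0 : 0ℚ < ⅓
  ⅓>0 = proj₁ (proj₂ (recip {3ℚ} (ℚ.positive⁻¹ 3ℚ)))

  3*⅓ : 3ℚ * ⅓ ≡ 1ℚ
  3*⅓ = proj₂ (proj₂ (recip {3ℚ} (ℚ.positive⁻¹ 3ℚ)))

-- `ninth` is by definition `fourth` times `fifth`, the factorisation that turns m / p⁴ into p⁵.
fourth fifth ninth : ℚ → ℚ
fourth p = (p * p) * (p * p)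
fifth p  = p * fourth p
ninth p  = fourth p * fifth p

module Assembly (C : Coefficients) (k : ℕ) (ℓ<k : suc (Coefficients.ℓ C) ≤ k) where

  open Coefficients C

  2≤k : 2 ≤ k
  2≤k = ℕ.≤-trans 2≤ℓ (ℕ.≤-trans (ℕ.n≤1+n ℓ) ℓ<k)

  K : ℚ
  K = 2ℚ ^ k

  K≥0 : 0ℚ ≤ℚ K
  K≥0 = ^≥0 (ℚ.nonNegative⁻¹ 2ℚ) k

  ½K : ½ ^ k * K ≡ 1ℚ
  ½K = trans (sym (^-*-distrib ½ 2ℚ k)) (1^ k)

  h : ℚ
  h = ½ ^ k

  h>0 : 0ℚ < h
  h>0 = ^>0 (ℚ.positive⁻¹ ½) k

  ΓK≥0 : 0ℚ ≤ℚ Γ * K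
  ΓK≥0 = *≥0 Γ≥0 K≥0

  Large : ∀ {n} → List (Vec Bool n) → ℚ → Set
  Large {n} es z = ∃[ t ] ((∀ (i : Fin n) → ∣ t i ∣ ≤ℚ 1ℚ) × z ≤ℚ excessForm γ es t)

  weaken : ∀ {n} {es : List (Vec Bool n)} {z z′} → z ≤ℚ z′ → Large es z′ → Large es z
  weaken q (t , b , p) = t , b , ℚ.≤-trans q p

  codeg-sym : ∀ {n} (es : List (Vec Bool n)) i j → codeg es i j ≡ codeg es j i
  codeg-sym es i j = ∑-cong es (λ {e} _ → ℚ.*-comm (mem i e) (mem j e))

  MatchingBound : ℚ → Set
  MatchingBound c = ∀ {n} (es : List (Vec Bool n)) → All (λ e → card e ≡ k) es →
    ∀ {D j} → 0ℚ ≤ℚ D → HeavyMatching (codeg es) D j → Large es (c * (⟦ j ⟧ * D))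

  from-matching : ∃[ c ] (0ℚ < c × MatchingBound c)
  -- The net factor is q² (-γ₂ / 4 - Γ K q); this q keeps half of the gain.
  from-matching with small-factor {ε = - γ 2 * ⅛} {X = Γ * K} (*>0 -γ₂>0 (ℚ.positive⁻¹ ⅛)) ΓK≥0
  ... | q , q>0 , q≤1 , Xq≤ε = (q * q) * (- γ 2 * ⅛) , *>0 (*>0 q>0 q>0) (*>0 -γ₂>0 (ℚ.positive⁻¹ ⅛)) , result
    where
    result : MatchingBound ((q * q) * (- γ 2 * ⅛))
    result {n} es unif {D} {j} D≥0 M = weaken bound (matching-lemma k es unif)
      where
      open HeavyMatching M
      open Matched C π inv (ℚ.<⇒≤ q>0) q≤1
      open ℚ.≤-Reasoning
      Y = ∑ (allFin n) (λ w → moved w * codeg es w (π w))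
      heavy-term : ∀ w → ι (lookup support w) * D ≤ℚ moved w * codeg es w (π w)
      heavy-term w with moves w
      ... | e with π w Fin.≟ w
      ...   | yes _ = ≡⇒≤ (trans (cong (λ b → ι b * D) e) (trans (ℚ.*-zeroˡ D) (sym (ℚ.*-zeroˡ (codeg es w (π w))))))
      ...   | no ne = ℚ.≤-trans (≡⇒≤ (cong (λ b → ι b * D) e)) (*-monoˡ 0≤1 (heavy w ne))
      Y≥ : ⟦ j ⟧ * D ≤ℚ Y
      Y≥ = begin
        ⟦ j ⟧ * D                                            ≤⟨ *-monoʳ D≥0 (⟦⟧-mono (ℕ.≤-trans (ℕ.m≤m+n j j) (ℕ.≤-reflexive (sym size)))) ⟩
        ⟦ card support ⟧ * D                                 ≡⟨ cong (_* D) (sym (∑-ι-lookup support)) ⟩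
        ∑ (allFin n) (λ w → ι (lookup support w)) * D        ≡⟨ sym (∑-*ʳ D (allFin n) (λ w → ι (lookup support w))) ⟩
        ∑ (allFin n) (λ w → ι (lookup support w) * D)        ≤⟨ ∑-mono (allFin n) (λ {w} _ → heavy-term w) ⟩
        Y                                                    ∎
      coefficient : (q * q) * (- γ 2 * ⅛) ≤ℚ gain - loss * K
      coefficient = ≤-diff (subst (0ℚ ≤ℚ_) (eq q (γ 2) Γ K) (*≥0 (sq≥0 q) (diff-≥0 Xq≤ε)))
        where
        eq : ∀ q g G K → (q * q) * (- g * ⅛ - (G * K) * q) ≡ (- g * (½ * (½ * (q * q))) - (G * (q * (q * q))) * K) - (q * q) * (- g * ⅛)
        eq = solve-∀ ℚ-ring
      bound : ((q * q) * (- γ 2 * ⅛)) * (⟦ j ⟧ * D) ≤ℚ (gain - loss * K) * Y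
      bound = *-mono (*≥0 (⟦⟧≥0 j) D≥0) (ℚ.≤-trans (*≥0 (sq≥0 q) (*≥0 (ℚ.<⇒≤ -γ₂>0) (ℚ.nonNegative⁻¹ ⅛))) coefficient) coefficient Y≥

  CoverBound : ℚ → Set
  CoverBound c = ∀ {n} (es : List (Vec Bool n)) → All (λ e → card e ≡ k) es →
    ∀ {p} → 0ℚ < p → ninth p ≤ℚ ⟦ length es ⟧ → ∀ A → ⟦ card A ⟧ ≤ℚ 3ℚ * fourth p →
    ½ * ⟦ length es ⟧ ≤ℚ ∑ es (λ e → ι (touches A e)) → Large es (c * fifth p)

  from-cover : ∃[ c ] (0ℚ < c × CoverBound c)
  -- A fraction h / 2 of the edges has exactly one signed vertex, so the gain is -γ₂ q h m / 2
  -- before the factor a⁻¹; ε is half of that rate.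
  from-cover with small-factor {ε = - γ 2 * (h * (½ * ½))} {X = Γ * K} (*>0 -γ₂>0 (*>0 h>0 (ℚ.positive⁻¹ (½ * ½)))) ΓK≥0
  ... | q , q>0 , q≤1 , Xq≤ε = ⅓ * (q * ε) , *>0 ⅓>0 (*>0 q>0 ε>0) , result
    where
    ε = - γ 2 * (h * (½ * ½))
    ε>0 : 0ℚ < ε
    ε>0 = *>0 -γ₂>0 (*>0 h>0 (ℚ.positive⁻¹ (½ * ½)))
    result : CoverBound (⅓ * (q * ε))
    -- An edge may meet A in many vertices, so A is thinned to `A ∩ B`, which meets a fraction h of
    -- the touched edges exactly once.
    result {n} es unif {p} p>0 m≥ A A≤ touched with recip (*>0 (*>0 p>0 p>0) (*>0 p>0 p>0))
      | random-subset {k = k} es (signedPart (coverRoles A)) (λ {e} e∈ → ℕ.≤-trans (card-signedPart (coverRoles A) e) (ℕ.≤-reflexive (All.lookup unif e∈)))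
    ... | w , w>0 , pw | B , many = weaken bound (cover-lemma k es 2≤k unif)
      where
      open ℚ.≤-Reasoning
      m = ⟦ length es ⟧
      a⁻¹ = ⅓ * w
      a⁻¹≥0 : 0ℚ ≤ℚ a⁻¹
      a⁻¹≥0 = *≥0 (ℚ.<⇒≤ ⅓>0) (ℚ.<⇒≤ w>0)
      small : a⁻¹ * ⟦ card (A ∩ B) ⟧ ≤ℚ 1ℚ
      small = ℚ.≤-trans (*-monoˡ a⁻¹≥0 (ℚ.≤-trans (⟦⟧-mono (card-∩ A B)) A≤))
        (≡⇒≤ (trans (eq ⅓ w (fourth p)) (trans (cong₂ _*_ 3*⅓ pw) (ℚ.*-identityˡ 1ℚ))))
        where
        eq : ∀ t w f → (t * w) * (3ℚ * f) ≡ (3ℚ * t) * (f * w)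
        eq = solve-∀ ℚ-ring
      open Cover C (A ∩ B) (ℚ.<⇒≤ q>0) q≤1 a⁻¹≥0 small
      N = ∑ es one-signed
      N≥ : h * (½ * m) ≤ℚ N
      N≥ = ℚ.≤-trans (*-monoˡ (ℚ.<⇒≤ h>0) touched) (ℚ.≤-trans many
        (≡⇒≤ (∑-cong es (λ {e} _ → cong (λ T → ι (card T ℕ.≡ᵇ 1)) (sym (signedPart-∩ A B e))))))
      bound : (⅓ * (q * ε)) * fifth p ≤ℚ a⁻¹ * ((- γ 2 * q) * N - (Γ * (q * q)) * (K * m))
      bound = begin
        (⅓ * (q * ε)) * fifth p
          ≡⟨ sym (trans (eq₁ ⅓ w (q * ε) (fourth p) (fifth p)) (trans (cong ((⅓ * (q * ε)) *_) (trans (cong (_* fifth p) pw) (ℚ.*-identityˡ (fifth p)))) refl)) ⟩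
        a⁻¹ * ((q * ε) * ninth p)
          ≤⟨ *-monoˡ a⁻¹≥0 (*-monoˡ (*≥0 (ℚ.<⇒≤ q>0) (ℚ.<⇒≤ ε>0)) m≥) ⟩
        a⁻¹ * ((q * ε) * m)
          ≤⟨ *-monoˡ a⁻¹≥0 (≤-diff (subst (0ℚ ≤ℚ_) (eq₂ q (γ 2) h m Γ K) (*≥0 (*≥0 (ℚ.<⇒≤ q>0) (⟦⟧≥0 (length es))) (diff-≥0 Xq≤ε)))) ⟩
        a⁻¹ * ((- γ 2 * q) * (h * (½ * m)) - (Γ * (q * q)) * (K * m))
          ≤⟨ *-monoˡ a⁻¹≥0 (ℚ.+-monoˡ-≤ (- ((Γ * (q * q)) * (K * m))) (*-monoˡ (*≥0 (ℚ.<⇒≤ -γ₂>0) (ℚ.<⇒≤ q>0)) N≥)) ⟩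
        a⁻¹ * ((- γ 2 * q) * N - (Γ * (q * q)) * (K * m)) ∎
        where
        eq₁ : ∀ t w c f g → (t * w) * (c * (f * g)) ≡ (t * c) * ((f * w) * g)
        eq₁ = solve-∀ ℚ-ring
        eq₂ : ∀ q g h m G K → (q * m) * (- g * (h * (½ * ½)) - (G * K) * q) ≡
          ((- g * q) * (h * (½ * m)) - (G * (q * q)) * (K * m)) - (q * (- g * (h * (½ * ½)))) * m
        eq₂ = solve-∀ ℚ-ring

  κ : ℚ
  κ = ⟦ k ⟧

  ChaosBound : ℚ → ℚ → Set
  ChaosBound β c = ∀ {n} (es : List (Vec Bool n)) → All (λ e → card e ≡ k) es →
    ∀ {p} → 1ℚ ≤ℚ p → ninth p ≤ℚ ⟦ length es ⟧ → ∀ A →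
    (∀ i j → i ≢ j → lookup A i ≡ false → lookup A j ≡ false → codeg es i j ≤ℚ p) →
    (∀ i → lookup A i ≡ false → deg es i ≤ℚ β * fifth p) →
    ½ * ⟦ length es ⟧ ≤ℚ ∑ es (λ e → ι (not (touches A e))) → Large es (c * fifth p)

  module ChaosCase {β : ℚ} (β≥0 : 0ℚ ≤ℚ β) where

    G = ∣ γ (suc ℓ) ∣
    G>0 : 0ℚ < G
    G>0 = ℚ.≰⇒> (λ q → γtop≢0 (ℚ.∣p∣≡0⇒p≡0 (γ (suc ℓ)) (ℚ.≤-antisym q (ℚ.0≤∣p∣ (γ (suc ℓ))))))
    N₉ = 3ℚ ^ ℓ * 3ℚ ^ ℓ
    -- Measured in units of `SQ` / p⁴, the quadratic loss is at most η² `X₂` · 2 K and the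
    -- truncation loss at most η³ `X₃`, each still to be multiplied by Γ.
    X₂ = (K * (K * K)) * (2ℚ * (κ * (κ * (κ * κ))))
    X₂≥0 : 0ℚ ≤ℚ X₂
    X₂≥0 = *≥0 (*≥0 K≥0 (*≥0 K≥0 K≥0)) (*≥0 (ℚ.nonNegative⁻¹ 2ℚ) (*≥0 (⟦⟧≥0 k) (*≥0 (⟦⟧≥0 k) (*≥0 (⟦⟧≥0 k) (⟦⟧≥0 k)))))
    X₃ = 3ℚ * ((K * β) * (1ℚ + N₉ * ((K * K) * β)))
    X₃≥0 : 0ℚ ≤ℚ X₃
    X₃≥0 = *≥0 (ℚ.nonNegative⁻¹ 3ℚ) (*≥0 (*≥0 K≥0 β≥0) (+≥0 0≤1 (*≥0 (*≥0 (3^≥0 ℓ) (3^≥0 ℓ)) (*≥0 (*≥0 K≥0 K≥0) β≥0))))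

    -- Putting the sign of the top coefficient into τ makes the first-order term positive in either
    -- case.
    σ : ∃[ s ] (γ (suc ℓ) * s ≡ G × ∣ s ∣ ≡ 1ℚ)
    σ with ℚ.∣p∣≡p∨∣p∣≡-p (γ (suc ℓ))
    ... | inj₁ e = 1ℚ , trans (ℚ.*-identityʳ (γ (suc ℓ))) (sym e) , refl
    ... | inj₂ e = - 1ℚ , trans (eq (γ (suc ℓ))) (sym e) , refl
      where
      eq : ∀ x → x * - 1ℚ ≡ - x
      eq = solve-∀ ℚ-ring

    chaos-case : ∀ {η} → 0ℚ < η → η ≤ℚ 1ℚ → (Γ * (X₂ * (2ℚ * K) + X₃)) * η ≤ℚ ½ * G → ChaosBound β ((η * (½ * G)) * (h * ½))
    chaos-case {η} η>0 η≤1 Xη≤ε {n} es unif {p} 1≤p m≥ A light low untouched-many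
      with recip (ℚ.<-≤-trans (ℚ.positive⁻¹ 1ℚ) 1≤p) | random-subset {k = k} es (avoiding A) (λ {e} e∈ → avoiding≤ A e (All.lookup unif e∈))
    -- Here θ = p³, the order of the standard deviation of a linear coefficient, since `Q≤` bounds
    -- the variance by K² · p · β p⁵.
    ... | u , u>0 , pu | B , many = weaken bound (chaos-lemma (cube≥0 p≥0) (cube≥0 u≥0) θθ⁻¹)
      where
      open ℚ.≤-Reasoning
      m = ⟦ length es ⟧
      p≥0 : 0ℚ ≤ℚ p
      p≥0 = ℚ.≤-trans 0≤1 1≤p
      u≥0 : 0ℚ ≤ℚ u
      u≥0 = ℚ.<⇒≤ u>0
      R = avoidRoles A B
      Δ = β * fifth p
      w = fourth u
      w≥0 : 0ℚ ≤ℚ w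
      w≥0 = sq≥0 (u * u)
      s = proj₁ σ
      -- With w = p⁻⁴, the product of degree, τ³ and third-moment scale is p⁵ · η³ p⁻¹² · p³ = η³
      -- p⁻⁴, against η p⁻⁴ for the gain: any larger power of p would lose.
      τ = s * (η * w)
      P5≥0 : 0ℚ ≤ℚ fifth p
      P5≥0 = *≥0 p≥0 (sq≥0 (p * p))
      open Chaos C R es k unif p≥0
        (λ i j ne a b → light i j ne (avoidRoles-live A B i a) (avoidRoles-live A B j b))
        (*≥0 β≥0 P5≥0)
        (λ v f → low v (avoidRoles-live A B v (λ d → free≢dead (trans (sym f) d)))) τ
      wP4 : w * fourth p ≡ 1ℚ
      wP4 = trans (eq p u) (cong (λ x → (x * x) * (x * x)) pu)
        where
        eq : ∀ p u → ((u * u) * (u * u)) * ((p * p) * (p * p)) ≡ ((p * u) * (p * u)) * ((p * u) * (p * u))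
        eq = solve-∀ ℚ-ring
      θθ⁻¹ : cube p * cube u ≡ 1ℚ
      θθ⁻¹ = trans (eq p u) (trans (cong (λ x → x * (x * x)) pu) refl)
        where
        eq : ∀ p u → (p * (p * p)) * (u * (u * u)) ≡ (p * u) * ((p * u) * (p * u))
        eq = solve-∀ ℚ-ring
      T : Vec Bool n → Vec Bool n
      T = avoiding A
      η≥0 = ℚ.<⇒≤ η>0
      count = (K * (K * K)) * (2ℚ * ((p * p) * (κ * (κ * (κ * (κ * m))))))
      nonempty-T : ∀ {e} → e ∈ es → ι (not (touches A e)) ≤ℚ ι (nonempty (T e))
      nonempty-T {e} e∈ with touches A e
      ... | true  = ι≥0 (nonempty (Vec.replicate n false))
      ... | false = ≡⇒≤ (sym (cong ι (positive-card 2≤k (All.lookup unif e∈))))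
        where
        positive-card : ∀ {c k} → 2 ≤ k → c ≡ k → not (c ℕ.≡ᵇ 0) ≡ true
        positive-card (s≤s q) refl = refl
      one-free : ∀ e → ι (card (T e ∩ B) ℕ.≡ᵇ 1) ≤ℚ ι (good e)
      one-free e = go (touches A e) refl
        where
        go : ∀ t → touches A e ≡ t → ι (card (T e ∩ B) ℕ.≡ᵇ 1) ≤ℚ ι (good e)
        go true  t = ℚ.≤-trans (≡⇒≤ (cong ι (trans (cong (λ b → card ((if b then Vec.replicate n false else e) ∩ B) ℕ.≡ᵇ 1) t)
                       (cong (ℕ._≡ᵇ 1) (ℕ.n≤0⇒n≡0 (ℕ.≤-trans (card-∩ (Vec.replicate n false) B) (ℕ.≤-reflexive (card-∅ n)))))))) (ι≥0 (good e))
        go false t with untouched A B e (≡ᵇ-true _ 0 (not-false t))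
          where
          not-false : ∀ {b} → not b ≡ false → b ≡ true
          not-false {true} _ = refl
        ... | al , fr = ≡⇒≤ (trans (cong (λ b → ι (card ((if b then Vec.replicate n false else e) ∩ B) ℕ.≡ᵇ 1)) t)
                          (sym (cong₂ (λ a W → ι (a ∧ (card W ℕ.≡ᵇ 1))) al fr)))
      SQ≥ : h * (½ * m) ≤ℚ SQ
      SQ≥ = ℚ.≤-trans (*-monoˡ (ℚ.<⇒≤ h>0) (ℚ.≤-trans untouched-many (∑-mono es nonempty-T)))
        (ℚ.≤-trans many (ℚ.≤-trans (∑-mono es (λ {e} _ → one-free e)) (good≤SQ ℓ<k)))
      m≤ : m ≤ℚ (2ℚ * K) * SQ
      m≤ = subst (_≤ℚ (2ℚ * K) * SQ) (trans (eq K h m) (trans (cong (_* m) ½K) (ℚ.*-identityˡ m)))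
        (*-monoˡ (*≥0 (ℚ.nonNegative⁻¹ 2ℚ) K≥0) SQ≥)
        where
        eq : ∀ K h m → (2ℚ * K) * (h * (½ * m)) ≡ (h * K) * m
        eq = solve-∀ ℚ-ring
      z = w * SQ
      z≥0 : 0ℚ ≤ℚ z
      z≥0 = *≥0 w≥0 SQ≥0
      u≤1 : u ≤ℚ 1ℚ
      u≤1 = subst₂ _≤ℚ_ (ℚ.*-identityˡ u) pu (*-monoʳ u≥0 1≤p)
      ∣τ∣ : ∣ τ ∣ ≡ η * w
      ∣τ∣ = trans (ℚ.∣p*q∣≡∣p∣*∣q∣ s (η * w)) (trans (cong₂ _*_ (proj₂ (proj₂ σ)) (ℚ.0≤p⇒∣p∣≡p (*≥0 η≥0 w≥0))) (ℚ.*-identityˡ (η * w)))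
      gain-eq : (γ (suc ℓ) * τ) * SQ ≡ (G * η) * z
      gain-eq = trans (eq (γ (suc ℓ)) s η w SQ) (cong (λ g → (g * η) * z) (proj₁ (proj₂ σ)))
        where
        eq : ∀ g s η w q → (g * (s * (η * w))) * q ≡ ((g * s) * η) * (w * q)
        eq = solve-∀ ℚ-ring
      second≤ : (τ * τ) * count ≤ℚ ((η * η) * (X₂ * (2ℚ * K))) * z
      second≤ = begin
        (τ * τ) * count
          ≡⟨ cong (_* count) (trans (sym (∣∣*∣∣ τ)) (cong₂ _*_ ∣τ∣ ∣τ∣)) ⟩
        ((η * w) * (η * w)) * count
          ≡⟨ trans (eq η w (p * p) (K * (K * K)) κ m) (cong (λ x → (((η * η) * X₂) * (w * x)) * m) (trans (eq″ p u) (trans (cong (λ x → (u * u) * (x * x)) pu) (ℚ.*-identityʳ (u * u))))) ⟩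
        (((η * η) * X₂) * (w * (u * u))) * m
          -- The spare factor p⁻² of the quadratic loss is discarded, using p ≥ 1.
          ≤⟨ *-monoʳ (⟦⟧≥0 (length es)) (*-monoˡ (*≥0 (sq≥0 η) X₂≥0) (*-monoˡ w≥0 (*-mono u≥0 0≤1 u≤1 u≤1))) ⟩
        (((η * η) * X₂) * (w * 1ℚ)) * m
          ≤⟨ *-monoˡ (*≥0 (*≥0 (sq≥0 η) X₂≥0) (*≥0 w≥0 0≤1)) m≤ ⟩
        (((η * η) * X₂) * (w * 1ℚ)) * ((2ℚ * K) * SQ)
          ≡⟨ eq′ (η * η) X₂ w K SQ ⟩
        ((η * η) * (X₂ * (2ℚ * K))) * z ∎
        where
        eq : ∀ η w s K³ κ m → ((η * w) * (η * w)) * (K³ * (2ℚ * (s * (κ * (κ * (κ * (κ * m)))))))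
          ≡ (((η * η) * (K³ * (2ℚ * (κ * (κ * (κ * κ)))))) * (w * (w * s))) * m
        eq = solve-∀ ℚ-ring
        eq″ : ∀ p u → ((u * u) * (u * u)) * (p * p) ≡ (u * u) * ((p * u) * (p * u))
        eq″ = solve-∀ ℚ-ring
        eq′ : ∀ e X w K q → ((e * X) * (w * 1ℚ)) * ((2ℚ * K) * q) ≡ (e * (X * (2ℚ * K))) * (w * q)
        eq′ = solve-∀ ℚ-ring
      moment-eq : moment (cube≥0 p≥0) (cube≥0 u≥0) θθ⁻¹ ≡ cube p * (1ℚ + N₉ * ((K * K) * β))
      moment-eq = trans (eq (cube p) (cube u) N₉ K p β (fifth p)) (trans (cong (λ x → cube p + (N₉ * ((K * K) * β)) * x)
          (trans (eq′ p u) (trans (cong (λ x → cube x * cube p) pu) (ℚ.*-identityˡ (cube p))))) (eq″ (cube p) (N₉ * ((K * K) * β))))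
        where
        eq : ∀ t i N K p β f → t + i * (N * ((K * K) * (p * (β * f)))) ≡ t + (N * ((K * K) * β)) * (i * (p * f))
        eq = solve-∀ ℚ-ring
        eq′ : ∀ p u → (u * (u * u)) * (p * (p * ((p * p) * (p * p)))) ≡ ((p * u) * ((p * u) * (p * u))) * (p * (p * p))
        eq′ = solve-∀ ℚ-ring
        eq″ : ∀ t N → t + N * t ≡ t * (1ℚ + N)
        eq″ = solve-∀ ℚ-ring
      third-eq : 3ℚ * (((K * Δ) * (∣cube∣ τ * moment (cube≥0 p≥0) (cube≥0 u≥0) θθ⁻¹)) * SQ) ≡ ((η * (η * η)) * X₃) * z
      third-eq = trans (cong₂ (λ t μ → 3ℚ * (((K * Δ) * (cube t * μ)) * SQ)) ∣τ∣ moment-eq)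
        (trans (eq K β (fifth p) η w (cube p) (1ℚ + N₉ * ((K * K) * β)) SQ)
          (trans (cong (λ x → (((η * (η * η)) * X₃) * z) * x) (trans (eq′ p w (fourth p)) (trans (cong₂ _*_ wP4 wP4) (ℚ.*-identityˡ 1ℚ)))) (ℚ.*-identityʳ (((η * (η * η)) * X₃) * z))))
        where
        eq : ∀ K β f η w t Y q → 3ℚ * (((K * (β * f)) * (((η * w) * ((η * w) * (η * w))) * (t * Y))) * q)
          ≡ (((η * (η * η)) * (3ℚ * ((K * β) * Y))) * (w * q)) * ((w * w) * (f * t))
        eq = solve-∀ ℚ-ring
        eq′ : ∀ p w f → (w * w) * ((p * f) * (p * (p * p))) ≡ (w * f) * (w * ((p * p) * (p * p)))
        eq′ = solve-∀ ℚ-ring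
      bound : ((η * (½ * G)) * (h * ½)) * fifth p ≤ℚ
        (γ (suc ℓ) * τ) * SQ - (Γ * ((τ * τ) * count) + Γ * (3ℚ * (((K * Δ) * (∣cube∣ τ * moment (cube≥0 p≥0) (cube≥0 u≥0) θθ⁻¹)) * SQ)))
      bound = begin
        ((η * (½ * G)) * (h * ½)) * fifth p
          ≡⟨ sym (trans (eq₁ (η * (½ * G)) h w (fourth p) (fifth p)) (trans (cong (λ x → ((η * (½ * G)) * (h * ½)) * (x * fifth p)) wP4)
               (cong (((η * (½ * G)) * (h * ½)) *_) (ℚ.*-identityˡ (fifth p))))) ⟩
        (η * (½ * G)) * (w * (h * (½ * ninth p)))
          ≤⟨ *-monoˡ η½G≥0 (*-monoˡ w≥0 (*-monoˡ (ℚ.<⇒≤ h>0) (*-monoˡ 0≤½ m≥))) ⟩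
        (η * (½ * G)) * (w * (h * (½ * m)))
          ≤⟨ *-monoˡ η½G≥0 (*-monoˡ w≥0 SQ≥) ⟩
        (η * (½ * G)) * z
          -- By the choice of η, half of the gain survives both losses.
          ≤⟨ ≤-diff (subst (0ℚ ≤ℚ_) (eq₂ η G z Γ (X₂ * (2ℚ * K)) X₃) (*≥0 (*≥0 η≥0 z≥0) (diff-≥0 Xη≤ε))) ⟩
        (G * η) * z - (Γ * (((η * η) * (X₂ * (2ℚ * K))) * z) + Γ * (((η * η) * X₃) * z))
          ≤⟨ ℚ.+-mono-≤ (≡⇒≤ (sym gain-eq)) (neg-anti (ℚ.+-mono-≤ (*-monoˡ Γ≥0 second≤) (*-monoˡ Γ≥0 (ℚ.≤-trans (≡⇒≤ third-eq)
               (*-monoʳ z≥0 (*-monoʳ X₃≥0 (ℚ.≤-trans (*-monoʳ (sq≥0 η) η≤1) (≡⇒≤ (ℚ.*-identityˡ (η * η)))))))))) ⟩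
        (γ (suc ℓ) * τ) * SQ - (Γ * ((τ * τ) * count) + Γ * (3ℚ * (((K * Δ) * (∣cube∣ τ * moment (cube≥0 p≥0) (cube≥0 u≥0) θθ⁻¹)) * SQ))) ∎
        where
        η½G≥0 : 0ℚ ≤ℚ η * (½ * G)
        η½G≥0 = *≥0 η≥0 (*≥0 0≤½ (ℚ.<⇒≤ G>0))
        eq₁ : ∀ c h w f g → c * (w * (h * (½ * (f * g)))) ≡ (c * (h * ½)) * ((w * f) * g)
        eq₁ = solve-∀ ℚ-ring
        eq₂ : ∀ η G z Γ a c → (η * z) * (½ * G - (Γ * (a + c)) * η) ≡ ((G * η) * z - (Γ * (((η * η) * a) * z) + Γ * (((η * η) * c) * z))) - (η * (½ * G)) * z
        eq₂ = solve-∀ ℚ-ring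

    from-chaos : ∃[ c ] (0ℚ < c × ChaosBound β c)
    from-chaos = choose (small-factor (*>0 (ℚ.positive⁻¹ ½) G>0) (*≥0 Γ≥0 (+≥0 (*≥0 X₂≥0 (*≥0 (ℚ.nonNegative⁻¹ 2ℚ) K≥0)) X₃≥0)))
      where
      choose : ∃[ η ] (0ℚ < η × η ≤ℚ 1ℚ × (Γ * (X₂ * (2ℚ * K) + X₃)) * η ≤ℚ ½ * G) → ∃[ c ] (0ℚ < c × ChaosBound β c)
      choose (η , η>0 , η≤1 , small) = (η * (½ * G)) * (h * ½) , *>0 (*>0 η>0 (*>0 (ℚ.positive⁻¹ ½) G>0)) (*>0 h>0 (ℚ.positive⁻¹ ½)) ,
        chaos-case η>0 η≤1 small

⊓>0 : ∀ {x y} → 0ℚ < x → 0ℚ < y → 0ℚ < x ℚ.⊓ y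
⊓>0 {x} {y} p q with ℚ.⊓-sel x y
... | inj₁ e = subst (0ℚ <_) (sym e) p
... | inj₂ e = subst (0ℚ <_) (sym e) q

*-cancelʳ-≤ : ∀ {x y z} → 0ℚ < z → x * z ≤ℚ y * z → x ≤ℚ y
*-cancelʳ-≤ {z = z} p = ℚ.*-cancelʳ-≤-pos z {{ℚ.positive p}}

-- Markov's inequality for the vertices at which f exceeds Δ.
card-threshold : ∀ {n} (f : Fin n → ℚ) {Δ} → 0ℚ ≤ℚ Δ → (∀ v → 0ℚ ≤ℚ f v) →
  ∃[ A ] (⟦ card A ⟧ * Δ ≤ℚ ∑ (allFin n) f × (∀ v → lookup A v ≡ false → f v ≤ℚ Δ))
card-threshold {n} f {Δ} Δ≥0 f≥0 = A , many , below
  where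
  open ℚ.≤-Reasoning
  A : Vec Bool n
  A = Vec.tabulate (λ v → ⌊ Δ ℚ.<? f v ⌋)
  lookup-A : ∀ v → lookup A v ≡ ⌊ Δ ℚ.<? f v ⌋
  lookup-A v = Vec.lookup∘tabulate (λ v → ⌊ Δ ℚ.<? f v ⌋) v
  below : ∀ v → lookup A v ≡ false → f v ≤ℚ Δ
  below v e with trans (sym e) (lookup-A v)
  ... | q with Δ ℚ.<? f v
  ...   | no ¬p = ℚ.≮⇒≥ ¬p
  term : ∀ v → ι (lookup A v) * Δ ≤ℚ f v
  term v = ι*≤ (lookup A v) (f≥0 v) above
    where
    above : lookup A v ≡ true → Δ ≤ℚ f v
    above e with trans (sym e) (lookup-A v)
    ... | q with Δ ℚ.<? f v
    ...   | yes p = ℚ.<⇒≤ p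
  many : ⟦ card A ⟧ * Δ ≤ℚ ∑ (allFin n) f
  many = begin
    ⟦ card A ⟧ * Δ                                 ≡⟨ cong (_* Δ) (sym (∑-ι-lookup A)) ⟩
    ∑ (allFin n) (λ v → ι (lookup A v)) * Δ        ≡⟨ sym (∑-*ʳ Δ (allFin n) (λ v → ι (lookup A v))) ⟩
    ∑ (allFin n) (λ v → ι (lookup A v) * Δ)        ≤⟨ ∑-mono (allFin n) (λ {v} _ → term v) ⟩
    ∑ (allFin n) f                                 ∎

module _ (C : Coefficients) (k : ℕ) (ℓ<k : suc (Coefficients.ℓ C) ≤ k) where

  open Coefficients C
  open Assembly C k ℓ<k

  -- p is the integer part of m^{1/9}, and j = p⁴.
  module Combine {b c c₁ c₂ c₃ : ℚ} (b>0 : 0ℚ < b) (c≤c₁ : c ≤ℚ c₁) (c≤c₂ : c ≤ℚ c₂) (c≤c₃ : c ≤ℚ c₃)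
    (matching : MatchingBound c₁) (cover : CoverBound c₂) (chaos : ChaosBound (⟦ k ⟧ * b) c₃)
    {n} (es : List (Vec Bool n)) (unif : All (λ e → card e ≡ k) es) {p : ℚ} (j : ℕ) (⟦j⟧ : ⟦ j ⟧ ≡ fourth p) (1≤p : 1ℚ ≤ℚ p)
    (m≥ : ninth p ≤ℚ ⟦ length es ⟧) (m≤ : ⟦ length es ⟧ ≤ℚ b * ninth p) where

    open ℚ.≤-Reasoning

    κ>0 : 0ℚ < ⟦ k ⟧
    κ>0 = ℚ.<-≤-trans (ℚ.positive⁻¹ 1ℚ) (subst (_≤ℚ ⟦ k ⟧) (ℚ.+-identityʳ 1ℚ) (⟦⟧-mono {1} {k} (ℕ.≤-trans (s≤s z≤n) 2≤k)))
    m = ⟦ length es ⟧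
    p>0 : 0ℚ < p
    p>0 = ℚ.<-≤-trans (ℚ.positive⁻¹ 1ℚ) 1≤p
    P4>0 : 0ℚ < fourth p
    P4>0 = *>0 (*>0 p>0 p>0) (*>0 p>0 p>0)
    P5≥0 : 0ℚ ≤ℚ fifth p
    P5≥0 = ℚ.<⇒≤ (*>0 p>0 P4>0)
    -- The degrees sum to k m ≤ k b p⁹ = p⁴ Δ, so at most p⁴ vertices exceed Δ.
    Δ = (⟦ k ⟧ * b) * fifth p
    Δ>0 : 0ℚ < Δ
    Δ>0 = *>0 (*>0 κ>0 b>0) (*>0 p>0 P4>0)

    by-matching : HeavyMatching (codeg es) p j → Large es (c * fifth p)
    by-matching M = weaken (ℚ.≤-trans (*-monoʳ P5≥0 c≤c₁) (≡⇒≤ (cong (c₁ *_) (trans (ℚ.*-comm p (fourth p)) (cong (_* p) (sym ⟦j⟧))))))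
      (matching es unif (ℚ.<⇒≤ p>0) M)

    module ByCover (A₀ A₁ : Vec Bool n) (size₀ : card A₀ ≤ j ℕ.+ j)
      (light : ∀ u v → u ≢ v → lookup A₀ u ≡ false → lookup A₀ v ≡ false → codeg es u v ≤ℚ p)
      (size₁ : ⟦ card A₁ ⟧ * Δ ≤ℚ ∑ (allFin n) (deg es)) (low : ∀ v → lookup A₁ v ≡ false → deg es v ≤ℚ Δ) where

      -- At most 2 p⁴ ends of heavy pairs and at most p⁴ vertices of large degree, hence the 3 p⁴
      -- required by `CoverBound`.
      A = A₀ ∪ A₁
      card-A₁ : ⟦ card A₁ ⟧ ≤ℚ fourth p
      card-A₁ = *-cancelʳ-≤ {z = Δ} Δ>0 (begin
        ⟦ card A₁ ⟧ * Δ                    ≤⟨ size₁ ⟩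
        ∑ (allFin n) (deg es)              ≡⟨ ∑-deg k es unif ⟩
        ⟦ k ⟧ * m                          ≤⟨ *-monoˡ (⟦⟧≥0 k) m≤ ⟩
        ⟦ k ⟧ * (b * ninth p)              ≡⟨ eq ⟦ k ⟧ b (fourth p) (fifth p) ⟩
        fourth p * Δ                       ∎)
        where
        eq : ∀ k b f g → k * (b * (f * g)) ≡ f * ((k * b) * g)
        eq = solve-∀ ℚ-ring
      card-A : ⟦ card A ⟧ ≤ℚ 3ℚ * fourth p
      card-A = begin
        ⟦ card A ⟧                         ≤⟨ ⟦⟧-mono (ℕ.≤-trans (card-∪ A₀ A₁) (ℕ.+-monoˡ-≤ (card A₁) size₀)) ⟩
        ⟦ (j ℕ.+ j) ℕ.+ card A₁ ⟧          ≡⟨ trans (⟦⟧-+ (j ℕ.+ j) (card A₁)) (cong (_+ ⟦ card A₁ ⟧) (trans (⟦⟧-+ j j) (cong₂ _+_ ⟦j⟧ ⟦j⟧))) ⟩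
        (fourth p + fourth p) + ⟦ card A₁ ⟧ ≤⟨ ℚ.+-monoʳ-≤ (fourth p + fourth p) card-A₁ ⟩
        (fourth p + fourth p) + fourth p   ≡⟨ eq (fourth p) ⟩
        3ℚ * fourth p                      ∎
        where
        eq : ∀ f → (f + f) + f ≡ 3ℚ * f
        eq = solve-∀ ℚ-ring
      touched untouched-count : ℚ
      touched = ∑ es (λ e → ι (touches A e))
      untouched-count = ∑ es (λ e → ι (not (touches A e)))
      total : touched + untouched-count ≡ m
      total = trans (sym (∑-+ es (λ e → ι (touches A e)) (λ e → ι (not (touches A e)))))
        (trans (∑-cong es (λ {e} _ → both (touches A e))) (trans (∑-const es 1ℚ) (ℚ.*-identityʳ m)))
        where
        both : ∀ t → ι t + ι (not t) ≡ 1ℚ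
        both true  = ℚ.+-identityʳ 1ℚ
        both false = ℚ.+-identityˡ 1ℚ
      dichotomy : ½ * m ≤ℚ touched ⊎ touched ≤ℚ ½ * m → Large es (c * fifth p)
      dichotomy (inj₁ many) = weaken (*-monoʳ P5≥0 c≤c₂) (cover es unif p>0 m≥ A card-A many)
      dichotomy (inj₂ few)  = weaken (*-monoʳ P5≥0 c≤c₃) (chaos es unif 1≤p m≥ A
        (λ u v ne a a′ → light u v ne (proj₁ (∪-false A₀ A₁ u a)) (proj₁ (∪-false A₀ A₁ v a′)))
        (λ v a → low v (proj₂ (∪-false A₀ A₁ v a)))
        (≤-diff (subst (0ℚ ≤ℚ_) (trans (cong (λ m → ½ * m - touched) (sym total)) (trans (eq touched untouched-count) (cong (λ m → untouched-count - ½ * m) total))) (diff-≥0 few))))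
        where
        eq : ∀ t u → ½ * (t + u) - t ≡ u - ½ * (t + u)
        eq = solve-∀ ℚ-ring

    large : Large es (c * fifth p)
    large = by-kind (matching-or-cover (codeg-sym es) {D = p} j)
      where
      by-threshold : ∀ A₀ → card A₀ ≤ j ℕ.+ j → (∀ u v → u ≢ v → lookup A₀ u ≡ false → lookup A₀ v ≡ false → codeg es u v ≤ℚ p) →
        ∃[ A₁ ] (⟦ card A₁ ⟧ * Δ ≤ℚ ∑ (allFin n) (deg es) × (∀ v → lookup A₁ v ≡ false → deg es v ≤ℚ Δ)) → Large es (c * fifth p)
      by-threshold A₀ size₀ light (A₁ , size₁ , low) = ByCover.dichotomy A₀ A₁ size₀ light size₁ low (ℚ.≤-total (½ * m) (ByCover.touched A₀ A₁ size₀ light size₁ low))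
      by-kind : HeavyMatching (codeg es) p j ⊎ (∃[ A ] (card A ≤ j ℕ.+ j × (∀ u v → u ≢ v → lookup A u ≡ false → lookup A v ≡ false → codeg es u v ≤ℚ p))) →
        Large es (c * fifth p)
      by-kind (inj₁ M)                   = by-matching M
      by-kind (inj₂ (A₀ , size₀ , light)) = by-threshold A₀ size₀ light (card-threshold (deg es) (ℚ.<⇒≤ Δ>0) (λ v → ∑≥0 es (mem≥0 v)))

  LargeForm : ℚ → ℚ → Set
  LargeForm b c = ∀ {n} (es : List (Vec Bool n)) → All (λ e → card e ≡ k) es →
    ∀ d → ninth ⟦ d ⟧ ≤ℚ ⟦ length es ⟧ → ⟦ length es ⟧ ≤ℚ b * ninth ⟦ d ⟧ → Large es (c * fifth ⟦ d ⟧)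

  large-form : ∀ {b} → 0ℚ < b → ∃[ c ] (0ℚ < c × LargeForm b c)
  large-form {b} b>0 = combine from-matching from-cover (ChaosCase.from-chaos (*≥0 (⟦⟧≥0 k) (ℚ.<⇒≤ b>0)))
    where
    combine : ∃[ c ] (0ℚ < c × MatchingBound c) → ∃[ c ] (0ℚ < c × CoverBound c) → ∃[ c ] (0ℚ < c × ChaosBound (⟦ k ⟧ * b) c) →
      ∃[ c ] (0ℚ < c × LargeForm b c)
    combine (c₁ , c₁>0 , matching) (c₂ , c₂>0 , cover) (c₃ , c₃>0 , chaos) = c , ⊓>0 c₁>0 (⊓>0 c₂>0 c₃>0) , result
      where
      c = c₁ ℚ.⊓ (c₂ ℚ.⊓ c₃)
      result : LargeForm b c
      -- For d = 0 the upper bound forces m = 0, and zero weights suffice.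
      result []       unif zero m≥ m≤ = (λ _ → 0ℚ) , (λ _ → 0≤1) , ≡⇒≤ (trans (ℚ.*-zeroʳ c) (sym (∑-[] _)))
      result (e ∷ es) unif zero m≥ m≤ = ⊥-elim (ℚ.<-irrefl refl (ℚ.<-≤-trans (ℚ.<-≤-trans (ℚ.positive⁻¹ 1ℚ) (≤+ˡ 1ℚ (⟦⟧≥0 (length es))))
        (subst (⟦ suc (length es) ⟧ ≤ℚ_) (ℚ.*-zeroʳ b) m≤)))
      result es unif (suc d) m≥ m≤ = Combine.large b>0 (ℚ.p⊓q≤p c₁ (c₂ ℚ.⊓ c₃))
        (ℚ.≤-trans (ℚ.p⊓q≤q c₁ (c₂ ℚ.⊓ c₃)) (ℚ.p⊓q≤p c₂ c₃)) (ℚ.≤-trans (ℚ.p⊓q≤q c₁ (c₂ ℚ.⊓ c₃)) (ℚ.p⊓q≤q c₂ c₃))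
        matching cover chaos es unif {⟦ suc d ⟧} ((suc d ℕ.* suc d) ℕ.* (suc d ℕ.* suc d)) (fourth-power (suc d)) (≤+ˡ 1ℚ (⟦⟧≥0 d)) m≥ m≤
        where
        fourth-power : ∀ d → ⟦ (d ℕ.* d) ℕ.* (d ℕ.* d) ⟧ ≡ fourth ⟦ d ⟧
        fourth-power d = trans (⟦⟧-* (d ℕ.* d) (d ℕ.* d)) (cong (λ x → x * x) (⟦⟧-* d d))

-- Random colourings

ins : ∀ {r} → Fin r → Vec Bool r → Vec Bool r
ins zero    (b ∷ C) = true ∷ C
ins (suc i) (b ∷ C) = b ∷ ins i C

ins-comm : ∀ {r} (i j : Fin r) C → ins i (ins j C) ≡ ins j (ins i C)
ins-comm zero    zero    (b ∷ C) = refl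
ins-comm zero    (suc j) (b ∷ C) = refl
ins-comm (suc i) zero    (b ∷ C) = refl
ins-comm (suc i) (suc j) (b ∷ C) = cong (b ∷_) (ins-comm i j C)

isFull : ∀ {r} → Vec Bool r → Bool
isFull []      = true
isFull (b ∷ C) = b ∧ isFull C

missing : ∀ {r} → Vec Bool r → ℕ
missing []          = 0
missing (true ∷ C)  = missing C
missing (false ∷ C) = suc (missing C)

-- The last argument accumulates the colours already seen; the operators below act on functions of
-- this set.
colours : ∀ {r n} → Vec (Fin r) n → Vec Bool n → Vec Bool r → Vec Bool r
colours []       []          C = C
colours (i ∷ fs) (true ∷ e)  C = colours fs e (ins i C)
colours (i ∷ fs) (false ∷ e) C = colours fs e C

∑-weights : ∀ {r} (μ : Fin r → ℚ) c → ∑ (allFin r) μ ≡ 1ℚ → ∑ (allFin r) (λ i → μ i * c) ≡ c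
∑-weights {r} μ c p = trans (∑-*ʳ c (allFin r) μ) (trans (cong (_* c) p) (ℚ.*-identityˡ c))

argmax : ∀ {r} (X : Fin (suc r) → ℚ) → ∃[ i ] (∀ j → X j ≤ℚ X i)
argmax {zero}  X = zero , λ { zero → ℚ.≤-refl }
argmax {suc r} X with argmax (X ∘ suc)
... | i , p with ℚ.≤-total (X zero) (X (suc i))
...   | inj₁ q = suc i , λ { zero → q ; (suc j) → p j }
...   | inj₂ q = zero , λ { zero → ℚ.≤-refl ; (suc j) → ℚ.≤-trans (p j) q }

opaque
  𝔼ᶜ : ∀ {r n} → (Fin n → Fin r → ℚ) → (Vec (Fin r) n → ℚ) → ℚ
  𝔼ᶜ {r} {zero}  μ G = G []
  𝔼ᶜ {r} {suc n} μ G = ∑ (allFin r) (λ i → μ zero i * 𝔼ᶜ (μ ∘ suc) (λ fs → G (i ∷ fs)))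

  𝔼ᶜ-[] : ∀ {r} (μ : Fin 0 → Fin r → ℚ) G → 𝔼ᶜ μ G ≡ G []
  𝔼ᶜ-[] μ G = refl

  𝔼ᶜ-∷ : ∀ {r n} (μ : Fin (suc n) → Fin r → ℚ) G →
    𝔼ᶜ μ G ≡ ∑ (allFin r) (λ i → μ zero i * 𝔼ᶜ (μ ∘ suc) (λ fs → G (i ∷ fs)))
  𝔼ᶜ-∷ μ G = refl

  𝔼ᶜ-+ : ∀ {r n} (μ : Fin n → Fin r → ℚ) G G′ → 𝔼ᶜ μ (λ fs → G fs + G′ fs) ≡ 𝔼ᶜ μ G + 𝔼ᶜ μ G′
  𝔼ᶜ-+ {r} {zero}  μ G G′ = refl
  𝔼ᶜ-+ {r} {suc n} μ G G′ = trans (∑-cong (allFin r) (λ {i} _ → trans (cong (μ zero i *_) (𝔼ᶜ-+ (μ ∘ suc) (λ fs → G (i ∷ fs)) (λ fs → G′ (i ∷ fs))))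
    (ℚ.*-distribˡ-+ (μ zero i) (𝔼ᶜ (μ ∘ suc) (λ fs → G (i ∷ fs))) (𝔼ᶜ (μ ∘ suc) (λ fs → G′ (i ∷ fs))))))
    (∑-+ (allFin r) (λ i → μ zero i * 𝔼ᶜ (μ ∘ suc) (λ fs → G (i ∷ fs))) (λ i → μ zero i * 𝔼ᶜ (μ ∘ suc) (λ fs → G′ (i ∷ fs))))

  𝔼ᶜ-0 : ∀ {r n} (μ : Fin n → Fin r → ℚ) → 𝔼ᶜ μ (λ _ → 0ℚ) ≡ 0ℚ
  𝔼ᶜ-0 {r} {zero}  μ = refl
  𝔼ᶜ-0 {r} {suc n} μ = ∑-zero (allFin r) (λ {i} _ → trans (cong (μ zero i *_) (𝔼ᶜ-0 (μ ∘ suc))) (ℚ.*-zeroʳ (μ zero i)))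

  -- Conditional expectations: colouring the vertices one by one with the best colour never falls
  -- below the mean.
  𝔼ᶜ-max : ∀ {r n} (μ : Fin n → Fin (suc r) → ℚ) → (∀ v i → 0ℚ ≤ℚ μ v i) → (∀ v → ∑ (allFin (suc r)) (μ v) ≡ 1ℚ) →
    ∀ G → ∃[ fs ] 𝔼ᶜ μ G ≤ℚ G fs
  𝔼ᶜ-max {r} {zero}  μ μ≥0 Σμ G = [] , ℚ.≤-refl
  𝔼ᶜ-max {r} {suc n} μ μ≥0 Σμ G with argmax (λ i → 𝔼ᶜ (μ ∘ suc) (λ fs → G (i ∷ fs)))
  ... | i , best with 𝔼ᶜ-max (μ ∘ suc) (μ≥0 ∘ suc) (Σμ ∘ suc) (λ fs → G (i ∷ fs))
  ...   | fs , p = i ∷ fs , ℚ.≤-trans (∑-mono (allFin (suc r)) (λ {j} _ → *-monoˡ (μ≥0 zero j) (best j)))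
            (ℚ.≤-trans (≡⇒≤ (∑-weights (μ zero) (𝔼ᶜ (μ ∘ suc) (λ fs → G (i ∷ fs))) (Σμ zero))) p)

opaque
  unfolding ∑

  𝔼ᶜ-∑ : ∀ {r n} {A : Set} (μ : Fin n → Fin r → ℚ) (xs : List A) (G : A → Vec (Fin r) n → ℚ) →
    𝔼ᶜ μ (λ fs → ∑ xs (λ a → G a fs)) ≡ ∑ xs (λ a → 𝔼ᶜ μ (G a))
  𝔼ᶜ-∑ μ []       G = 𝔼ᶜ-0 μ
  𝔼ᶜ-∑ μ (a ∷ xs) G = trans (𝔼ᶜ-+ μ (G a) (λ fs → ∑ xs (λ a → G a fs))) (cong (𝔼ᶜ μ (G a) +_) (𝔼ᶜ-∑ μ xs G))

-- A vertex of weight t gets colour i with probability ϱ + t w i.  Adding one random colour acts on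
-- functions of the set of colours seen by U + t W.
module Operators {r : ℕ} (ϱ : ℚ) (w : Fin r → ℚ) where

  U W : (Vec Bool r → ℚ) → Vec Bool r → ℚ
  U h C = ϱ * ∑ (allFin r) (λ i → h (ins i C))
  W h C = ∑ (allFin r) (λ i → w i * h (ins i C))

  U-cong : ∀ {h h′} → (∀ C → h C ≡ h′ C) → ∀ C → U h C ≡ U h′ C
  U-cong p C = cong (ϱ *_) (∑-cong (allFin r) (λ {i} _ → p (ins i C)))

  W-cong : ∀ {h h′} → (∀ C → h C ≡ h′ C) → ∀ C → W h C ≡ W h′ C
  W-cong p C = ∑-cong (allFin r) (λ {i} _ → cong (w i *_) (p (ins i C)))

  UW-comm : ∀ h C → U (W h) C ≡ W (U h) C
  UW-comm h C = trans (cong (ϱ *_) (trans (∑-swap (allFin r) (allFin r) (λ i j → w j * h (ins j (ins i C))))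
      (∑-cong (allFin r) (λ {j} _ → trans (∑-*ˡ (w j) (allFin r) (λ i → h (ins j (ins i C))))
        (cong (w j *_) (∑-cong (allFin r) (λ {i} _ → cong h (ins-comm j i C))))))))
    (trans (sym (∑-*ˡ ϱ (allFin r) (λ j → w j * ∑ (allFin r) (λ i → h (ins i (ins j C))))))
      (∑-cong (allFin r) (λ {j} _ → eq ϱ (w j) (∑ (allFin r) (λ i → h (ins i (ins j C)))))))
    where
    eq : ∀ a b c → a * (b * c) ≡ b * (a * c)
    eq = solve-∀ ℚ-ring

  U^ W^ : ℕ → (Vec Bool r → ℚ) → Vec Bool r → ℚ
  U^ zero    h = h
  U^ (suc j) h = U (U^ j h)
  W^ zero    h = h
  W^ (suc s) h = W (W^ s h)

  U-W^ : ∀ s h C → U (W^ s h) C ≡ W^ s (U h) C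
  U-W^ zero    h C = refl
  U-W^ (suc s) h C = trans (UW-comm (W^ s h) C) (W-cong (U-W^ s h) C)

  module _ (Σw : ∑ (allFin r) w ≡ 0ℚ) (Σϱ : ⟦ r ⟧ * ϱ ≡ 1ℚ) where

    probs : ℚ → Fin r → ℚ
    probs t i = ϱ + t * w i

    Σprobs : ∀ t → ∑ (allFin r) (probs t) ≡ 1ℚ
    Σprobs t = trans (∑-+ (allFin r) (λ _ → ϱ) (λ i → t * w i)) (trans (cong₂ _+_
      (trans (∑-const (allFin r) ϱ) (trans (cong (λ l → ⟦ l ⟧ * ϱ) (List.length-tabulate {n = r} id)) Σϱ))
      (trans (∑-*ˡ t (allFin r) w) (trans (cong (t *_) Σw) (ℚ.*-zeroʳ t)))) (ℚ.+-identityʳ 1ℚ))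

    step : ∀ t (H : Vec Bool r → ℚ) C → ∑ (allFin r) (λ i → probs t i * H (ins i C)) ≡ U H C + t * W H C
    step t H C = trans (∑-cong (allFin r) (λ {i} _ → eq ϱ t (w i) (H (ins i C)))) (trans (∑-+ (allFin r) (λ i → ϱ * H (ins i C)) (λ i → t * (w i * H (ins i C))))
      (cong₂ _+_ (∑-*ˡ ϱ (allFin r) (λ i → H (ins i C))) (∑-*ˡ t (allFin r) (λ i → w i * H (ins i C)))))
      where
      eq : ∀ a t b c → (a + t * b) * c ≡ a * c + t * (b * c)
      eq = solve-∀ ℚ-ring

    -- Each vertex of e applies U + t W, and the two operators commute because the order in which
    -- colours are inserted is irrelevant; so the product expands over subsets as a commutative one.
    expansion : ∀ {n} (t : Fin n → ℚ) (e : Vec Bool n) h C → 𝔼ᶜ (λ v → probs (t v)) (λ fs → h (colours fs e C))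
      ≡ ∑ (subs e) (λ S → mono S t * W^ (card S) (U^ (card e ℕ.∸ card S) h) C)
    expansion t [] h C = trans (𝔼ᶜ-[] _ _) (sym (trans (∑-∷ [] [] _) (trans (cong (1ℚ * h C +_) (∑-[] _)) (trans (ℚ.+-identityʳ (1ℚ * h C)) (ℚ.*-identityˡ (h C))))))
    expansion t (false ∷ e) h C = trans (𝔼ᶜ-∷ (λ v → probs (t v)) (λ fs → h (colours fs (false ∷ e) C)))
      (trans (∑-weights (probs (t zero)) (𝔼ᶜ (λ v → probs (t (suc v))) (λ fs → h (colours fs e C))) (Σprobs (t zero)))
      (trans (expansion (t ∘ suc) e h C) (sym (∑-map (false ∷_) (subs e) (λ S → mono S t * W^ (card S) (U^ (card e ℕ.∸ card S) h) C)))))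
    expansion t (true ∷ e) h C = trans (𝔼ᶜ-∷ (λ v → probs (t v)) (λ fs → h (colours fs (true ∷ e) C)))
      (trans (∑-cong (allFin r) (λ {i} _ → cong (probs (t zero) i *_) (expansion (t ∘ suc) e h (ins i C))))
      (trans (∑-cong (allFin r) (λ {i} _ → sym (∑-*ˡ (probs (t zero) i) (subs e) (λ S → mono S t′ * H S (ins i C)))))
      (trans (∑-swap (allFin r) (subs e) (λ i S → probs (t zero) i * (mono S t′ * H S (ins i C))))
      (trans (∑-cong (subs e) (λ {S} S∈ → per-subset S S∈))
      (trans (∑-+ (subs e) (λ S → target (false ∷ S)) (λ S → target (true ∷ S)))
      (sym (trans (∑-++ (List.map (false ∷_) (subs e)) (List.map (true ∷_) (subs e)) target)
        (cong₂ _+_ (∑-map (false ∷_) (subs e) target) (∑-map (true ∷_) (subs e) target)))))))))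
      where
      t′ = t ∘ suc
      H : Vec Bool _ → Vec Bool r → ℚ
      H S = W^ (card S) (U^ (card e ℕ.∸ card S) h)
      target : Vec Bool _ → ℚ
      target S = mono S t * W^ (card S) (U^ (suc (card e) ℕ.∸ card S) h) C
      per-subset : ∀ S → S ∈ subs e → ∑ (allFin r) (λ i → probs (t zero) i * (mono S t′ * H S (ins i C))) ≡ target (false ∷ S) + target (true ∷ S)
      per-subset S S∈ = trans (∑-cong (allFin r) (λ {i} _ → eq (probs (t zero) i) (mono S t′) (H S (ins i C))))
        (trans (∑-*ˡ (mono S t′) (allFin r) (λ i → probs (t zero) i * H S (ins i C)))
        (trans (cong (mono S t′ *_) (step (t zero) (H S) C))
        (trans (eq′ (mono S t′) (U (H S) C) (t zero) (W (H S) C))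
        (cong (λ x → mono S t′ * x + (t zero * mono S t′) * W (H S) C)
          (trans (U-W^ (card S) (U^ (card e ℕ.∸ card S) h) C) (cong (λ j → W^ (card S) (U^ j h) C) (sym (ℕ.+-∸-assoc 1 (⊆-card S e (∈-subs⇒⊆ e S∈))))))))))
        where
        eq : ∀ p m h → p * (m * h) ≡ m * (p * h)
        eq = solve-∀ ℚ-ring
        eq′ : ∀ m u t w → m * (u + t * w) ≡ m * u + (t * m) * w
        eq′ = solve-∀ ℚ-ring

  module _ (ϱ≥0 : 0ℚ ≤ℚ ϱ) (Σϱ : ⟦ r ⟧ * ϱ ≡ 1ℚ) (Σ∣w∣ : ∑ (allFin r) (λ i → ∣ w i ∣) ≤ℚ 1ℚ) where

    -- U is an average and W has total absolute weight at most 1, so neither increases the maximum.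
    -- This is why Γ = 1 bounds every level.
    ∣U∣≤1 : ∀ {h} → (∀ C → ∣ h C ∣ ≤ℚ 1ℚ) → ∀ C → ∣ U h C ∣ ≤ℚ 1ℚ
    ∣U∣≤1 {h} p C = begin
      ∣ U h C ∣                                    ≡⟨ trans (ℚ.∣p*q∣≡∣p∣*∣q∣ ϱ (∑ (allFin r) (λ i → h (ins i C)))) (cong (_* ∣ ∑ (allFin r) (λ i → h (ins i C)) ∣) (ℚ.0≤p⇒∣p∣≡p ϱ≥0)) ⟩
      ϱ * ∣ ∑ (allFin r) (λ i → h (ins i C)) ∣     ≤⟨ *-monoˡ ϱ≥0 (ℚ.≤-trans (∣∑∣≤ (allFin r) (λ i → h (ins i C))) (∑-≤-const (allFin r) 1ℚ (λ {i} _ → p (ins i C)))) ⟩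
      ϱ * (⟦ length (allFin r) ⟧ * 1ℚ)             ≡⟨ trans (eq ϱ ⟦ length (allFin r) ⟧) (trans (cong (λ l → ⟦ l ⟧ * ϱ) (List.length-tabulate {n = r} id)) Σϱ) ⟩
      1ℚ                                           ∎
      where
      open ℚ.≤-Reasoning
      eq : ∀ a l → a * (l * 1ℚ) ≡ l * a
      eq = solve-∀ ℚ-ring

    ∣W∣≤1 : ∀ {h} → (∀ C → ∣ h C ∣ ≤ℚ 1ℚ) → ∀ C → ∣ W h C ∣ ≤ℚ 1ℚ
    ∣W∣≤1 {h} p C = ℚ.≤-trans (∣∑∣≤ (allFin r) (λ i → w i * h (ins i C))) (ℚ.≤-trans (∑-mono (allFin r) (λ {i} _ →
      subst₂ _≤ℚ_ (sym (ℚ.∣p*q∣≡∣p∣*∣q∣ (w i) (h (ins i C)))) (ℚ.*-identityʳ ∣ w i ∣) (*-monoˡ (ℚ.0≤∣p∣ (w i)) (p (ins i C))))) Σ∣w∣)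

    ∣U^∣≤1 : ∀ j {h} → (∀ C → ∣ h C ∣ ≤ℚ 1ℚ) → ∀ C → ∣ U^ j h C ∣ ≤ℚ 1ℚ
    ∣U^∣≤1 zero    p = p
    ∣U^∣≤1 (suc j) p = ∣U∣≤1 (∣U^∣≤1 j p)

    ∣W^∣≤1 : ∀ s {h} → (∀ C → ∣ h C ∣ ≤ℚ 1ℚ) → ∀ C → ∣ W^ s h C ∣ ≤ℚ 1ℚ
    ∣W^∣≤1 zero    p = p
    ∣W^∣≤1 (suc s) p = ∣W∣≤1 (∣W^∣≤1 s p)

-- c! · rStirling j c b counts the maps from j points to b + c colours that hit c given colours.
rStirling : ℕ → ℕ → ℕ → ℕ
rStirling zero    zero    b = 1
rStirling zero    (suc c) b = 0
rStirling (suc j) zero    b = b ℕ.* rStirling j zero b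
rStirling (suc j) (suc c) b = (b ℕ.+ suc c) ℕ.* rStirling j (suc c) b ℕ.+ rStirling j c b

hits : ℕ → ℕ → ℕ → ℕ
hits j c b = c ! ℕ.* rStirling j c b

rStirling-0 : ∀ j c → rStirling j c 0 ≡ stirling2 j c
rStirling-0 zero    zero    = refl
rStirling-0 zero    (suc c) = refl
rStirling-0 (suc j) zero    = refl
rStirling-0 (suc j) (suc c) = cong₂ (λ x y → suc c ℕ.* x ℕ.+ y) (rStirling-0 j (suc c)) (rStirling-0 j c)

-- After multiplication by c!, the maps are split by whether one distinguished further colour is
-- missed or hit.
rStirling-shift : ∀ j c b → rStirling j c (suc b) ≡ rStirling j c b ℕ.+ suc c ℕ.* rStirling j (suc c) b
rStirling-shift zero    zero    b = refl
rStirling-shift zero    (suc c) b = sym (ℕ.*-zeroʳ (suc (suc c)))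
rStirling-shift (suc j) zero    b = trans (cong (suc b ℕ.*_) (rStirling-shift j zero b)) (eq b (rStirling j zero b) (rStirling j 1 b))
  where
  eq : ∀ b x y → suc b ℕ.* (x ℕ.+ 1 ℕ.* y) ≡ b ℕ.* x ℕ.+ 1 ℕ.* ((b ℕ.+ 1) ℕ.* y ℕ.+ x)
  eq = solveℕ-∀
rStirling-shift (suc j) (suc c) b = trans (cong₂ (λ x y → (suc b ℕ.+ suc c) ℕ.* x ℕ.+ y) (rStirling-shift j (suc c) b) (rStirling-shift j c b))
  (eq b c (rStirling j (suc (suc c)) b) (rStirling j (suc c) b) (rStirling j c b))
  where
  eq : ∀ b c x y z → (suc b ℕ.+ suc c) ℕ.* (y ℕ.+ suc (suc c) ℕ.* x) ℕ.+ (z ℕ.+ suc c ℕ.* y)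
     ≡ ((b ℕ.+ suc c) ℕ.* y ℕ.+ z) ℕ.+ suc (suc c) ℕ.* ((b ℕ.+ suc (suc c)) ℕ.* x ℕ.+ y)
  eq = solveℕ-∀

-- The spare colour accommodates the points beyond the c that hit the given colours.
rStirling>0 : ∀ j c b → c ≤ j → 1 ≤ rStirling j c (suc b)
rStirling>0 zero    zero    b p       = s≤s z≤n
rStirling>0 (suc j) zero    b p       = ℕ.≤-trans (rStirling>0 j zero b z≤n) (ℕ.m≤m+n (rStirling j zero (suc b)) (b ℕ.* rStirling j zero (suc b)))
rStirling>0 (suc j) (suc c) b (s≤s p) = ℕ.≤-trans (rStirling>0 j c b p) (ℕ.m≤n+m (rStirling j c (suc b)) _)

!>0 : ∀ c → 1 ≤ c !
!>0 zero    = s≤s z≤n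
!>0 (suc c) = ℕ.*-mono-≤ {1} {suc c} (s≤s z≤n) (!>0 c)

hits>0 : ∀ j c b → c ≤ j → 1 ≤ hits j c (suc b)
hits>0 j c b p = ℕ.*-mono-≤ (!>0 c) (rStirling>0 j c b p)

hits-shift : ∀ j c b → hits j c (suc b) ≡ hits j c b ℕ.+ hits j (suc c) b
hits-shift j c b = trans (cong (c ! ℕ.*_) (rStirling-shift j c b)) (eq (c !) (rStirling j c b) c (rStirling j (suc c) b))
  where
  eq : ∀ f x c y → f ℕ.* (x ℕ.+ suc c ℕ.* y) ≡ f ℕ.* x ℕ.+ (suc c ℕ.* f) ℕ.* y
  eq = solveℕ-∀

-- Reveal the first point instead of the last.
hits-suc-0 : ∀ j b → hits (suc j) 0 b ≡ b ℕ.* hits j 0 b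
hits-suc-0 j b = eq b (rStirling j 0 b)
  where
  eq : ∀ b x → 1 ℕ.* (b ℕ.* x) ≡ b ℕ.* (1 ℕ.* x)
  eq = solveℕ-∀

hits-suc-suc : ∀ j c b → hits (suc j) (suc c) b ≡ b ℕ.* hits j (suc c) b ℕ.+ suc c ℕ.* hits j c (suc b)
hits-suc-suc j c b = trans (eq c (c !) b (rStirling j (suc c) b) (rStirling j c b)) (cong (λ x → b ℕ.* hits j (suc c) b ℕ.+ suc c ℕ.* (c ! ℕ.* x)) (sym (rStirling-shift j c b)))
  where
  eq : ∀ c f b x y → (suc c ℕ.* f) ℕ.* ((b ℕ.+ suc c) ℕ.* x ℕ.+ y) ≡ b ℕ.* ((suc c ℕ.* f) ℕ.* x) ℕ.+ suc c ℕ.* (f ℕ.* (y ℕ.+ suc c ℕ.* x))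
  eq = solveℕ-∀

hit : (ℕ → ℕ → ℚ) → ℕ → ℕ → ℚ
hit φ zero    b = 0ℚ
hit φ (suc c) b = ⟦ suc c ⟧ * φ c (suc b)

-- A function of the numbers of missing and present colours sees only two kinds of insertion: a
-- colour already present changes nothing, a missing one moves from one number to the other.
∑-ins : ∀ {r} (φ : ℕ → ℕ → ℚ) (C : Vec Bool r) →
  ∑ (allFin r) (λ i → φ (missing (ins i C)) (card (ins i C))) ≡ ⟦ card C ⟧ * φ (missing C) (card C) + hit φ (missing C) (card C)
∑-ins φ [] = trans (∑-[] _) (sym (trans (ℚ.+-identityʳ _) (ℚ.*-zeroˡ (φ 0 0))))
∑-ins {suc r} φ (true ∷ C) = trans (∑-allFin-suc r (λ i → φ (missing (ins i (true ∷ C))) (card (ins i (true ∷ C)))))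
  (trans (cong (φ (missing C) (suc (card C)) +_) (∑-ins (λ c b → φ c (suc b)) C)) (eq (missing C)))
  where
  eq′ : ∀ x l h → x + (l * x + h) ≡ (1ℚ + l) * x + h
  eq′ = solve-∀ ℚ-ring
  eq : ∀ m → φ m (suc (card C)) + (⟦ card C ⟧ * φ m (suc (card C)) + hit (λ c b → φ c (suc b)) m (card C))
     ≡ ⟦ suc (card C) ⟧ * φ m (suc (card C)) + hit φ m (suc (card C))
  eq zero    = eq′ (φ zero (suc (card C))) ⟦ card C ⟧ 0ℚ
  eq (suc m) = eq′ (φ (suc m) (suc (card C))) ⟦ card C ⟧ (⟦ suc m ⟧ * φ m (suc (suc (card C))))
∑-ins {suc r} φ (false ∷ C) = trans (∑-allFin-suc r (λ i → φ (missing (ins i (false ∷ C))) (card (ins i (false ∷ C)))))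
  (trans (cong (φ (missing C) (suc (card C)) +_) (∑-ins (λ c b → φ (suc c) b) C)) (eq (missing C)))
  where
  eq₀ : ∀ x a → x + (a + 0ℚ) ≡ a + (1ℚ + 0ℚ) * x
  eq₀ = solve-∀ ℚ-ring
  eq₁ : ∀ x a m → x + (a + m * x) ≡ a + (1ℚ + m) * x
  eq₁ = solve-∀ ℚ-ring
  eq : ∀ m → φ m (suc (card C)) + (⟦ card C ⟧ * φ (suc m) (card C) + hit (λ c b → φ (suc c) b) m (card C))
     ≡ ⟦ card C ⟧ * φ (suc m) (card C) + ⟦ suc m ⟧ * φ m (suc (card C))
  eq zero    = eq₀ (φ zero (suc (card C))) (⟦ card C ⟧ * φ 1 (card C))
  eq (suc m) = eq₁ (φ (suc m) (suc (card C))) (⟦ card C ⟧ * φ (suc (suc m)) (card C)) ⟦ suc m ⟧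

full : ∀ {r} → Vec Bool r → ℚ
full C = ι (isFull C)

module _ {r : ℕ} (ϱ : ℚ) (w : Fin r → ℚ) where

  open Operators ϱ w

  -- For ϱ = 1/r both sides are the probability that j further uniform colours complete C.
  U^-full : ∀ j C → U^ j full C ≡ ϱ ^ j * ⟦ hits j (missing C) (card C) ⟧
  U^-full zero    C = trans (base C) (sym (ℚ.*-identityˡ ⟦ hits 0 (missing C) (card C) ⟧))
    where
    base : ∀ {r} (C : Vec Bool r) → full C ≡ ⟦ hits 0 (missing C) (card C) ⟧
    base []          = sym (ℚ.+-identityʳ 1ℚ)
    base (true ∷ C)  = trans (base C) (cong ⟦_⟧ (shift (missing C)))
      where
      shift : ∀ m → hits 0 m (card C) ≡ hits 0 m (suc (card C))
      shift zero    = refl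
      shift (suc m) = refl
    base (false ∷ C) = cong ⟦_⟧ (sym (ℕ.*-zeroʳ (suc (missing C) !)))
  U^-full (suc j) C = trans (U-cong (U^-full j) C) (trans (cong (ϱ *_) (∑-*ˡ (ϱ ^ j) (allFin r) (λ i → ⟦ hits j (missing (ins i C)) (card (ins i C)) ⟧)))
    (trans (sym (ℚ.*-assoc ϱ (ϱ ^ j) _)) (cong (ϱ ^ suc j *_) (trans (∑-ins (λ c b → ⟦ hits j c b ⟧) C) (collect (missing C))))))
    where
    b = card C
    collect : ∀ m → ⟦ b ⟧ * ⟦ hits j m b ⟧ + hit (λ c b → ⟦ hits j c b ⟧) m b ≡ ⟦ hits (suc j) m b ⟧
    collect zero    = trans (ℚ.+-identityʳ _) (trans (sym (⟦⟧-* b (hits j 0 b))) (cong ⟦_⟧ (sym (hits-suc-0 j b))))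
    collect (suc m) = trans (cong₂ _+_ (sym (⟦⟧-* b (hits j (suc m) b))) (sym (⟦⟧-* (suc m) (hits j m (suc b)))))
      (trans (sym (⟦⟧-+ (b ℕ.* hits j (suc m) b) (suc m ℕ.* hits j m (suc b)))) (cong ⟦_⟧ (sym (hits-suc-suc j m b))))

-- Cut edges as complete colour sets

∅ : ∀ {r} → Vec Bool r
∅ {r} = Vec.replicate r false

missing-∅ : ∀ r → missing (∅ {r}) ≡ r
missing-∅ zero    = refl
missing-∅ (suc r) = cong suc (missing-∅ r)

any-allFin : ∀ n (p : Fin (suc n) → Bool) → any p (allFin (suc n)) ≡ p zero ∨ any (p ∘ suc) (allFin n)
any-allFin n p = cong (λ bs → p zero ∨ List.foldr _∨_ false bs) (trans (List.map-tabulate suc p) (sym (List.map-tabulate id (p ∘ suc))))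

all-allFin : ∀ n (p : Fin (suc n) → Bool) → all p (allFin (suc n)) ≡ p zero ∧ all (p ∘ suc) (allFin n)
all-allFin n p = cong (λ bs → p zero ∧ List.foldr _∧_ true bs) (trans (List.map-tabulate suc p) (sym (List.map-tabulate id (p ∘ suc))))

isFull-all : ∀ {r} (C : Vec Bool r) (p : Fin r → Bool) → (∀ i → lookup C i ≡ p i) → isFull C ≡ all p (allFin r)
isFull-all []              p q = refl
isFull-all {suc r} (b ∷ C) p q = trans (cong₂ _∧_ (q zero) (isFull-all C (p ∘ suc) (q ∘ suc))) (sym (all-allFin r p))

lookup-ins : ∀ {r} (j : Fin r) C i → lookup (ins j C) i ≡ lookup C i ∨ ⌊ j Fin.≟ i ⌋
lookup-ins zero    (b ∷ C) zero    = sym (Bool.∨-zeroʳ b)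
lookup-ins zero    (b ∷ C) (suc i) = sym (Bool.∨-identityʳ (lookup C i))
lookup-ins (suc j) (b ∷ C) zero    = sym (Bool.∨-identityʳ b)
lookup-ins (suc j) (b ∷ C) (suc i) = trans (lookup-ins j C i) (cong (lookup C i ∨_) same)
  where
  same : ⌊ j Fin.≟ i ⌋ ≡ ⌊ suc j Fin.≟ suc i ⌋
  same with j Fin.≟ i
  ... | yes _ = refl
  ... | no _  = refl

lookup-colours : ∀ {r n} (fs : Vec (Fin r) n) e C i → lookup (colours fs e C) i ≡ lookup C i ∨ meets (lookup fs) e i
lookup-colours [] [] C i = sym (Bool.∨-identityʳ (lookup C i))
lookup-colours {n = suc n} (j ∷ fs) (true ∷ e) C i = trans (lookup-colours fs e (ins j C) i) (trans (cong (_∨ meets (lookup fs) e i) (lookup-ins j C i))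
  (trans (Bool.∨-assoc (lookup C i) ⌊ j Fin.≟ i ⌋ (meets (lookup fs) e i)) (cong (lookup C i ∨_) (sym (any-allFin n (λ v → lookup (true ∷ e) v ∧ ⌊ lookup (j ∷ fs) v Fin.≟ i ⌋))))))
lookup-colours {n = suc n} (j ∷ fs) (false ∷ e) C i = trans (lookup-colours fs e C i)
  (cong (lookup C i ∨_) (sym (any-allFin n (λ v → lookup (false ∷ e) v ∧ ⌊ lookup (j ∷ fs) v Fin.≟ i ⌋))))

isCutEdge≡isFull : ∀ {r n} (fs : Vec (Fin r) n) e → isCutEdge (lookup fs) e ≡ isFull (colours fs e ∅)
isCutEdge≡isFull fs e = sym (isFull-all (colours fs e ∅) (meets (lookup fs) e) (λ i → trans (lookup-colours fs e ∅ i) (cong (_∨ meets (lookup fs) e i) (lookup-∅ i))))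

⟦length-filter⟧ : ∀ {A : Set} (p : A → Bool) xs → ⟦ length (List.filterᵇ p xs) ⟧ ≡ ∑ xs (λ x → ι (p x))
⟦length-filter⟧ p []       = sym (∑-[] _)
⟦length-filter⟧ p (x ∷ xs) with p x in e
... | true  = trans (cong (1ℚ +_) (⟦length-filter⟧ p xs)) (sym (trans (∑-∷ x xs _) (cong (λ b → ι b + ∑ xs (λ x → ι (p x))) e)))
... | false = trans (⟦length-filter⟧ p xs) (sym (trans (∑-∷ x xs _) (trans (cong (λ b → ι b + ∑ xs (λ x → ι (p x))) e) (ℚ.+-identityˡ _))))

module Cut (k : ℕ) {r′ : ℕ} (ϱ : ℚ) (w : Fin (suc r′) → ℚ) (Σw : ∑ (allFin (suc r′)) w ≡ 0ℚ) (Σϱ : ⟦ suc r′ ⟧ * ϱ ≡ 1ℚ)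
  (ϱ≥0 : 0ℚ ≤ℚ ϱ) (Σ∣w∣ : ∑ (allFin (suc r′)) (λ i → ∣ w i ∣) ≤ℚ 1ℚ) (∣w∣≤ϱ : ∀ i → ∣ w i ∣ ≤ℚ ϱ) where

  open Operators ϱ w

  levelWeight : ℕ → ℚ
  levelWeight s = W^ s (U^ (k ℕ.∸ s) full) ∅

  -- Level 0 is the expected contribution of an edge to a uniform random cut. The excess subtracts
  -- it, so it is removed here.
  γ : ℕ → ℚ
  γ zero    = 0ℚ
  γ (suc s) = levelWeight (suc s)

  ∣γ∣≤1 : ∀ s → ∣ γ s ∣ ≤ℚ 1ℚ
  ∣γ∣≤1 zero    = 0≤1
  ∣γ∣≤1 (suc s) = ∣W^∣≤1 ϱ≥0 Σϱ Σ∣w∣ (suc s) (∣U^∣≤1 ϱ≥0 Σϱ Σ∣w∣ (k ℕ.∸ suc s) (λ C → subst (_≤ℚ 1ℚ) (sym (ℚ.0≤p⇒∣p∣≡p (ι≥0 (isFull C)))) (ι≤1 (isFull C)))) ∅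

  -- With ϱ = 1/r this is S(k,r) r! / r^k, the mean in the definition of the excess.
  level-0 : levelWeight 0 ≡ ϱ ^ k * ⟦ suc r′ ! ℕ.* stirling2 k (suc r′) ⟧
  level-0 = trans (U^-full ϱ w k ∅) (cong (λ x → ϱ ^ k * ⟦ x ⟧)
    (trans (cong₂ (hits k) (missing-∅ (suc r′)) (card-∅ (suc r′))) (cong (suc r′ ! ℕ.*_) (rStirling-0 k (suc r′)))))

  ∑-empty : ∀ {n} (e : Vec Bool n) t → ∑ (subs e) (λ S → ι (card S ℕ.≡ᵇ 0) * mono S t) ≡ 1ℚ
  ∑-empty []          t = trans (∑-∷ [] [] _) (trans (cong ((1ℚ * 1ℚ) +_) (∑-[] (λ S → ι (card S ℕ.≡ᵇ 0) * mono S t))) refl)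
  ∑-empty (false ∷ e) t = trans (∑-map (false ∷_) (subs e) (λ S → ι (card S ℕ.≡ᵇ 0) * mono S t)) (∑-empty e (t ∘ suc))
  ∑-empty (true ∷ e)  t = trans (∑-++ (List.map (false ∷_) (subs e)) _ (λ S → ι (card S ℕ.≡ᵇ 0) * mono S t)) (trans
    (cong₂ _+_ (trans (∑-map (false ∷_) (subs e) (λ S → ι (card S ℕ.≡ᵇ 0) * mono S t)) (∑-empty e (t ∘ suc)))
               (trans (∑-map (true ∷_) (subs e) (λ S → ι (card S ℕ.≡ᵇ 0) * mono S t)) (∑-zero (subs e) (λ {S} _ → ℚ.*-zeroˡ (t zero * mono S (t ∘ suc))))))
    (ℚ.+-identityʳ 1ℚ))

  -- Colour v independently with probabilities ϱ + t w i, which are nonnegative because |t| ≤ 1 and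
  -- |w i| ≤ ϱ; some colouring cuts at least the mean number of edges.
  cut-exists : ∀ {n} (es : List (Vec Bool n)) → All (λ e → card e ≡ k) es → ∀ t → (∀ i → ∣ t i ∣ ≤ℚ 1ℚ) →
    ∃[ fs ] excessForm γ es t + ⟦ length es ⟧ * levelWeight 0 ≤ℚ ∑ es (λ e → ι (isCutEdge (lookup fs) e))
  cut-exists {n} es unif t ∣t∣≤1 = finish (𝔼ᶜ-max μ μ≥0 (λ v → Σprobs Σw Σϱ (t v)) (λ fs → ∑ es (λ e → full (colours fs e ∅))))
    where
    μ : Fin n → Fin (suc r′) → ℚ
    μ v = probs Σw Σϱ (t v)
    μ≥0 : ∀ v i → 0ℚ ≤ℚ μ v i
    μ≥0 v i = subst (_≤ℚ μ v i) (ℚ.+-inverseʳ ϱ) (ℚ.+-monoʳ-≤ ϱ (ℚ.≤-trans (neg-anti ∣tw∣≤) (-∣∣≤ (t v * w i))))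
      where
      ∣tw∣≤ : ∣ t v * w i ∣ ≤ℚ ϱ
      ∣tw∣≤ = subst₂ _≤ℚ_ (sym (ℚ.∣p*q∣≡∣p∣*∣q∣ (t v) (w i))) (ℚ.*-identityˡ ϱ) (*-mono (ℚ.0≤∣p∣ (w i)) 0≤1 (∣t∣≤1 v) (∣w∣≤ϱ i))
    -- The term of the empty set, absent from γ, is carried separately and adds up to
    -- `levelWeight 0` per edge.
    split : ∀ s m → m * levelWeight s ≡ γ s * m + levelWeight 0 * (ι (s ℕ.≡ᵇ 0) * m)
    split zero    m = eq m (levelWeight 0)
      where
      eq : ∀ m l → m * l ≡ 0ℚ * m + l * (1ℚ * m)
      eq = solve-∀ ℚ-ring
    split (suc s) m = eq m (levelWeight (suc s)) (levelWeight 0)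
      where
      eq : ∀ m l z → m * l ≡ l * m + z * (0ℚ * m)
      eq = solve-∀ ℚ-ring
    mean : 𝔼ᶜ μ (λ fs → ∑ es (λ e → full (colours fs e ∅))) ≡ excessForm γ es t + ⟦ length es ⟧ * levelWeight 0
    mean = trans (𝔼ᶜ-∑ μ es (λ e fs → full (colours fs e ∅))) (trans (∑-cong es (λ {e} e∈ → per-edge e (All.lookup unif e∈)))
      (trans (∑-+ es (λ e → ∑ (subs e) (λ S → γ (card S) * mono S t)) (λ _ → levelWeight 0)) (cong (excessForm γ es t +_) (∑-const es (levelWeight 0)))))
      where
      per-edge : ∀ e → card e ≡ k → 𝔼ᶜ μ (λ fs → full (colours fs e ∅)) ≡ ∑ (subs e) (λ S → γ (card S) * mono S t) + levelWeight 0
      per-edge e c = trans (expansion Σw Σϱ t e full ∅) (trans (∑-cong (subs e) (λ {S} _ →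
          trans (cong (λ j → mono S t * W^ (card S) (U^ (j ℕ.∸ card S) full) ∅) c) (split (card S) (mono S t))))
        (trans (∑-+ (subs e) (λ S → γ (card S) * mono S t) (λ S → levelWeight 0 * (ι (card S ℕ.≡ᵇ 0) * mono S t)))
          (cong (∑ (subs e) (λ S → γ (card S) * mono S t) +_) (trans (∑-*ˡ (levelWeight 0) (subs e) (λ S → ι (card S ℕ.≡ᵇ 0) * mono S t))
            (trans (cong (levelWeight 0 *_) (∑-empty e t)) (ℚ.*-identityʳ (levelWeight 0)))))))
    finish : ∃[ fs ] 𝔼ᶜ μ (λ fs → ∑ es (λ e → full (colours fs e ∅))) ≤ℚ ∑ es (λ e → full (colours fs e ∅)) →
      ∃[ fs ] excessForm γ es t + ⟦ length es ⟧ * levelWeight 0 ≤ℚ ∑ es (λ e → ι (isCutEdge (lookup fs) e))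
    finish (fs , p) = fs , subst₂ _≤ℚ_ mean (∑-cong es (λ {e} _ → cong ι (sym (isCutEdge≡isFull fs e)))) p

record CutWeights (k r : ℕ) : Set where
  field
    coefficients : Coefficients
  open Coefficients coefficients public
  field
    top≤k  : suc ℓ ≤ k
    ϱ      : ℚ
    Σϱ     : ⟦ r ⟧ * ϱ ≡ 1ℚ
    exists : ∀ {n} (es : List (Vec Bool n)) → All (λ e → card e ≡ k) es → ∀ t → (∀ i → ∣ t i ∣ ≤ℚ 1ℚ) →
      ∃[ fs ] excessForm γ es t + ⟦ length es ⟧ * (ϱ ^ k * ⟦ r ! ℕ.* stirling2 k r ⟧) ≤ℚ ∑ es (λ e → ι (isCutEdge {r = r} (lookup fs) e))

-- Directions for three or more colours and for two

1/ℕ : ∀ r → ∃[ ϱ ] (0ℚ < ϱ × ⟦ suc r ⟧ * ϱ ≡ 1ℚ)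
1/ℕ r = recip (ℚ.<-≤-trans (ℚ.positive⁻¹ 1ℚ) (≤+ˡ 1ℚ (⟦⟧≥0 r)))

⟦⟧>0 : ∀ {n} → 1 ≤ n → 0ℚ < ⟦ n ⟧
⟦⟧>0 {suc n} _ = ℚ.<-≤-trans (ℚ.positive⁻¹ 1ℚ) (≤+ˡ 1ℚ (⟦⟧≥0 n))

neg<0 : ∀ {x} → 0ℚ < x → - x < 0ℚ
neg<0 p = ℚ.neg-antimono-< p

>0⇒≢0 : ∀ {x} → 0ℚ < x → x ≢ 0ℚ
>0⇒≢0 p e = ℚ.<-irrefl (sym e) p

<0⇒≢0 : ∀ {x} → x < 0ℚ → x ≢ 0ℚ
<0⇒≢0 p e = ℚ.<-irrefl e p

-- Direction (2, -1, -1, 0, …); its third level has positive weight.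
module ManyColours (k r : ℕ) (r≤k : 3 ℕ.+ r ≤ k) (ϱ : ℚ) (ϱ>0 : 0ℚ < ϱ) (Σϱ : ⟦ 3 ℕ.+ r ⟧ * ϱ ≡ 1ℚ) where

  -- With this scale the largest entry 2 ω equals ϱ, the most that keeps the probabilities
  -- nonnegative.
  ω : ℚ
  ω = ½ * ϱ

  ω>0 : 0ℚ < ω
  ω>0 = *>0 (ℚ.positive⁻¹ ½) ϱ>0

  ϱ≥0 : 0ℚ ≤ℚ ϱ
  ϱ≥0 = ℚ.<⇒≤ ϱ>0

  w : Fin (3 ℕ.+ r) → ℚ
  w zero                = 2ℚ * ω
  w (suc zero)          = - ω
  w (suc (suc zero))    = - ω
  w (suc (suc (suc i))) = 0ℚ

  sum-w : ∀ (f : ℚ → Fin (3 ℕ.+ r) → ℚ) → (∀ i → f 0ℚ i ≡ 0ℚ) →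
    ∑ (allFin (3 ℕ.+ r)) (λ i → f (w i) i) ≡ f (2ℚ * ω) zero + (f (- ω) (suc zero) + (f (- ω) (suc (suc zero)) + 0ℚ))
  sum-w f z = trans (∑-allFin-suc (2 ℕ.+ r) (λ i → f (w i) i)) (cong (f (2ℚ * ω) zero +_)
    (trans (∑-allFin-suc (suc r) (λ i → f (w (suc i)) (suc i))) (cong (f (- ω) (suc zero) +_)
    (trans (∑-allFin-suc r (λ i → f (w (suc (suc i))) (suc (suc i)))) (cong (f (- ω) (suc (suc zero)) +_)
      (∑-zero (allFin r) (λ {i} _ → z (suc (suc (suc i))))))))))

  open Operators ϱ w

  E : (Vec Bool (3 ℕ.+ r) → ℚ) → Vec Bool (3 ℕ.+ r) → ℚ
  E h C = ω * ((2ℚ * h (ins zero C) - h (ins (suc zero) C)) - h (ins (suc (suc zero)) C))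

  W≡E : ∀ h C → W h C ≡ E h C
  W≡E h C = trans (sum-w (λ v i → v * h (ins i C)) (λ i → ℚ.*-zeroˡ (h (ins i C)))) (eq ω (h (ins zero C)) (h (ins (suc zero) C)) (h (ins (suc (suc zero)) C)))
    where
    eq : ∀ ω a b c → (2ℚ * ω) * a + ((- ω) * b + ((- ω) * c + 0ℚ)) ≡ ω * ((2ℚ * a - b) - c)
    eq = solve-∀ ℚ-ring

  Σw : ∑ (allFin (3 ℕ.+ r)) w ≡ 0ℚ
  Σw = trans (sum-w (λ v i → v) (λ _ → refl)) (eq ω)
    where
    eq : ∀ ω → (2ℚ * ω) + ((- ω) + ((- ω) + 0ℚ)) ≡ 0ℚ
    eq = solve-∀ ℚ-ring

  ∣-ω∣ : ∣ - ω ∣ ≡ ω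
  ∣-ω∣ = trans (ℚ.∣-p∣≡∣p∣ ω) (ℚ.0≤p⇒∣p∣≡p (ℚ.<⇒≤ ω>0))

  2ω≡ϱ : 2ℚ * ω ≡ ϱ
  2ω≡ϱ = eq ϱ
    where
    eq : ∀ ϱ → 2ℚ * (½ * ϱ) ≡ ϱ
    eq = solve-∀ ℚ-ring

  ∣2ω∣ : ∣ 2ℚ * ω ∣ ≡ ϱ
  ∣2ω∣ = trans (cong ∣_∣ 2ω≡ϱ) (ℚ.0≤p⇒∣p∣≡p ϱ≥0)

  Σ∣w∣ : ∑ (allFin (3 ℕ.+ r)) (λ i → ∣ w i ∣) ≤ℚ 1ℚ
  Σ∣w∣ = ℚ.≤-trans (≡⇒≤ (trans (sum-w (λ v i → ∣ v ∣) (λ _ → refl)) (trans (cong₂ (λ a b → a + (b + (b + 0ℚ))) ∣2ω∣ ∣-ω∣) (eq ϱ))))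
    (subst (⟦ 2 ⟧ * ϱ ≤ℚ_) Σϱ (*-monoʳ ϱ≥0 (⟦⟧-mono {2} {3 ℕ.+ r} (s≤s (s≤s z≤n)))))
    where
    eq : ∀ ϱ → ϱ + (½ * ϱ + (½ * ϱ + 0ℚ)) ≡ (1ℚ + (1ℚ + 0ℚ)) * ϱ
    eq = solve-∀ ℚ-ring

  ω≤ϱ : ω ≤ℚ ϱ
  ω≤ϱ = subst (ω ≤ℚ_) 2ω≡ϱ (≤-diff (subst (0ℚ ≤ℚ_) (eq ω) (ℚ.<⇒≤ ω>0)))
    where
    eq : ∀ ω → ω ≡ 2ℚ * ω - ω
    eq = solve-∀ ℚ-ring

  ∣w∣≤ϱ : ∀ i → ∣ w i ∣ ≤ℚ ϱ
  ∣w∣≤ϱ zero                = ≡⇒≤ ∣2ω∣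
  ∣w∣≤ϱ (suc zero)          = ℚ.≤-trans (≡⇒≤ ∣-ω∣) ω≤ϱ
  ∣w∣≤ϱ (suc (suc zero))    = ℚ.≤-trans (≡⇒≤ ∣-ω∣) ω≤ϱ
  ∣w∣≤ϱ (suc (suc (suc i))) = ϱ≥0

  open Cut k ϱ w Σw Σϱ ϱ≥0 Σ∣w∣ ∣w∣≤ϱ

  E-cong : ∀ {h h′} → (∀ C → h C ≡ h′ C) → ∀ C → E h C ≡ E h′ C
  E-cong p C = cong₂ (λ a b → ω * (a - b)) (cong₂ (λ a b → 2ℚ * a - b) (p (ins zero C)) (p (ins (suc zero) C))) (p (ins (suc (suc zero)) C))

  -- The missing and present colours among the r colours of weight 0, at the empty set. They are
  -- kept unevaluated so that the ring identities meet syntactically equal terms.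
  m c : ℕ
  m = missing (∅ {r})
  c = card (∅ {r})

  m≡r : m ≡ r
  m≡r = missing-∅ r

  φ : ℕ → Vec Bool (3 ℕ.+ r) → ℚ
  φ j C = ϱ ^ j * ⟦ hits j (missing C) (card C) ⟧

  mass : ℕ → ℕ → ℕ → ℚ
  mass j a b = ϱ ^ j * ⟦ hits j a b ⟧

  mass-shift : ∀ j a b → mass j a (suc b) ≡ mass j a b + mass j (suc a) b
  mass-shift j a b = trans (cong (ϱ ^ j *_) (trans (cong ⟦_⟧ (hits-shift j a b)) (⟦⟧-+ (hits j a b) (hits j (suc a) b)))) (ℚ.*-distribˡ-+ (ϱ ^ j) ⟦ hits j a b ⟧ ⟦ hits j (suc a) b ⟧)

  mass>0 : ∀ j a b → a ≤ j → 0ℚ < mass j a (suc b)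
  mass>0 j a b p = *>0 (^>0 ϱ>0 j) (⟦⟧>0 (hits>0 j a b p))

  γ₁ : γ 1 ≡ 0ℚ
  γ₁ = trans (W-cong (U^-full ϱ w (k ℕ.∸ 1)) ∅) (trans (W≡E (φ (k ℕ.∸ 1)) ∅) (eq ω (mass (k ℕ.∸ 1) (2 ℕ.+ m) (1 ℕ.+ c))))
    where
    eq : ∀ ω x1 → (ω * ((2ℚ * x1 - x1) - x1)) ≡ 0ℚ
    eq = solve-∀ ℚ-ring

  -- Two equal insertions have total weight 6 ω², two distinct ones -6 ω² because the entries of w
  -- sum to zero. Seeing two distinct colours makes completion likelier, by exactly the mass on the
  -- right.
  γ₂ : γ 2 ≡ - ((2ℚ * (3ℚ * (ω * ω))) * mass (k ℕ.∸ 2) (1 ℕ.+ m) (1 ℕ.+ c))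
  γ₂ = trans (W-cong (W-cong (U^-full ϱ w j)) ∅) (trans (trans (W≡E (W (φ j)) ∅) (E-cong (W≡E (φ j)) ∅))
    (trans (eq ω x1 x2) (trans (cong (λ z → (2ℚ * (3ℚ * (ω * ω))) * (x1 - z)) (mass-shift j (1 ℕ.+ m) (1 ℕ.+ c))) (eq′ (2ℚ * (3ℚ * (ω * ω))) x1 (mass j (1 ℕ.+ m) (1 ℕ.+ c))))))
    where
    j = k ℕ.∸ 2
    x1 = mass j (2 ℕ.+ m) (1 ℕ.+ c)
    x2 = mass j (1 ℕ.+ m) (2 ℕ.+ c)
    eq : ∀ ω x1 x2 → (ω * ((2ℚ * (ω * ((2ℚ * x1 - x2) - x2)) - (ω * ((2ℚ * x2 - x1) - x2))) - (ω * ((2ℚ * x2 - x2) - x1)))) ≡ (2ℚ * (3ℚ * (ω * ω))) * (x1 - x2)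
    eq = solve-∀ ℚ-ring
    eq′ : ∀ s x y → s * (x - (y + x)) ≡ - (s * y)
    eq′ = solve-∀ ℚ-ring

  -- Sequences with one, two and three distinct colours have total weights 6, -18 and 12 times ω³.
  -- The combination x1 - 3 x2 + 2 x3 becomes a sum of two masses after splitting by further colours
  -- hit or missed.
  γ₃ : γ 3 ≡ (2ℚ * (3ℚ * (ω * (ω * ω)))) * (mass (k ℕ.∸ 3) m (2 ℕ.+ c) + mass (k ℕ.∸ 3) m (1 ℕ.+ c))
  γ₃ = trans (W-cong (W-cong (W-cong (U^-full ϱ w j))) ∅) (trans (trans (W≡E (W (W (φ j))) ∅) (E-cong (λ C → trans (W≡E (W (φ j)) C) (E-cong (W≡E (φ j)) C)) ∅))
    (trans (eq ω x1 x2 x3) (cong ((2ℚ * (3ℚ * (ω * (ω * ω)))) *_) (combine x1 x2 x3 (mass j m (2 ℕ.+ c)) (mass j m (1 ℕ.+ c)) (mass j (1 ℕ.+ m) (1 ℕ.+ c))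
      (mass-shift j (1 ℕ.+ m) (1 ℕ.+ c)) (mass-shift j m (2 ℕ.+ c)) (mass-shift j m (1 ℕ.+ c))))))
    where
    j = k ℕ.∸ 3
    x1 = mass j (2 ℕ.+ m) (1 ℕ.+ c)
    x2 = mass j (1 ℕ.+ m) (2 ℕ.+ c)
    x3 = mass j m (3 ℕ.+ c)
    eq : ∀ ω x1 x2 x3 → (ω * ((2ℚ * (ω * ((2ℚ * (ω * ((2ℚ * x1 - x2) - x2)) - (ω * ((2ℚ * x2 - x2) - x3))) - (ω * ((2ℚ * x2 - x3) - x2)))) - (ω * ((2ℚ * (ω * ((2ℚ * x2 - x2) - x3)) - (ω * ((2ℚ * x2 - x1) - x2))) - (ω * ((2ℚ * x3 - x2) - x2))))) - (ω * ((2ℚ * (ω * ((2ℚ * x2 - x3) - x2)) - (ω * ((2ℚ * x3 - x2) - x2))) - (ω * ((2ℚ * x2 - x2) - x1)))))) ≡ (2ℚ * (3ℚ * (ω * (ω * ω)))) * ((x1 - 3ℚ * x2) + 2ℚ * x3)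
    eq = solve-∀ ℚ-ring
    combine : ∀ x1 x2 x3 X Z Y → x2 ≡ Y + x1 → x3 ≡ X + x2 → X ≡ Z + Y → (x1 - 3ℚ * x2) + 2ℚ * x3 ≡ X + Z
    combine x1 _ _ _ Z Y refl refl refl = eq″ x1 Z Y
      where
      eq″ : ∀ x Z Y → (x - 3ℚ * (Y + x)) + 2ℚ * ((Z + Y) + (Y + x)) ≡ (Z + Y) + Z
      eq″ = solve-∀ ℚ-ring

  cutWeights : CutWeights k (3 ℕ.+ r)
  cutWeights = record
    { coefficients = record
      { γ = γ ; Γ = 1ℚ ; ℓ = 2 ; γ₀ = refl ; γ₁ = γ₁
      ; γ₂<0 = subst (_< 0ℚ) (sym γ₂) (neg<0 (*>0 (*>0 (ℚ.positive⁻¹ 2ℚ) (*>0 (ℚ.positive⁻¹ 3ℚ) (*>0 ω>0 ω>0)))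
          (mass>0 (k ℕ.∸ 2) (1 ℕ.+ m) c (subst (λ z → suc z ≤ k ℕ.∸ 2) (sym m≡r) (ℕ.∸-monoˡ-≤ 2 r≤k)))))
      ; ∣γ∣≤Γ = ∣γ∣≤1 ; 2≤ℓ = ℕ.≤-refl
      ; γtop≢0 = >0⇒≢0 (subst (0ℚ <_) (sym γ₃) (*>0 (*>0 (ℚ.positive⁻¹ 2ℚ) (*>0 (ℚ.positive⁻¹ 3ℚ) (*>0 ω>0 (*>0 ω>0 ω>0))))
          (+>0ˡ (mass>0 (k ℕ.∸ 3) m (suc c) m≤) (ℚ.<⇒≤ (mass>0 (k ℕ.∸ 3) m c m≤))))) }
    ; top≤k = ℕ.≤-trans (s≤s (s≤s (s≤s z≤n))) r≤k
    ; ϱ = ϱ ; Σϱ = Σϱ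
    ; exists = λ es unif t b → subst (λ z → ∃[ fs ] excessForm γ es t + ⟦ length es ⟧ * z ≤ℚ ∑ es (λ e → ι (isCutEdge (lookup fs) e))) level-0 (cut-exists es unif t b) }
    where
    m≤ : m ≤ k ℕ.∸ 3
    m≤ = subst (_≤ k ℕ.∸ 3) (sym m≡r) (ℕ.∸-monoˡ-≤ 3 r≤k)

-- Direction (1, -1); odd levels vanish, so the fourth level is used.
module TwoColours (k : ℕ) (4≤k : 4 ≤ k) (ϱ : ℚ) (ϱ>0 : 0ℚ < ϱ) (Σϱ : ⟦ 2 ⟧ * ϱ ≡ 1ℚ) where

  ω : ℚ
  ω = ½ * ϱ

  ω>0 : 0ℚ < ω
  ω>0 = *>0 (ℚ.positive⁻¹ ½) ϱ>0

  ϱ≥0 : 0ℚ ≤ℚ ϱ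
  ϱ≥0 = ℚ.<⇒≤ ϱ>0

  w : Fin 2 → ℚ
  w zero       = ω
  w (suc zero) = - ω

  sum₂ : ∀ (f : Fin 2 → ℚ) → ∑ (allFin 2) f ≡ f zero + (f (suc zero) + 0ℚ)
  sum₂ f = trans (∑-allFin-suc 1 f) (cong (f zero +_) (trans (∑-allFin-suc 0 (f ∘ suc)) (cong (f (suc zero) +_) (∑-[] _))))

  open Operators ϱ w

  E : (Vec Bool 2 → ℚ) → Vec Bool 2 → ℚ
  E h C = ω * (h (ins zero C) - h (ins (suc zero) C))

  W≡E : ∀ h C → W h C ≡ E h C
  W≡E h C = trans (sum₂ (λ i → w i * h (ins i C))) (eq ω (h (ins zero C)) (h (ins (suc zero) C)))
    where
    eq : ∀ ω a b → ω * a + ((- ω) * b + 0ℚ) ≡ ω * (a - b)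
    eq = solve-∀ ℚ-ring

  Σw : ∑ (allFin 2) w ≡ 0ℚ
  Σw = trans (sum₂ w) (eq ω)
    where
    eq : ∀ ω → ω + ((- ω) + 0ℚ) ≡ 0ℚ
    eq = solve-∀ ℚ-ring

  ∣ω∣ : ∣ ω ∣ ≡ ω
  ∣ω∣ = ℚ.0≤p⇒∣p∣≡p (ℚ.<⇒≤ ω>0)

  ∣-ω∣ : ∣ - ω ∣ ≡ ω
  ∣-ω∣ = trans (ℚ.∣-p∣≡∣p∣ ω) ∣ω∣

  ω≤ϱ : ω ≤ℚ ϱ
  ω≤ϱ = ≤-diff (subst (0ℚ ≤ℚ_) (eq ϱ) (ℚ.<⇒≤ ω>0))
    where
    eq : ∀ ϱ → ½ * ϱ ≡ ϱ - ½ * ϱ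
    eq = solve-∀ ℚ-ring

  Σ∣w∣ : ∑ (allFin 2) (λ i → ∣ w i ∣) ≤ℚ 1ℚ
  Σ∣w∣ = ℚ.≤-trans (≡⇒≤ (trans (sum₂ (λ i → ∣ w i ∣)) (trans (cong₂ (λ a b → a + (b + 0ℚ)) ∣ω∣ ∣-ω∣) (eq ϱ))))
    (subst (ϱ ≤ℚ_) Σϱ (subst (_≤ℚ ⟦ 2 ⟧ * ϱ) (ℚ.*-identityˡ ϱ) (*-monoʳ ϱ≥0 (≤+ˡ 1ℚ (⟦⟧≥0 1)))))
    where
    eq : ∀ ϱ → ½ * ϱ + (½ * ϱ + 0ℚ) ≡ ϱ
    eq = solve-∀ ℚ-ring

  ∣w∣≤ϱ : ∀ i → ∣ w i ∣ ≤ℚ ϱ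
  ∣w∣≤ϱ zero       = ℚ.≤-trans (≡⇒≤ ∣ω∣) ω≤ϱ
  ∣w∣≤ϱ (suc zero) = ℚ.≤-trans (≡⇒≤ ∣-ω∣) ω≤ϱ

  open Cut k ϱ w Σw Σϱ ϱ≥0 Σ∣w∣ ∣w∣≤ϱ

  E-cong : ∀ {h h′} → (∀ C → h C ≡ h′ C) → ∀ C → E h C ≡ E h′ C
  E-cong p C = cong₂ (λ a b → ω * (a - b)) (p (ins zero C)) (p (ins (suc zero) C))

  φ : ℕ → Vec Bool 2 → ℚ
  φ j C = ϱ ^ j * ⟦ hits j (missing C) (card C) ⟧

  mass : ℕ → ℕ → ℕ → ℚ
  mass j a b = ϱ ^ j * ⟦ hits j a b ⟧

  mass-shift : ∀ j → mass j 0 2 ≡ mass j 0 1 + mass j 1 1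
  mass-shift j = trans (cong (ϱ ^ j *_) (trans (cong ⟦_⟧ (hits-shift j 0 1)) (⟦⟧-+ (hits j 0 1) (hits j 1 1)))) (ℚ.*-distribˡ-+ (ϱ ^ j) ⟦ hits j 0 1 ⟧ ⟦ hits j 1 1 ⟧)

  mass>0 : ∀ j → 0ℚ < mass j 0 1
  mass>0 j = *>0 (^>0 ϱ>0 j) (⟦⟧>0 (hits>0 j 0 0 z≤n))

  γ₁ : γ 1 ≡ 0ℚ
  γ₁ = trans (W-cong (U^-full ϱ w (k ℕ.∸ 1)) ∅) (trans (W≡E (φ (k ℕ.∸ 1)) ∅) (eq ω (mass (k ℕ.∸ 1) 1 1)))
    where
    eq : ∀ ω x1 → (ω * (x1 - x1)) ≡ 0ℚ
    eq = solve-∀ ℚ-ring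

  γ₂ : γ 2 ≡ - ((2ℚ * (ω * ω)) * mass (k ℕ.∸ 2) 0 1)
  γ₂ = trans (W-cong (W-cong (U^-full ϱ w j)) ∅) (trans (trans (W≡E (W (φ j)) ∅) (E-cong (W≡E (φ j)) ∅))
    (trans (cong (λ x2 → (ω * ((ω * (x1 - x2)) - (ω * (x2 - x1))))) (mass-shift j)) (eq ω x1 (mass j 0 1))))
    where
    j = k ℕ.∸ 2
    x1 = mass j 1 1
    eq : ∀ ω x1 y → (ω * ((ω * (x1 - (y + x1))) - (ω * ((y + x1) - x1)))) ≡ - ((2ℚ * (ω * ω)) * y)
    eq = solve-∀ ℚ-ring

  -- Of the sixteen sequences only the two constant ones leave a colour missing. Both have positive
  -- sign, and as all signs sum to zero the others have total weight -2 ω⁴.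
  γ₄ : γ 4 ≡ - ((2ℚ * ((ω * ω) * (ω * ω))) * mass (k ℕ.∸ 4) 0 1)
  γ₄ = trans (W-cong (W-cong (W-cong (W-cong (U^-full ϱ w j)))) ∅) (trans (trans (W≡E (W (W (W (φ j)))) ∅) (E-cong (λ C → trans (W≡E (W (W (φ j))) C)
      (E-cong (λ C → trans (W≡E (W (φ j)) C) (E-cong (W≡E (φ j)) C)) C)) ∅))
    (trans (cong (λ x2 → (ω * ((ω * ((ω * ((ω * (x1 - x2)) - (ω * (x2 - x2)))) - (ω * ((ω * (x2 - x2)) - (ω * (x2 - x2)))))) - (ω * ((ω * ((ω * (x2 - x2)) - (ω * (x2 - x2)))) - (ω * ((ω * (x2 - x2)) - (ω * (x2 - x1))))))))) (mass-shift j)) (eq ω x1 (mass j 0 1))))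
    where
    j = k ℕ.∸ 4
    x1 = mass j 1 1
    eq : ∀ ω x1 y → (ω * ((ω * ((ω * ((ω * (x1 - (y + x1))) - (ω * ((y + x1) - (y + x1))))) - (ω * ((ω * ((y + x1) - (y + x1))) - (ω * ((y + x1) - (y + x1))))))) - (ω * ((ω * ((ω * ((y + x1) - (y + x1))) - (ω * ((y + x1) - (y + x1))))) - (ω * ((ω * ((y + x1) - (y + x1))) - (ω * ((y + x1) - x1)))))))) ≡ - ((2ℚ * ((ω * ω) * (ω * ω))) * y)
    eq = solve-∀ ℚ-ring

  cutWeights : CutWeights k 2
  cutWeights = record
    { coefficients = record
      { γ = γ ; Γ = 1ℚ ; ℓ = 3 ; γ₀ = refl ; γ₁ = γ₁
      ; γ₂<0 = subst (_< 0ℚ) (sym γ₂) (neg<0 (*>0 (*>0 (ℚ.positive⁻¹ 2ℚ) (*>0 ω>0 ω>0)) (mass>0 (k ℕ.∸ 2))))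
      ; ∣γ∣≤Γ = ∣γ∣≤1 ; 2≤ℓ = s≤s (s≤s z≤n)
      ; γtop≢0 = <0⇒≢0 (subst (_< 0ℚ) (sym γ₄) (neg<0 (*>0 (*>0 (ℚ.positive⁻¹ 2ℚ) (*>0 (*>0 ω>0 ω>0) (*>0 ω>0 ω>0))) (mass>0 (k ℕ.∸ 4))))) }
    ; top≤k = 4≤k
    ; ϱ = ϱ ; Σϱ = Σϱ
    ; exists = λ es unif t b → subst (λ z → ∃[ fs ] excessForm γ es t + ⟦ length es ⟧ * z ≤ℚ ∑ es (λ e → ι (isCutEdge (lookup fs) e))) level-0 (cut-exists es unif t b) }

-- Fractions, ninth roots and the conclusion

toℚᵘ-⟦⟧ : ∀ a → ℚ.toℚᵘ ⟦ a ⟧ ℚᵘ.≃ ℚᵘ.mkℚᵘ (ℤ.+ a) 0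
toℚᵘ-⟦⟧ zero    = ℚᵘ.≃-refl
toℚᵘ-⟦⟧ (suc a) = ℚᵘ.≃-trans (ℚ.toℚᵘ-homo-+ 1ℚ ⟦ a ⟧) (ℚᵘ.≃-trans (ℚᵘ.+-congʳ ℚᵘ.1ℚᵘ (toℚᵘ-⟦⟧ a))
  (ℚᵘ.*≡* (cong (λ z → (ℤ.+ 1 ℤ.+ z) ℤ.* ℤ.1ℤ) (ℤ.*-identityʳ (ℤ.+ a)))))

-- Among unnormalised rationals equality is cross-multiplication, which avoids reasoning about
-- greatest common divisors.
/ℕ-* : ∀ a d → (a /ℕ suc d) * ⟦ suc d ⟧ ≡ ⟦ a ⟧
/ℕ-* a d = ℚ.toℚᵘ-injective (ℚᵘ.≃-trans (ℚ.toℚᵘ-homo-* (a /ℕ suc d) ⟦ suc d ⟧)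
  (ℚᵘ.≃-trans (ℚᵘ.*-cong (ℚ.toℚᵘ-fromℚᵘ (ℚᵘ.mkℚᵘ (ℤ.+ a) d)) (toℚᵘ-⟦⟧ (suc d)))
  (ℚᵘ.≃-trans (ℚᵘ.*≡* (trans (ℤ.*-identityʳ _) (cong (λ z → (ℤ.+ a) ℤ.* (ℤ.+ z)) (sym (ℕ.*-identityʳ (suc d))))))
  (ℚᵘ.≃-sym (toℚᵘ-⟦⟧ a)))))

/ℕ-1 : ∀ a → a /ℕ 1 ≡ ⟦ a ⟧
/ℕ-1 a = trans (sym (trans (cong (a /ℕ 1 *_) (ℚ.+-identityʳ 1ℚ)) (ℚ.*-identityʳ (a /ℕ 1)))) (/ℕ-* a 0)

/ℕ-inverse : ∀ a d {y} → ⟦ d ⟧ * y ≡ 1ℚ → a /ℕ d ≡ y * ⟦ a ⟧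
-- The convention a / 0 = 0 never enters: 0 has no inverse y.
/ℕ-inverse a zero    {y} p with trans (sym (ℚ.*-zeroˡ y)) p
... | ()
/ℕ-inverse a (suc d) {y} p = trans (sym (ℚ.*-identityʳ (a /ℕ suc d))) (trans (cong (a /ℕ suc d *_) (sym p))
  (trans (sym (ℚ.*-assoc (a /ℕ suc d) ⟦ suc d ⟧ y)) (trans (cong (_* y) (/ℕ-* a d)) (ℚ.*-comm ⟦ a ⟧ y))))

^-comm : ∀ x a b → (x ^ a) ^ b ≡ (x ^ b) ^ a
^-comm x a zero    = sym (1^ a)
^-comm x a (suc b) = trans (cong (x ^ a *_) (^-comm x a b)) (sym (^-*-distrib x (x ^ b) a))

ninth-root : ∀ m → ∃[ d ] (d ℕ.^ 9 ≤ m × m ℕ.< suc d ℕ.^ 9)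
ninth-root zero = 0 , z≤n , s≤s z≤n
ninth-root (suc m) with ninth-root m
... | d , lo , hi with suc d ℕ.^ 9 ℕ.≤? suc m
...   | yes p = suc d , p , ℕ.≤-<-trans hi (ℕ.^-monoˡ-< 9 (ℕ.n<1+n (suc d)))
...   | no ¬p = d , ℕ.m≤n⇒m≤1+n lo , ℕ.≰⇒> ¬p

ninth≡ : ∀ p → ninth p ≡ p ^ 9
ninth≡ = eq
  where
  eq : ∀ p → ((p * p) * (p * p)) * (p * ((p * p) * (p * p))) ≡ p * (p * (p * (p * (p * (p * (p * (p * (p * 1ℚ))))))))
  eq = solve-∀ ℚ-ring

-- For d ≥ 1 the successor of d is at most 2 d; for d = 0 also m = 0.
double-ninth : ∀ m d → m ℕ.< suc d ℕ.^ 9 → d ℕ.^ 9 ≤ m → ⟦ m ⟧ ≤ℚ 2ℚ ^ 9 * ninth ⟦ d ⟧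
double-ninth zero    zero    (s≤s z≤n) lo = ℚ.≤-refl
double-ninth (suc m) zero    (s≤s ()) lo
double-ninth m       (suc d) hi lo = subst (⟦ m ⟧ ≤ℚ_) (trans (⟦⟧-^ (2 ℕ.* suc d) 9) (trans (cong (_^ 9) (⟦⟧-* 2 (suc d)))
    (trans (^-*-distrib 2ℚ ⟦ suc d ⟧ 9) (cong (2ℚ ^ 9 *_) (sym (ninth≡ ⟦ suc d ⟧))))))
  (⟦⟧-mono (ℕ.≤-trans (ℕ.<⇒≤ hi) (ℕ.^-monoˡ-≤ 9 (ℕ.≤-trans (ℕ.+-monoʳ-≤ 1 (ℕ.m≤n+m (suc d) d)) (ℕ.≤-reflexive (cong (λ x → suc d ℕ.+ x) (sym (ℕ.+-identityʳ (suc d)))))))))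

module Final {k r : ℕ} (weights : CutWeights k r) where

  open CutWeights weights

  ϱ^k : ⟦ r ℕ.^ k ⟧ * ϱ ^ k ≡ 1ℚ
  ϱ^k = trans (cong (_* ϱ ^ k) (⟦⟧-^ r k)) (trans (sym (^-*-distrib ⟦ r ⟧ ϱ k)) (trans (cong (_^ k) Σϱ) (1^ k)))

  module _ (H : Hypergraph k) where

    m : ℚ
    m = ⟦ numEdges H ⟧

    excess-bound : ∀ t → (∀ i → ∣ t i ∣ ≤ℚ 1ℚ) → ∃[ f ] excessForm γ (edges H) t ≤ℚ excess H r f
    excess-bound t b = finish (exists (edges H) (uniform H) t b)
      where
      E = excessForm γ (edges H) t
      p = ϱ ^ k * ⟦ r ! ℕ.* stirling2 k r ⟧
      average : (stirling2 k r ℕ.* (r !) ℕ.* numEdges H) /ℕ (r ℕ.^ k) ≡ m * p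
      average = trans (/ℕ-inverse (stirling2 k r ℕ.* (r !) ℕ.* numEdges H) (r ℕ.^ k) ϱ^k)
        (trans (cong (ϱ ^ k *_) (trans (⟦⟧-* (stirling2 k r ℕ.* (r !)) (numEdges H)) (cong (λ x → ⟦ x ⟧ * m) (ℕ.*-comm (stirling2 k r) (r !)))))
          (eq (ϱ ^ k) ⟦ r ! ℕ.* stirling2 k r ⟧ m))
        where
        eq : ∀ a b c → a * (b * c) ≡ c * (a * b)
        eq = solve-∀ ℚ-ring
      finish : ∃[ fs ] E + m * p ≤ℚ ∑ (edges H) (λ e → ι (isCutEdge {r = r} (lookup fs) e)) → ∃[ f ] E ≤ℚ excess H r f
      finish (fs , q) = lookup fs , subst₂ _≤ℚ_ (eq E (m * p))
        (cong₂ _-_ (trans (sym (⟦length-filter⟧ (isCutEdge (lookup fs)) (edges H))) (sym (/ℕ-1 (cutSize H (lookup fs))))) (sym average))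
        (ℚ.+-monoˡ-≤ (- (m * p)) q)
        where
        eq : ∀ a b → (a + b) - b ≡ a
        eq = solve-∀ ℚ-ring

  -- The bound c m^{5/9} raised to the ninth power, so that it can be stated over ℚ; for a
  -- nonnegative excess and a positive c nothing is lost.
  LargeExcess : ℚ → Set
  LargeExcess c = (H : Hypergraph k) → ∃[ f ] (0ℚ ≤ℚ excess H r f ×
    (c ^ℚ 9) * ((numEdges H /ℕ 1) ^ℚ 5) ≤ℚ (excess H r f) ^ℚ 9)

  large-excess : ∃[ c ] (0ℚ < c × LargeExcess c)
  large-excess = scale (large-form coefficients k top≤k {2ℚ ^ 9} (^>0 (ℚ.positive⁻¹ 2ℚ) 9))
    where
    open ℚ.≤-Reasoning
    scale : ∃[ c ] (0ℚ < c × LargeForm coefficients k top≤k (2ℚ ^ 9) c) → ∃[ c ] (0ℚ < c × LargeExcess c)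
    -- From m ≤ (2 p)⁹ follows m^{5/9} ≤ 32 p⁵, hence the factor ½⁵.
    scale (c , c>0 , large) = c * ½ ^ 5 , *>0 c>0 (^>0 (ℚ.positive⁻¹ ½) 5) , bound
      where
      bound : LargeExcess (c * ½ ^ 5)
      bound H = from-root (ninth-root (numEdges H))
        where
        from-root : ∃[ d ] (d ℕ.^ 9 ≤ numEdges H × numEdges H ℕ.< suc d ℕ.^ 9) → ∃[ f ] (0ℚ ≤ℚ excess H r f ×
          ((c * ½ ^ 5) ^ℚ 9) * ((numEdges H /ℕ 1) ^ℚ 5) ≤ℚ (excess H r f) ^ℚ 9)
        from-root (d , lo , hi) = from-weights (large (edges H) (uniform H) d
            (subst (_≤ℚ ⟦ numEdges H ⟧) (trans (⟦⟧-^ d 9) (sym (ninth≡ ⟦ d ⟧))) (⟦⟧-mono lo)) m≤)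
          where
          p = ⟦ d ⟧
          m≤ : ⟦ numEdges H ⟧ ≤ℚ 2ℚ ^ 9 * ninth p
          m≤ = double-ninth (numEdges H) d hi lo
          target≥0 : 0ℚ ≤ℚ c * fifth p
          target≥0 = *≥0 (ℚ.<⇒≤ c>0) (*≥0 (⟦⟧≥0 d) (sq≥0 (p * p)))
          from-cut : ∃[ f ] c * fifth p ≤ℚ excess H r f → ∃[ f ] (0ℚ ≤ℚ excess H r f ×
            ((c * ½ ^ 5) ^ℚ 9) * ((numEdges H /ℕ 1) ^ℚ 5) ≤ℚ (excess H r f) ^ℚ 9)
          from-cut (f , q) = f , ℚ.≤-trans target≥0 q , (begin
            (c * ½ ^ 5) ^ 9 * (numEdges H /ℕ 1) ^ 5
              ≡⟨ cong (λ x → (c * ½ ^ 5) ^ 9 * x ^ 5) (/ℕ-1 (numEdges H)) ⟩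
            (c * ½ ^ 5) ^ 9 * ⟦ numEdges H ⟧ ^ 5
              ≤⟨ *-monoˡ (^≥0 (*≥0 (ℚ.<⇒≤ c>0) (^≥0 0≤½ 5)) 9) (^-mono (⟦⟧≥0 (numEdges H)) m≤ 5) ⟩
            (c * ½ ^ 5) ^ 9 * (2ℚ ^ 9 * ninth p) ^ 5
              ≡⟨ cong (λ x → (c * ½ ^ 5) ^ 9 * x ^ 5) (trans (cong (2ℚ ^ 9 *_) (ninth≡ p)) (sym (^-*-distrib 2ℚ p 9))) ⟩
            (c * ½ ^ 5) ^ 9 * ((2ℚ * p) ^ 9) ^ 5
              ≡⟨ trans (cong ((c * ½ ^ 5) ^ 9 *_) (^-comm (2ℚ * p) 9 5)) (sym (^-*-distrib (c * ½ ^ 5) ((2ℚ * p) ^ 5) 9)) ⟩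
            ((c * ½ ^ 5) * (2ℚ * p) ^ 5) ^ 9
              ≡⟨ cong (_^ 9) (eq c p) ⟩
            (c * fifth p) ^ 9
              ≤⟨ ^-mono target≥0 q 9 ⟩
            (excess H r f) ^ 9 ∎)
            where
            eq : ∀ c p → (c * (½ * (½ * (½ * (½ * (½ * 1ℚ)))))) * ((2ℚ * p) * ((2ℚ * p) * ((2ℚ * p) * ((2ℚ * p) * ((2ℚ * p) * 1ℚ))))) ≡ c * (p * ((p * p) * (p * p)))
            eq = solve-∀ ℚ-ring
          from-weights : ∃[ t ] ((∀ i → ∣ t i ∣ ≤ℚ 1ℚ) × c * fifth p ≤ℚ excessForm γ (edges H) t) → ∃[ f ] (0ℚ ≤ℚ excess H r f ×
            ((c * ½ ^ 5) ^ℚ 9) * ((numEdges H /ℕ 1) ^ℚ 5) ≤ℚ (excess H r f) ^ℚ 9)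
          from-weights (t , b , q) = from-cut (combine (excess-bound H t b))
            where
            combine : ∃[ f ] excessForm γ (edges H) t ≤ℚ excess H r f → ∃[ f ] c * fifth p ≤ℚ excess H r f
            combine (f , q′) = f , ℚ.≤-trans q q′

cutWeights : ∀ k r → 2 ≤ r → r ≤ k → 3 ≤ r ⊎ 4 ≤ k → CutWeights k r
cutWeights k 2 _ _ (inj₁ (s≤s (s≤s ())))
cutWeights k 2 _ _ (inj₂ 4≤k) = many (1/ℕ 1)
  where
  many : ∃[ ϱ ] (0ℚ < ϱ × ⟦ 2 ⟧ * ϱ ≡ 1ℚ) → CutWeights k 2
  many (ϱ , ϱ>0 , Σϱ) = TwoColours.cutWeights k 4≤k ϱ ϱ>0 Σϱ
cutWeights k (suc (suc (suc r))) _ r≤k _ = many (1/ℕ (2 ℕ.+ r))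
  where
  many : ∃[ ϱ ] (0ℚ < ϱ × ⟦ 3 ℕ.+ r ⟧ * ϱ ≡ 1ℚ) → CutWeights k (3 ℕ.+ r)
  many (ϱ , ϱ>0 , Σϱ) = ManyColours.cutWeights k r r≤k ϱ ϱ>0 Σϱ
cutWeights k 1 (s≤s ()) _ _

theorem1p2 : (k r : ℕ) → 2 ≤ r → r ≤ k → (3 ≤ r ⊎ 4 ≤ k) →
    ∃[ c ] (0ℚ < c ×
    ((H : Hypergraph k) → ∃[ f ] (0ℚ ≤ℚ excess H r f ×
    (c ^ℚ 9) * ((numEdges H /ℕ 1) ^ℚ 5) ≤ℚ (excess H r f) ^ℚ 9)))
theorem1p2 k r 2≤r r≤k h = Final.large-excess (cutWeights k r 2≤r r≤k h)
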